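{- A hypergraph language (a set, closed under isomorphism, of hypergraphs over a finite $\Sigma$-typed alphabet $T$, all of the same type $X\subseteq\Sigma$) is generated by some hypergraph $\mathrm{ILL}1$ grammar if and only if it is recursively enumerable.
   Context: $\mathrm{ILL}1$ is first-order intuitionistic linear logic (connectives $\otimes,\multimap,\wedge,\vee,{!}$, constants $0,1,\top$, quantifiers; atomic formulas are predicate symbols applied to variables, no function symbols or constants), standard sequent calculus with multiset antecedents and single succedent. $\mathrm{FVar}(A)$ is the set of free variables of $A$ and $A[h]$ denotes substitution. Fix a countable set $\Sigma$ of selectors, identified with variables. A $\Sigma$-typed alphabet is a set $C$ with $\mathrm{type}(c)$ a finite subset of $\Sigma$ for each $c$; each $c$ is a predicate symbol of arity $|\mathrm{type}(c)|$ with a fixed enumeration $\mathrm{type}(c)=\{\sigma_1,\dots,\sigma_n\}$, and for $h:\mathrm{type}(c)\to\mathrm{Var}$, $c[h]:=c(h(\sigma_1),\dots,h(\sigma_n))$; a formula $A$ with $\mathrm{FVar}(A)\subseteq\mathrm{type}(c)$ is substituted likewise. A hypergraph over $C$ is $H=\langle V_H,E_H,\mathit{lab}_H,\mathit{att}_H,\mathit{ext}_H\rangle$: finite node set $V_H$ (nodes are also regarded as variables), finite hyperedge set $E_H$, $\mathit{lab}_H:E_H\to C$, $\mathit{att}_H(e):\mathrm{type}(\mathit{lab}_H(e))\to V_H$, and $\mathit{ext}_H:\mathrm{type}(H)\to V_H$ with $\mathrm{type}(H)\subseteq\Sigma$. Fix a variable $x_\bullet$ and a symbol $\bullet$. A hypergraph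 $\mathrm{ILL}1$ grammar is $\mathcal{G}=\langle T,S,X,\triangleright\rangle$ where $T$ is a finite $\Sigma$-typed alphabet, $\triangleright\subseteq(T\cup\{\bullet\})\times\mathrm{Fm}(\mathrm{ILL}1)$ is a finite relation with $a\triangleright A\Rightarrow\mathrm{FVar}(A)\subseteq\mathrm{type}(a)$ and $\bullet\triangleright A\Rightarrow\mathrm{FVar}(A)\subseteq\{x_\bullet\}$, and $S$ is a formula with $\mathrm{FVar}(S)\subseteq X\subseteq\Sigma$. $H\in L(\mathcal{G})$ iff $\mathrm{type}(H)=X$ and there are $h_V:V_H\to\mathrm{Fm}$, $h_E:E_H\to\mathrm{Fm}$ with $\bullet\triangleright h_V(v)$ for all $v$, $\mathit{lab}_H(e)\triangleright h_E(e)$ for all $e$, such that $\{h_E(e)[\mathit{att}_H(e)]\mid e\in E_H\},\{h_V(v)[v/x_\bullet]\mid v\in V_H\}\vdash S[\mathit{ext}_H]$ is derivable in $\mathrm{ILL}1$. -}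

module Defs where

open import Data.Nat using (ℕ; zero; suc; _+_; _<_)
open import Data.Nat.Properties using (_≟_)
open import Data.Fin using (Fin; zero; suc; toℕ; cast)
open import Data.Vec using (Vec; []; _∷_)
open import Data.List using (List; []; _∷_; _++_; map; concatMap; length; tabulate)
open import Data.List.Membership.Propositional using (_∈_; _∉_)
open import Data.List.Relation.Unary.All using (All)
open import Data.List.Relation.Unary.Unique.Propositional using (Unique)
open import Data.List.Relation.Binary.Permutation.Propositional using (_↭_)
open import Data.Maybe using (Maybe; just; nothing)
open import Data.Product using (Σ; Σ-syntax; ∃; _×_; _,_)
open import Function using (_∘_)
open import Function.Bundles using (_↔_; _⇔_; Inverse)
open import Relation.Binary.PropositionalEquality using (_≡_; cong; sym)
open import Relation.Nullary using (yes; no)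

-- First-order intuitionistic linear logic ILL1 (locally nameless:
-- free variables are named by ℕ, bound variables are de Bruijn indices)

Var : Set
Var = ℕ

data Tm (n : ℕ) : Set where
  fv : Var → Tm n
  bv : Fin n → Tm n

infixr 6 _⊗_
infixr 5 _⊸_
infixr 7 _&_ _⊕_

-- Predicate symbols are natural numbers; atoms are predicate symbols
-- applied to variables (no function symbols, no constants).
data Fm (n : ℕ) : Set where
  atom : ℕ → List (Tm n) → Fm n
  _⊗_ _⊸_ : Fm n → Fm n → Fm n
  _&_ : Fm n → Fm n → Fm n
  _⊕_ : Fm n → Fm n → Fm n
  !_ : Fm n → Fm n
  𝟘 𝟙 ⊤ : Fm n
  ∀' ∃' : Fm (suc n) → Fm n

wkT : ∀ {m} → Tm m → Tm (suc m)
wkT (fv x) = fv x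
wkT (bv i) = bv (suc i)

liftS : ∀ {n m} → (Fin n → Tm m) → Fin (suc n) → Tm (suc m)
liftS σ zero = bv zero
liftS σ (suc i) = wkT (σ i)

substT : ∀ {n m} → (Fin n → Tm m) → Tm n → Tm m
substT σ (fv x) = fv x
substT σ (bv i) = σ i

substF : ∀ {n m} → (Fin n → Tm m) → Fm n → Fm m
substF σ (atom p ts) = atom p (map (substT σ) ts)
substF σ (A ⊗ B) = substF σ A ⊗ substF σ B
substF σ (A ⊸ B) = substF σ A ⊸ substF σ B
substF σ (A & B) = substF σ A & substF σ B
substF σ (A ⊕ B) = substF σ A ⊕ substF σ B
substF σ (! A) = ! substF σ A
substF σ 𝟘 = 𝟘
substF σ 𝟙 = 𝟙
substF σ ⊤ = ⊤
substF σ (∀' A) = ∀' (substF (liftS σ) A)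
substF σ (∃' A) = ∃' (substF (liftS σ) A)

inst : Fm 1 → Var → Fm 0
inst A y = substF (λ _ → fv y) A

renT : ∀ {n} → (Var → Var) → Tm n → Tm n
renT h (fv x) = fv (h x)
renT h (bv i) = bv i

ren : ∀ {n} → (Var → Var) → Fm n → Fm n
ren h (atom p ts) = atom p (map (renT h) ts)
ren h (A ⊗ B) = ren h A ⊗ ren h B
ren h (A ⊸ B) = ren h A ⊸ ren h B
ren h (A & B) = ren h A & ren h B
ren h (A ⊕ B) = ren h A ⊕ ren h B
ren h (! A) = ! ren h A
ren h 𝟘 = 𝟘
ren h 𝟙 = 𝟙
ren h ⊤ = ⊤
ren h (∀' A) = ∀' (ren h A)
ren h (∃' A) = ∃' (ren h A)

fvT : ∀ {n} → Tm n → List Var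
fvT (fv x) = x ∷ []
fvT (bv i) = []

FV : ∀ {n} → Fm n → List Var
FV (atom p ts) = concatMap fvT ts
FV (A ⊗ B) = FV A ++ FV B
FV (A ⊸ B) = FV A ++ FV B
FV (A & B) = FV A ++ FV B
FV (A ⊕ B) = FV A ++ FV B
FV (! A) = FV A
FV 𝟘 = []
FV 𝟙 = []
FV ⊤ = []
FV (∀' A) = FV A
FV (∃' A) = FV A

FVs : List (Fm 0) → List Var
FVs = concatMap FV

Ctx : Set
Ctx = List (Fm 0)

-- Sequent calculus for ILL1; antecedents are multisets (lists up to
-- the exchange rule ↭), single succedent.
infix 3 _⊢_
data _⊢_ : Ctx → Fm 0 → Set where
  ax   : ∀ {A} → A ∷ [] ⊢ A
  exch : ∀ {Γ Δ C} → Γ ↭ Δ → Γ ⊢ C → Δ ⊢ C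
  cut  : ∀ {Γ Δ A C} → Γ ⊢ A → A ∷ Δ ⊢ C → Γ ++ Δ ⊢ C
  ⊗L   : ∀ {Γ A B C} → A ∷ B ∷ Γ ⊢ C → (A ⊗ B) ∷ Γ ⊢ C
  ⊗R   : ∀ {Γ Δ A B} → Γ ⊢ A → Δ ⊢ B → Γ ++ Δ ⊢ A ⊗ B
  ⊸L   : ∀ {Γ Δ A B C} → Γ ⊢ A → B ∷ Δ ⊢ C → (A ⊸ B) ∷ (Γ ++ Δ) ⊢ C
  ⊸R   : ∀ {Γ A B} → A ∷ Γ ⊢ B → Γ ⊢ A ⊸ B
  &L₁  : ∀ {Γ A B C} → A ∷ Γ ⊢ C → (A & B) ∷ Γ ⊢ C
  &L₂  : ∀ {Γ A B C} → B ∷ Γ ⊢ C → (A & B) ∷ Γ ⊢ C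
  &R   : ∀ {Γ A B} → Γ ⊢ A → Γ ⊢ B → Γ ⊢ A & B
  ⊕L   : ∀ {Γ A B C} → A ∷ Γ ⊢ C → B ∷ Γ ⊢ C → (A ⊕ B) ∷ Γ ⊢ C
  ⊕R₁  : ∀ {Γ A B} → Γ ⊢ A → Γ ⊢ A ⊕ B
  ⊕R₂  : ∀ {Γ A B} → Γ ⊢ B → Γ ⊢ A ⊕ B
  𝟘L   : ∀ {Γ C} → 𝟘 ∷ Γ ⊢ C
  𝟙L   : ∀ {Γ C} → Γ ⊢ C → 𝟙 ∷ Γ ⊢ C
  𝟙R   : [] ⊢ 𝟙
  ⊤R   : ∀ {Γ} → Γ ⊢ ⊤
  !L   : ∀ {Γ A C} → A ∷ Γ ⊢ C → (! A) ∷ Γ ⊢ C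
  !W   : ∀ {Γ A C} → Γ ⊢ C → (! A) ∷ Γ ⊢ C
  !C   : ∀ {Γ A C} → (! A) ∷ (! A) ∷ Γ ⊢ C → (! A) ∷ Γ ⊢ C
  !R   : ∀ {Γ A} → map !_ Γ ⊢ A → map !_ Γ ⊢ ! A
  ∀L   : ∀ {Γ A C} (y : Var) → inst A y ∷ Γ ⊢ C → ∀' A ∷ Γ ⊢ C
  ∀R   : ∀ {Γ A} (y : Var) → y ∉ FVs Γ → y ∉ FV (∀' A) →
         Γ ⊢ inst A y → Γ ⊢ ∀' A
  ∃L   : ∀ {Γ A C} (y : Var) → y ∉ FVs Γ → y ∉ FV (∃' A) → y ∉ FV C →
         inst A y ∷ Γ ⊢ C → ∃' A ∷ Γ ⊢ C
  ∃R   : ∀ {Γ A} (y : Var) → Γ ⊢ inst A y → Γ ⊢ ∃' A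

-- Σ-typed alphabets and hypergraphs.  Selectors = variables = ℕ.
-- A finite subset of Σ with a fixed enumeration = duplicate-free list.

record Alphabet : Set where
  field
    size        : ℕ
    type        : Fin size → List Var
    type-unique : ∀ c → Unique (type c)
open Alphabet public

-- hypergraphs over T of type X; nodes Fin nV (node v regarded as the
-- variable toℕ v); att / ext are indexed by positions in the enumeration
record HG (T : Alphabet) (X : List Var) : Set where
  field
    nV  : ℕ
    nE  : ℕ
    lab : Fin nE → Fin (size T)
    att : (e : Fin nE) → Fin (length (type T (lab e))) → Fin nV
    ext : Fin (length X) → Fin nV
open HG public

record Iso {T : Alphabet} {X : List Var} (H G : HG T X) : Set where
  field
    isoV : Fin (nV H) ↔ Fin (nV G)
    isoE : Fin (nE H) ↔ Fin (nE G)
    lab≡ : ∀ e → lab G (Inverse.to isoE e) ≡ lab H e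
    att≡ : ∀ e i → att G (Inverse.to isoE e)
                     (cast (cong (λ c → length (type T c)) (sym (lab≡ e))) i)
                   ≡ Inverse.to isoV (att H e i)
    ext≡ : ∀ i → ext G i ≡ Inverse.to isoV (ext H i)

IsoClosed : {T : Alphabet} {X : List Var} → (HG T X → Set) → Set
IsoClosed L = ∀ H G → Iso H G → L H → L G

-- substitution h : type(c) → Var given positionally: variable x is sent
-- to h(i) where i is the position of x in the enumeration (x itself if
-- x ∉ type(c), which never matters since FVar(A) ⊆ type(c))
selSub : (l : List Var) → (Fin (length l) → Var) → Var → Var
selSub [] h x = x
selSub (σ ∷ l) h x with x ≟ σ
... | yes _ = h zero
... | no _  = selSub l (h ∘ suc) x

pointSub : Var → Var → Var → Var
pointSub x• v x with x ≟ x•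
... | yes _ = v
... | no _  = x

-- rules of ▷: (just a , A) means a ▷ A, (nothing , A) means • ▷ A
RuleOK : (x• : Var) (T : Alphabet) → Maybe (Fin (size T)) × Fm 0 → Set
RuleOK x• T (just a , A)  = All (_∈ type T a) (FV A)
RuleOK x• T (nothing , A) = All (_≡ x•) (FV A)

record Grammar (x• : Var) (T : Alphabet) (X : List Var) : Set where
  field
    rules    : List (Maybe (Fin (size T)) × Fm 0)
    rules-ok : All (RuleOK x• T) rules
    start    : Fm 0
    start-ok : All (_∈ X) (FV start)
open Grammar public

InL : ∀ {x• T X} → Grammar x• T X → HG T X → Set
InL {x•} {T} {X} G H =
  Σ[ hV ∈ (Fin (nV H) → Fm 0) ] Σ[ hE ∈ (Fin (nE H) → Fm 0) ]
    (∀ v → (nothing , hV v) ∈ rules G) ×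
    (∀ e → (just (lab H e) , hE e) ∈ rules G) ×
    (tabulate (λ e → ren (selSub (type T (lab H e)) (toℕ ∘ att H e)) (hE e))
       ++ tabulate (λ v → ren (pointSub x• (toℕ v)) (hV v))
     ⊢ ren (selSub X (toℕ ∘ ext H)) (start G))

data PR : ℕ → Set where
  Z    : ∀ {n} → PR n
  S    : PR 1
  P    : ∀ {n} → Fin n → PR n
  Comp : ∀ {m n} → PR m → Vec (PR n) m → PR n
  Rec  : ∀ {n} → PR n → PR (suc (suc n)) → PR (suc n)
  Mu   : ∀ {n} → PR (suc n) → PR n

lookupV : ∀ {n} → Vec ℕ n → Fin n → ℕ
lookupV (x ∷ xs) zero = x
lookupV (x ∷ xs) (suc i) = lookupV xs i

data _[_]↓_ : ∀ {n} → PR n → Vec ℕ n → ℕ → Set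
data _[_]↓*_ : ∀ {m n} → Vec (PR n) m → Vec ℕ n → Vec ℕ m → Set

data _[_]↓_ where
  eZ    : ∀ {n} {xs : Vec ℕ n} → Z [ xs ]↓ 0
  eS    : ∀ {x} → S [ x ∷ [] ]↓ suc x
  eP    : ∀ {n} {xs : Vec ℕ n} i → P i [ xs ]↓ lookupV xs i
  eComp : ∀ {m n} {f : PR m} {gs : Vec (PR n) m} {xs ys y} →
          gs [ xs ]↓* ys → f [ ys ]↓ y → Comp f gs [ xs ]↓ y
  eRec0 : ∀ {n} {g : PR n} {h xs y} → g [ xs ]↓ y → Rec g h [ 0 ∷ xs ]↓ y
  eRecS : ∀ {n} {g : PR n} {h k xs y z} → Rec g h [ k ∷ xs ]↓ y →
          h [ k ∷ y ∷ xs ]↓ z → Rec g h [ suc k ∷ xs ]↓ z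
  eMu   : ∀ {n} {f : PR (suc n)} {xs y} → f [ y ∷ xs ]↓ 0 →
          (∀ z → z < y → ∃ λ w → f [ z ∷ xs ]↓ suc w) → Mu f [ xs ]↓ y

data _[_]↓*_ where
  e[] : ∀ {n} {xs : Vec ℕ n} → [] [ xs ]↓* []
  e∷  : ∀ {m n} {g : PR n} {gs : Vec (PR n) m} {xs y ys} →
        g [ xs ]↓ y → gs [ xs ]↓* ys → (g ∷ gs) [ xs ]↓* (y ∷ ys)

REℕ : (ℕ → Set) → Set
REℕ A = Σ[ f ∈ PR 1 ] (∀ n → A n ⇔ (∃ λ y → f [ n ∷ [] ]↓ y))

-- standard Gödel numbering of hypergraphs (Cantor pairing, list codes)
tri : ℕ → ℕ
tri zero = zero
tri (suc n) = suc n + tri n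

pair : ℕ → ℕ → ℕ
pair a b = tri (a + b) + b

encList : List ℕ → ℕ
encList [] = 0
encList (x ∷ xs) = suc (pair x (encList xs))

encode : ∀ {T X} → HG T X → ℕ
encode {T} {X} H = encList
  ( nV H ∷ nE H
  ∷ encList (tabulate (toℕ ∘ lab H))
  ∷ encList (tabulate (λ e → encList (tabulate (toℕ ∘ att H e))))
  ∷ encList (tabulate (toℕ ∘ ext H))
  ∷ [])

RE : ∀ {T X} → (HG T X → Set) → Set
RE {T} {X} L = REℕ (λ n → Σ[ H ∈ HG T X ] (encode H ≡ n × L H))

Generates : ∀ {x• T X} → Grammar x• T X → (HG T X → Set) → Set
Generates G L = ∀ H → L H ⇔ InL G H

{-# OPTIONS --safe #-}
-- From a grammar to a partial recursive function: formulas and sequents are coded as binary trees.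
-- Derivability in ILL1, and with it membership of a coded hypergraph in the language, is the least
-- model of a finite Horn program over trees, and the consequences of a Horn program are semidecided
-- by an unbounded search for a certificate that guides a machine working on a stack of goals.
--
-- From a partial recursive function f to a grammar: a node v contributes the atom node(v), a
-- hyperedge the atom edge_c(v₁ … vₖ), and the start formula is !θ₁ ⊸ … ⊸ !θₘ ⊸ accept(X).  The Horn
-- axioms θ consume nodes and hyperedges one by one, compute the code of the hypergraph in the order
-- in which it was read, and evaluate f on it, using one predicate for the graph of each subprogram
-- of f.  Numbers and lists of nodes are named by variables that come from axioms such as
-- ∀x ∃y !suc(x, y).  Conversely, ILL1 is sound for the semantics in which a formula denotes a
-- predicate on multisets of nodes and hyperedges (so no cut elimination is needed); there,
-- accept(X) says that every node and hyperedge was read exactly once, hence that f halts on the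
-- code of a hypergraph isomorphic to the given one.
module Submission where

open import Defs
open import Data.Empty using (⊥)
open import Data.Fin as Fin using (Fin; zero; suc; toℕ; cast; splitAt; #_; _↑ˡ_; _↑ʳ_)
open import Data.Fin.Permutation using (cast-id; _∘ₚ_)
open import Data.Fin.Properties
  using (toℕ<n; toℕ-fromℕ<; toℕ-injective; cast-is-id; cast-trans; splitAt-↑ˡ; splitAt-↑ʳ)
open import Data.List as List using (List; []; _∷_; _++_; map; foldr; concatMap; length; tabulate; lookup; mapMaybe)
open import Data.List.Extrema.Nat using (max; xs≤max)
open import Data.List.Membership.Propositional using (_∈_; _∉_)
open import Data.List.Membership.Propositional.Properties
  using (∈-++⁺ˡ; ∈-++⁺ʳ; ∈-++⁻; ∈-lookup; ∈-map⁺; ∈-tabulate⁺; ∈-tabulate⁻; ∈-concat⁺′)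
open import Data.List.Properties
  using ( ++-assoc; ++-identityʳ; ∷-injective; concatMap-++; length-tabulate; lookup-tabulate; map-∘; map-cong; map-id
        ; map-tabulate; mapMaybe-++; mapMaybe-just; mapMaybe-map; mapMaybe-nothing; tabulate-cong; tabulate-lookup)
open import Data.List.Relation.Binary.Permutation.Homogeneous using (onIndices)
open import Data.List.Relation.Binary.Permutation.Propositional
  using (_↭_; refl; prep; swap; trans; ↭-refl; ↭-reflexive; ↭-sym; ↭-trans; ↭⇒↭ₛ)
open import Data.List.Relation.Binary.Permutation.Propositional.Properties
  using (++-comm; ++⁺ˡ; ++⁺ʳ; mapMaybe-↭; shift; shifts; ↭-empty-inv; ↭-singleton-inv)
import Data.List.Relation.Binary.Permutation.Setoid.Properties as PermProp
open import Data.List.Relation.Unary.All as All using (All; []; _∷_)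
open import Data.List.Relation.Unary.All.Properties as AllP using ()
open import Data.List.Relation.Unary.AllPairs using ([]; _∷_)
open import Data.List.Relation.Unary.Any using (here; there)
open import Data.List.Relation.Unary.Unique.Propositional using (Unique)
open import Data.Maybe using (Maybe; just; nothing)
open import Data.Nat
  using (ℕ; zero; suc; pred; _+_; _∸_; _<_; _≤_; _≤′_; _⊔_; z≤n; s≤s; ≤-pred; ≤′-refl; ≤′-step)
open import Data.Nat.Induction using (<-rec)
open import Data.Nat.Properties
open import Data.Product using (Σ-syntax; ∃; _×_; _,_; proj₁; proj₂)
open import Data.Sum using (_⊎_; inj₁; inj₂; [_,_]′)
open import Data.Unit using (tt) renaming (⊤ to Unit)
open import Data.Vec as Vec using (Vec; []; _∷_)
open import Data.Vec.Properties using (lookup∘tabulate)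
open import Function using (_∘_)
open import Function.Bundles using (_⇔_; mk⇔; module Equivalence; _↔_; Inverse)
open import Relation.Binary.Definitions using (tri<; tri≈; tri>)
open import Relation.Binary.PropositionalEquality as ≡ using (_≡_; _≢_; refl; sym; cong; cong₂; subst; setoid)
open import Relation.Nullary using (yes; no; contradiction)

-- The antecedent of a sequent is a multiset, so a grammar cannot see the numbering of nodes and
-- hyperedges on which `encode` depends. The axioms therefore read them in a guessed order, and the
-- code obtained is that of the given hypergraph only up to isomorphism; closure of the language
-- under isomorphism repairs exactly this. Conversely, for a member of the language the guess can be
-- the order used by `encode` itself. There are no function symbols, hence no terms for the numbers
-- of a computation. Each number is named by an eigenvariable, and the fact that defines it stands
-- under `!`, since it is used many times whereas a node or hyperedge must be used once. How many
-- names a run needs is not known in advance. So a derivation is first built over some finite stage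
-- of a growing list of facts, and the names are discharged afterwards, the newest first.

↓-det  : ∀ {n} (f : PR n) {xs y z} → f [ xs ]↓ y → f [ xs ]↓ z → y ≡ z
↓*-det : ∀ {m n} (fs : Vec (PR n) m) {xs ys zs} → fs [ xs ]↓* ys → fs [ xs ]↓* zs → ys ≡ zs
↓-det Z eZ eZ = refl
↓-det S eS eS = refl
↓-det (P i) (eP .i) (eP .i) = refl
↓-det (Comp f gs) (eComp ds d) (eComp es e) with ↓*-det gs ds es
... | refl = ↓-det f d e
↓-det (Rec g h) (eRec0 d) (eRec0 e) = ↓-det g d e
↓-det (Rec g h) (eRecS d d′) (eRecS e e′) with ↓-det (Rec g h) d e
... | refl = ↓-det h d′ e′
↓-det (Mu f) {y = y} {z} (eMu d ds) (eMu e es) with <-cmp y z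
... | tri≈ _ y≡z _ = y≡z
... | tri< y<z _ _ = contradiction (↓-det f d (proj₂ (es y y<z))) λ ()
... | tri> _ _ z<y = contradiction (↓-det f e (proj₂ (ds z z<y))) λ ()
↓*-det [] e[] e[] = refl
↓*-det (f ∷ fs) (e∷ d ds) (e∷ e es) = cong₂ _∷_ (↓-det f d e) (↓*-det fs ds es)

-- Total functions with programs, and the inverse of Cantor pairing

record Fn (n : ℕ) : Set where
  field
    fun      : Vec ℕ n → ℕ
    prog     : PR n
    computes : ∀ xs → prog [ xs ]↓ fun xs
open Fn

-- Variables take the place of projections: `progE` compiles an expression with `P` and `Comp`, so a
-- function written in this way comes with a program and its correctness.
data Ex (n : ℕ) : Set where
  var : Fin n → Ex n
  ap  : ∀ {m} → Fn m → Vec (Ex n) m → Ex n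

evalE  : ∀ {n} → Ex n → Vec ℕ n → ℕ
evalE* : ∀ {n m} → Vec (Ex n) m → Vec ℕ n → Vec ℕ m
evalE (var i) xs = lookupV xs i
evalE (ap F es) xs = fun F (evalE* es xs)
evalE* [] xs = []
evalE* (e ∷ es) xs = evalE e xs ∷ evalE* es xs

progE  : ∀ {n} → Ex n → PR n
progE* : ∀ {n m} → Vec (Ex n) m → Vec (PR n) m
progE (var i) = P i
progE (ap F es) = Comp (prog F) (progE* es)
progE* [] = []
progE* (e ∷ es) = progE e ∷ progE* es

computesE  : ∀ {n} (e : Ex n) xs → progE e [ xs ]↓ evalE e xs
computesE* : ∀ {n m} (es : Vec (Ex n) m) xs → progE* es [ xs ]↓* evalE* es xs
computesE (var i) xs = eP i
computesE (ap F es) xs = eComp (computesE* es xs) (computes F (evalE* es xs))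
computesE* [] xs = e[]
computesE* (e ∷ es) xs = e∷ (computesE e xs) (computesE* es xs)

fn : ∀ {n} → Ex n → Fn n
fn e = record { fun = evalE e ; prog = progE e ; computes = computesE e }

recFun : ∀ {n} → (Vec ℕ n → ℕ) → (Vec ℕ (suc (suc n)) → ℕ) → Vec ℕ (suc n) → ℕ
recFun g h (zero ∷ xs) = g xs
recFun g h (suc k ∷ xs) = h (k ∷ recFun g h (k ∷ xs) ∷ xs)

recFn : ∀ {n} → Ex n → Ex (suc (suc n)) → Fn (suc n)
recFn {n} g h = record
  { fun = recFun (evalE g) (evalE h) ; prog = Rec (progE g) (progE h) ; computes = go }
  where
  go : ∀ xs → Rec (progE g) (progE h) [ xs ]↓ recFun (evalE g) (evalE h) xs
  go (zero ∷ xs) = eRec0 (computesE g xs)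
  go (suc k ∷ xs) = eRecS (go (k ∷ xs)) (computesE h _)

pattern #0 = zero
pattern #1 = suc zero
pattern #2 = suc (suc zero)
pattern #3 = suc (suc (suc zero))
pattern #4 = suc #3
pattern #5 = suc #4
pattern #6 = suc #5
pattern #7 = suc #6

zeroFn : Fn 0
zeroFn = record { fun = λ _ → 0 ; prog = Z ; computes = λ _ → eZ }

sucFn : Fn 1
sucFn = record { fun = λ { (x ∷ []) → suc x } ; prog = S ; computes = λ { (x ∷ []) → eS } }

sucE : ∀ {n} → Ex n → Ex n
sucE e = ap sucFn (e ∷ [])

litE : ∀ {n} → ℕ → Ex n
litE zero = ap zeroFn []
litE (suc k) = sucE (litE k)

evalE-lit : ∀ {n} k (xs : Vec ℕ n) → evalE (litE k) xs ≡ k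
evalE-lit zero xs = refl
evalE-lit (suc k) xs = cong suc (evalE-lit k xs)

-- Replaces the function computed by a pointwise equal one that has better reduction behaviour.
respec : ∀ {n} (F : Fn n) (f : Vec ℕ n → ℕ) → (∀ xs → fun F xs ≡ f xs) → Fn n
respec F f eq = record
  { fun = f ; prog = prog F ; computes = λ xs → subst (prog F [ xs ]↓_) (eq xs) (computes F xs) }

addFn : Fn 2
addFn = respec (recFn (var #0) (sucE (var #1))) (λ { (x ∷ y ∷ []) → x + y }) λ { (x ∷ y ∷ []) → go x y }
  where
  go : ∀ x y → fun (recFn (var #0) (sucE (var #1))) (x ∷ y ∷ []) ≡ x + y
  go zero y = refl
  go (suc x) y = cong suc (go x y)

predFn : Fn 1
predFn = respec (recFn (litE 0) (var #0)) (λ { (x ∷ []) → pred x })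
  λ { (zero ∷ []) → refl ; (suc x ∷ []) → refl }

-- Truncated subtraction with the arguments exchanged, since recursion is on the first one.
rsubFn : Fn 2
rsubFn = respec (recFn (var #0) (ap predFn (var #1 ∷ []))) (λ { (x ∷ y ∷ []) → y ∸ x }) λ { (x ∷ y ∷ []) → go x y }
  where
  go : ∀ x y → fun (recFn (var #0) (ap predFn (var #1 ∷ []))) (x ∷ y ∷ []) ≡ y ∸ x
  go zero y = refl
  go (suc x) y = ≡.trans (cong pred (go x y)) (pred[m∸n]≡m∸[1+n] y x)

cond : ℕ → ℕ → ℕ → ℕ
cond zero x y = x
cond (suc _) x y = y

condFn : Fn 3
condFn = respec (recFn (var #0) (var #3)) (λ { (b ∷ x ∷ y ∷ []) → cond b x y })
  λ { (zero ∷ x ∷ y ∷ []) → refl ; (suc b ∷ x ∷ y ∷ []) → refl }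

triFn : Fn 1
triFn = respec (recFn (litE 0) (sucE (ap addFn (var #0 ∷ var #1 ∷ [])))) (λ { (x ∷ []) → tri x }) λ { (x ∷ []) → go x }
  where
  go : ∀ x → fun (recFn (litE 0) (sucE (ap addFn (var #0 ∷ var #1 ∷ [])))) (x ∷ []) ≡ tri x
  go zero = refl
  go (suc x) = cong (λ k → suc (x + k)) (go x)

consℕ : ℕ → ℕ → ℕ
consℕ x y = suc (pair x y)

consFn : Fn 2
consFn = respec
  (fn (sucE (ap addFn (ap triFn (ap addFn (var #0 ∷ var #1 ∷ []) ∷ []) ∷ var #1 ∷ []))))
  (λ { (x ∷ y ∷ []) → consℕ x y }) λ { (x ∷ y ∷ []) → refl }

consE : ∀ {n} → Ex n → Ex n → Ex n
consE d e = ap consFn (d ∷ e ∷ [])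

-- diag n is the largest s with tri s ≤ n, that is, a + b for n = pair a b.
diag : ℕ → ℕ
diag zero = 0
diag (suc n) = cond (tri (suc (diag n)) ∸ suc n) (suc (diag n)) (diag n)

diagFn : Fn 1
diagFn = respec (recFn (litE 0) step) (λ { (n ∷ []) → diag n }) λ { (n ∷ []) → go n }
  where
  step : Ex 2
  step = ap condFn (ap rsubFn (sucE (var #0) ∷ ap triFn (sucE (var #1) ∷ []) ∷ []) ∷ sucE (var #1) ∷ var #1 ∷ [])
  go : ∀ n → fun (recFn (litE 0) step) (n ∷ []) ≡ diag n
  go zero = refl
  go (suc n) = cong (λ d → cond (tri (suc d) ∸ suc n) (suc d) d) (go n)

cond-pos : ∀ {k x y} → 0 < k → cond k x y ≡ y
cond-pos {suc k} _ = refl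

-- The numbers `tri s + b` with `b ≤ s` are the codes on the antidiagonal of sum `s`. Counting
-- upwards, the test in `diag` succeeds only on the step from `tri s + s` to `tri (suc s)`, which is
-- the case of `suc s` and `zero`; within an antidiagonal the value is kept.
diag-pair : ∀ s b → b ≤ s → diag (tri s + b) ≡ s
diag-pair zero zero _ = refl
diag-pair (suc s) zero _
  rewrite +-identityʳ (s + tri s) | +-comm s (tri s)
  | diag-pair s s ≤-refl | +-comm s (tri s) | n∸n≡0 (tri s + s) = refl
diag-pair s (suc b) b<s
  rewrite +-suc (tri s) b | diag-pair s b (<⇒≤ b<s) = cond-pos (m<n⇒0<n∸m lt)
  where
  lt : tri s + b < s + tri s
  lt = subst (tri s + b <_) (+-comm (tri s) s) (+-monoʳ-< (tri s) b<s)

snd fst hd tl : ℕ → ℕ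
snd n = n ∸ tri (diag n)
fst n = diag n ∸ snd n
hd n = fst (pred n)
tl n = snd (pred n)

snd-pair : ∀ a b → snd (pair a b) ≡ b
snd-pair a b rewrite diag-pair (a + b) b (m≤n+m b a) = m+n∸m≡n (tri (a + b)) b

fst-pair : ∀ a b → fst (pair a b) ≡ a
fst-pair a b rewrite snd-pair a b | diag-pair (a + b) b (m≤n+m b a) = m+n∸n≡m a b

sndFn hdFn tlFn : Fn 1
sndFn = respec (fn (ap rsubFn (ap triFn (ap diagFn (var #0 ∷ []) ∷ []) ∷ var #0 ∷ [])))
  (λ { (n ∷ []) → snd n }) λ { (n ∷ []) → refl }
tlFn = respec (fn (ap sndFn (ap predFn (var #0 ∷ []) ∷ []))) (λ { (n ∷ []) → tl n }) λ { (n ∷ []) → refl }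
hdFn = respec
  (fn (ap rsubFn (ap tlFn (var #0 ∷ []) ∷ ap diagFn (ap predFn (var #0 ∷ []) ∷ []) ∷ [])))
  (λ { (n ∷ []) → hd n }) λ { (n ∷ []) → refl }

hd-cons : ∀ a b → hd (consℕ a b) ≡ a
hd-cons = fst-pair

tl-cons : ∀ a b → tl (consℕ a b) ≡ b
tl-cons = snd-pair

consℕ-inj : ∀ {a b c d} → consℕ a b ≡ consℕ c d → a ≡ c × b ≡ d
consℕ-inj {a} {b} {c} {d} eq =
  ≡.trans (sym (hd-cons a b)) (≡.trans (cong hd eq) (hd-cons c d)) ,
  ≡.trans (sym (tl-cons a b)) (≡.trans (cong tl eq) (tl-cons c d))

-- The enumeration walks along antidiagonals: `(suc a , b)` is followed by `(a , suc b)`, and the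
-- end `(0 , b)` by the start `(suc b , 0)` of the next one.
pair-surj : ∀ n → Σ[ a ∈ ℕ ] Σ[ b ∈ ℕ ] pair a b ≡ n
pair-surj zero = 0 , 0 , refl
pair-surj (suc n) with pair-surj n
... | zero , b , refl = suc b , 0 , ≡.trans (+-identityʳ _)
        (≡.trans (cong (λ k → suc k + tri k) (+-identityʳ b)) (cong suc (+-comm b (tri b))))
... | suc a , b , refl = a , suc b , ≡.trans (cong (λ k → tri k + suc b) (+-suc a b)) (+-suc _ b)

pair-≥ˡ : ∀ a b → a ≤ pair a b
pair-≥ˡ a b = ≤-trans (≤-trans (m≤m+n a b) (n≤tri (a + b))) (m≤m+n (tri (a + b)) b)
  where
  n≤tri : ∀ n → n ≤ tri n
  n≤tri zero = z≤n
  n≤tri (suc n) = s≤s (m≤m+n n (tri n))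

pair-≥ʳ : ∀ a b → b ≤ pair a b
pair-≥ʳ a b = m≤n+m b (tri (a + b))

encList-inj : ∀ {xs ys} → encList xs ≡ encList ys → xs ≡ ys
encList-inj {List.[]} {List.[]} eq = refl
encList-inj {x List.∷ xs} {y List.∷ ys} eq with consℕ-inj {x} {encList xs} {y} {encList ys} eq
... | refl , eq′ = cong (x List.∷_) (encList-inj eq′)

-- For a total `F` any zero suffices: the search below a bound either meets a first zero, with only
-- positive values before it, or finds all values positive.
Mu-halts : ∀ {n} (F : Fn (suc n)) xs → (∃ λ y → Mu (prog F) [ xs ]↓ y) ⇔ (∃ λ y → fun F (y ∷ xs) ≡ 0)
Mu-halts F xs = mk⇔ to from
  where
  to : (∃ λ y → Mu (prog F) [ xs ]↓ y) → ∃ λ y → fun F (y ∷ xs) ≡ 0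
  to (y , eMu d _) = y , ↓-det (prog F) (computes F (y ∷ xs)) d

  val : ∀ {y v} → fun F (y ∷ xs) ≡ v → prog F [ y ∷ xs ]↓ v
  val {y} refl = computes F (y ∷ xs)

  search : ∀ b → (∃ λ y → Mu (prog F) [ xs ]↓ y) ⊎ (∀ z → z < b → ∃ λ w → prog F [ z ∷ xs ]↓ suc w)
  search zero = inj₂ λ _ ()
  search (suc b) with search b | fun F (b ∷ xs) in eq
  ... | inj₁ halt | _ = inj₁ halt
  ... | inj₂ pos | zero = inj₁ (b , eMu (val eq) pos)
  ... | inj₂ pos | suc w = inj₂ λ z z<1+b → case z (m≤n⇒m<n∨m≡n (≤-pred z<1+b))
    where
    case : ∀ z → z < b ⊎ z ≡ b → ∃ λ w → prog F [ z ∷ xs ]↓ suc w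
    case z (inj₁ z<b) = pos z z<b
    case z (inj₂ refl) = w , val eq

  from : (∃ λ y → fun F (y ∷ xs) ≡ 0) → ∃ λ y → Mu (prog F) [ xs ]↓ y
  from (y , eq) with search (suc y)
  ... | inj₁ halt = halt
  ... | inj₂ pos with ↓-det (prog F) (val eq) (proj₂ (pos y ≤-refl))
  ... | ()

-- Horn programs over binary trees

data Tree : Set where
  leaf : Tree
  node : Tree → Tree → Tree

τ : Tree → ℕ
τ leaf = 0
τ (node s t) = consℕ (τ s) (τ t)

τ-inj : ∀ s t → τ s ≡ τ t → s ≡ t
τ-inj leaf leaf _ = refl
τ-inj (node s s′) (node t t′) eq with consℕ-inj {τ s} {τ s′} {τ t} {τ t′} eq
... | p , q = cong₂ node (τ-inj s t p) (τ-inj s′ t′ q)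

-- Because every number codes a tree, whatever an item of a certificate contains can be read as a
-- substitution. The soundness of the machine thus needs no check that a certificate is well formed.
τ-surj : ∀ n → Σ[ t ∈ Tree ] τ t ≡ n
τ-surj = <-rec _ go
  where
  go : ∀ n → (∀ {m} → m < n → Σ[ t ∈ Tree ] τ t ≡ m) → Σ[ t ∈ Tree ] τ t ≡ n
  go zero rec = leaf , refl
  go (suc n) rec with pair-surj n
  ... | a , b , refl with rec (s≤s (pair-≥ˡ a b)) | rec (s≤s (pair-≥ʳ a b))
  ... | s , refl | t , refl = node s t , refl

data Pat (n : ℕ) : Set where
  var  : Fin n → Pat n
  leaf : Pat n
  node : Pat n → Pat n → Pat n

_⟦_⟧ : ∀ {n} → Pat n → Vec Tree n → Tree
var i ⟦ ρ ⟧ = Vec.lookup ρ i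
leaf ⟦ ρ ⟧ = leaf
node p q ⟦ ρ ⟧ = node (p ⟦ ρ ⟧) (q ⟦ ρ ⟧)

_⟦_⟧* : ∀ {n} → List (Pat n) → Vec Tree n → List Tree
[] ⟦ ρ ⟧* = []
(p ∷ ps) ⟦ ρ ⟧* = p ⟦ ρ ⟧ ∷ ps ⟦ ρ ⟧*

Atom : ℕ → Set
Atom n = ℕ × List (Pat n)

record Clause : Set where
  constructor _⇐_
  field
    {arity} : ℕ
    head    : Atom arity
    body    : List (Atom arity)
open Clause public

Fact : Set
Fact = ℕ × List Tree

_⟦_⟧ₐ : ∀ {n} → Atom n → Vec Tree n → Fact
(r , ps) ⟦ ρ ⟧ₐ = r , ps ⟦ ρ ⟧*

data Der (Π : List Clause) : Fact → Set where
  der : ∀ {c} → c ∈ Π → (ρ : Vec Tree (arity c)) →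
        All (λ a → Der Π (a ⟦ ρ ⟧ₐ)) (body c) → Der Π (head c ⟦ ρ ⟧ₐ)

Model : List Clause → (Fact → Set) → Set
Model Π I = All (λ c → (ρ : Vec Tree (arity c)) → All (λ a → I (a ⟦ ρ ⟧ₐ)) (body c) → I (head c ⟦ ρ ⟧ₐ)) Π

Der-least : ∀ {Π} I → Model Π I → ∀ {f} → Der Π f → I f
Der-least* : ∀ {Π n} I → Model Π I → (as : List (Atom n)) (ρ : Vec Tree n) →
  All (λ a → Der Π (a ⟦ ρ ⟧ₐ)) as → All (λ a → I (a ⟦ ρ ⟧ₐ)) as
Der-least I M (der {c} c∈Π ρ ds) = All.lookup M c∈Π ρ (Der-least* I M (body c) ρ ds)
Der-least* I M [] ρ [] = []
Der-least* I M (a ∷ as) ρ (d ∷ ds) = Der-least I M d ∷ Der-least* I M as ρ ds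

fact : Fact → ℕ
fact (r , ts) = consℕ r (encList (map τ ts))

map-τ-inj : ∀ ss ts → map τ ss ≡ map τ ts → ss ≡ ts
map-τ-inj [] [] _ = refl
map-τ-inj (s ∷ ss) (t ∷ ts) eq =
  cong₂ _∷_ (τ-inj s t (cong (λ { [] → 0 ; (x ∷ _) → x }) eq)) (map-τ-inj ss ts (cong (List.drop 1) eq))

fact-inj : ∀ {f g} → fact f ≡ fact g → f ≡ g
fact-inj {r , ss} {q , ts} eq with consℕ-inj {r} {encList (map τ ss)} {q} {encList (map τ ts)} eq
... | refl , eq′ = cong (r ,_) (map-τ-inj ss ts (encList-inj eq′))

-- A Horn program runs on a stack of goals, guided by a certificate: the item ⟨i, ρ⟩ asks to
-- replace the top goal by the body of clause i under ρ, and is skipped if the head does not match.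

goals : List Fact → ℕ
goals = encList ∘ map fact

dropE : ∀ {n} → ℕ → Ex n → Ex n
dropE zero e = e
dropE (suc k) e = dropE k (ap tlFn (e ∷ []))

patE : ∀ {n} → Pat n → Ex 2
patE (var i) = ap hdFn (dropE (suc (toℕ i)) (var #1) ∷ [])
patE leaf = ap zeroFn []
patE (node p q) = consE (patE p) (patE q)

patE* : ∀ {n} → List (Pat n) → Ex 2
patE* [] = ap zeroFn []
patE* (p ∷ ps) = consE (patE p) (patE* ps)

atomE : ∀ {n} → Atom n → Ex 2
atomE (r , ps) = consE (litE r) (patE* ps)

bodyE : ∀ {n} → List (Atom n) → Ex 2 → Ex 2
bodyE [] e = e
bodyE (a ∷ as) e = consE (atomE a) (bodyE as e)

diffE : Ex 2 → Ex 2 → Ex 2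
diffE d e = ap addFn (ap rsubFn (d ∷ e ∷ []) ∷ ap rsubFn (e ∷ d ∷ []) ∷ [])

wantE : Clause → Ex 2
wantE c = consE (atomE (head c)) (ap tlFn (var #0 ∷ []))

-- One comparison checks both that the item names clause `i` and that the stack is the instantiated
-- head on top of its own tail. The empty stack 0 never passes, as `wantE` is a successor.
testE : ℕ → Clause → Ex 2
testE i c = diffE (consE (ap hdFn (var #1 ∷ [])) (var #0)) (consE (litE i) (wantE c))

stepE : ℕ → List Clause → Ex 2
stepE i [] = var #0
stepE i (c ∷ cs) = ap condFn
  ( testE i c
  ∷ bodyE (body c) (ap tlFn (var #0 ∷ []))
  ∷ stepE (suc i) cs ∷ [])

drop-tl : ℕ → ℕ → ℕ
drop-tl zero c = c
drop-tl (suc k) c = tl (drop-tl k c)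

nth : ℕ → ℕ → ℕ
nth k c = hd (drop-tl k c)

drop-tl-tl : ∀ k c → drop-tl k (tl c) ≡ tl (drop-tl k c)
drop-tl-tl zero c = refl
drop-tl-tl (suc k) c = cong tl (drop-tl-tl k c)

evalE-drop : ∀ {n} k (e : Ex n) xs → evalE (dropE k e) xs ≡ drop-tl k (evalE e xs)
evalE-drop zero e xs = refl
evalE-drop (suc k) e xs = ≡.trans (evalE-drop k (ap tlFn (e ∷ [])) xs) (drop-tl-tl k (evalE e xs))

-- Position 0 of an item holds the number of the clause, hence the shift by one.
Binds : ∀ {n} → ℕ → Vec Tree n → Set
Binds it ρ = ∀ i → nth (suc (toℕ i)) it ≡ τ (Vec.lookup ρ i)

evalE-pat : ∀ {n} (p : Pat n) s it (ρ : Vec Tree n) → Binds it ρ → evalE (patE p) (s ∷ it ∷ []) ≡ τ (p ⟦ ρ ⟧)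
evalE-pat (var i) s it ρ b = ≡.trans (cong hd (evalE-drop (suc (toℕ i)) (var #1) (s ∷ it ∷ []))) (b i)
evalE-pat leaf s it ρ b = refl
evalE-pat (node p q) s it ρ b = cong₂ consℕ (evalE-pat p s it ρ b) (evalE-pat q s it ρ b)

evalE-pat* : ∀ {n} (ps : List (Pat n)) s it (ρ : Vec Tree n) → Binds it ρ →
  evalE (patE* ps) (s ∷ it ∷ []) ≡ encList (map τ (ps ⟦ ρ ⟧*))
evalE-pat* [] s it ρ b = refl
evalE-pat* (p ∷ ps) s it ρ b = cong₂ consℕ (evalE-pat p s it ρ b) (evalE-pat* ps s it ρ b)

evalE-atom : ∀ {n} (a : Atom n) s it (ρ : Vec Tree n) → Binds it ρ →
  evalE (atomE a) (s ∷ it ∷ []) ≡ fact (a ⟦ ρ ⟧ₐ)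
evalE-atom (r , ps) s it ρ b = cong₂ consℕ (evalE-lit r (s ∷ it ∷ [])) (evalE-pat* ps s it ρ b)

push : List Fact → ℕ → ℕ
push fs s = foldr (consℕ ∘ fact) s fs

evalE-body : ∀ {n} (as : List (Atom n)) e s it (ρ : Vec Tree n) → Binds it ρ →
  evalE (bodyE as e) (s ∷ it ∷ []) ≡ push (map (_⟦ ρ ⟧ₐ) as) (evalE e (s ∷ it ∷ []))
evalE-body [] e s it ρ b = refl
evalE-body (a ∷ as) e s it ρ b = cong₂ consℕ (evalE-atom a s it ρ b) (evalE-body as e s it ρ b)

diff : ℕ → ℕ → ℕ
diff x y = (y ∸ x) + (x ∸ y)

diff-≡ : ∀ {x y} → x ≡ y → diff x y ≡ 0
diff-≡ {x} refl = cong₂ _+_ (n∸n≡0 x) (n∸n≡0 x)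

cond-zero : ∀ {k x y} → k ≡ 0 → cond k x y ≡ x
cond-zero refl = refl

diff-zero : ∀ {x y} → diff x y ≡ 0 → x ≡ y
diff-zero {x} {y} eq = ≤-antisym (m∸n≡0⇒m≤n (m+n≡0⇒n≡0 (y ∸ x) eq)) (m∸n≡0⇒m≤n (m+n≡0⇒m≡0 (y ∸ x) eq))

test-zero : ∀ i c s it → evalE (testE i c) (s ∷ it ∷ []) ≡ 0 → hd it ≡ i × s ≡ evalE (wantE c) (s ∷ it ∷ [])
test-zero i c s it eq
  with consℕ-inj {hd it} {s} {evalE (litE i) (s ∷ it ∷ [])} {evalE (wantE c) (s ∷ it ∷ [])}
         (diff-zero {consℕ (hd it) s} {consℕ (evalE (litE i) (s ∷ it ∷ [])) (evalE (wantE c) (s ∷ it ∷ []))} eq)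
... | p , q = ≡.trans p (evalE-lit i (s ∷ it ∷ [])) , q

binding : ∀ n it → Σ[ ρ ∈ Vec Tree n ] Binds it ρ
binding n it = Vec.tabulate (λ i → proj₁ (τ-surj (nth (suc (toℕ i)) it))) ,
  λ i → ≡.trans (sym (proj₂ (τ-surj (nth (suc (toℕ i)) it)))) (cong τ (sym (lookup∘tabulate _ i)))

module Machine (Π : List Clause) where

  step : ℕ → ℕ → ℕ
  step s it = evalE (stepE 0 Π) (s ∷ it ∷ [])

  -- The invariant is propagated backwards: the empty stack at the end of a successful run is good,
  -- and a step that leads to a good stack started from a good one.
  Good : ℕ → Set
  Good s = Σ[ fs ∈ List Fact ] s ≡ goals fs × All (Der Π) fs

  unpush : ∀ {n} (as : List (Atom n)) (ρ : Vec Tree n) {s} → Good (push (map (_⟦ ρ ⟧ₐ) as) s) →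
    All (λ a → Der Π (a ⟦ ρ ⟧ₐ)) as × Good s
  unpush [] ρ g = [] , g
  unpush (a ∷ as) ρ {s} (f ∷ fs , eq , d ∷ ds)
    with consℕ-inj {fact (a ⟦ ρ ⟧ₐ)} {push (map (_⟦ ρ ⟧ₐ) as) s} {fact f} {goals fs} eq
  ... | eq₁ , eq₂ with fact-inj {a ⟦ ρ ⟧ₐ} {f} eq₁ | unpush as ρ (fs , eq₂ , ds)
  ... | refl | es , g = d ∷ es , g

  stepE-sound : ∀ i cs → (∀ {c} → c ∈ cs → c ∈ Π) → ∀ s it →
    Good (evalE (stepE i cs) (s ∷ it ∷ [])) → Good s
  stepE-sound i [] sub s it g = g
  stepE-sound i (c ∷ cs) sub s it g
    with evalE (testE i c) (s ∷ it ∷ []) in eq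
  ... | suc _ = stepE-sound (suc i) cs (sub ∘ there) s it g
  ... | zero with binding (arity c) it
  ... | ρ , b with test-zero i c s it eq
  ... | _ , eq′ with unpush (body c) ρ {tl s}
                      (subst Good (evalE-body (body c) (ap tlFn (var #0 ∷ [])) s it ρ b) g)
  ... | ds , (gs , eqs , es) =
    head c ⟦ ρ ⟧ₐ ∷ gs , ≡.trans eq′ (cong₂ consℕ (evalE-atom (head c) s it ρ b) eqs) ,
    der (sub (here refl)) ρ ds ∷ es

  position : ∀ {c} {cs : List Clause} → c ∈ cs → ℕ
  position (here _) = 0
  position (there m) = suc (position m)

  stepE-complete : ∀ i {cs c} (m : c ∈ cs) s it (ρ : Vec Tree (arity c)) → Binds it ρ →
    hd it ≡ i + position m →
    evalE (stepE i cs) (consℕ (fact (head c ⟦ ρ ⟧ₐ)) s ∷ it ∷ []) ≡ push (map (_⟦ ρ ⟧ₐ) (body c)) s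
  stepE-complete i {c = c} (here refl) s it ρ b hd≡
    = ≡.trans (cond-zero (diff-≡ (cong₂ consℕ (≡.trans hd≡ (≡.trans (+-identityʳ i) (sym (evalE-lit i (top ∷ it ∷ [])))))
        (cong₂ consℕ (sym (evalE-atom (head c) top it ρ b)) (sym (tl-cons (fact (head c ⟦ ρ ⟧ₐ)) s))))))
      (≡.trans (evalE-body (body c) (ap tlFn (var #0 ∷ [])) top it ρ b)
        (cong (push (map (_⟦ ρ ⟧ₐ) (body c))) (tl-cons (fact (head c ⟦ ρ ⟧ₐ)) s)))
    where top = consℕ (fact (head c ⟦ ρ ⟧ₐ)) s
  stepE-complete i {c′ ∷ cs} {c} (there m) s it ρ b hd≡
    with evalE (testE i c′)
           (consℕ (fact (head c ⟦ ρ ⟧ₐ)) s ∷ it ∷ []) in eq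
  ... | suc _ = stepE-complete (suc i) m s it ρ b (≡.trans hd≡ (+-suc i (position m)))
  ... | zero with test-zero i c′ (consℕ (fact (head c ⟦ ρ ⟧ₐ)) s) it eq
  ... | eq′ , _ = contradiction
    (≡.trans (sym hd≡) eq′)
    (m+1+n≢m i)

  stepE-empty : ∀ i cs it → evalE (stepE i cs) (0 ∷ it ∷ []) ≡ 0
  stepE-empty i [] it = refl
  stepE-empty i (c ∷ cs) it
    with evalE (testE i c) (0 ∷ it ∷ []) in eq
  ... | suc _ = stepE-empty (suc i) cs it
  ... | zero with test-zero i c 0 it eq
  ... | _ , ()

  run : ℕ → ℕ → ℕ → ℕ
  run zero cert s = s
  run (suc k) cert s = step (run k cert s) (nth k cert)

  nthFn : Fn 2
  nthFn = respec (fn (ap hdFn (ap (recFn (var #0) (ap tlFn (var #1 ∷ []))) (var #0 ∷ var #1 ∷ []) ∷ [])))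
    (λ { (k ∷ c ∷ []) → nth k c }) λ { (k ∷ c ∷ []) → cong hd (go k c) }
    where
    go : ∀ k c → fun (recFn (var #0) (ap tlFn (var #1 ∷ []))) (k ∷ c ∷ []) ≡ drop-tl k c
    go zero c = refl
    go (suc k) c = cong tl (go k c)

  runStep : Ex 4
  runStep = ap (fn (stepE 0 Π)) (var #1 ∷ ap nthFn (var #0 ∷ var #2 ∷ []) ∷ [])

  runFn : Fn 3
  runFn = respec (recFn (var #1) runStep) (λ { (k ∷ c ∷ s ∷ []) → run k c s }) λ { (k ∷ c ∷ s ∷ []) → go k c s }
    where
    go : ∀ k c s → fun (recFn (var #1) runStep) (k ∷ c ∷ s ∷ []) ≡ run k c s
    go zero c s = refl
    go (suc k) c s = cong (λ r → step r (nth k c)) (go k c s)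

  run-sound : ∀ k cert s → Good (run k cert s) → Good s
  run-sound zero cert s g = g
  run-sound (suc k) cert s g =
    run-sound k cert s (stepE-sound 0 Π (λ m → m) (run k cert s) (nth k cert) g)

  -- Primitive recursion peels off the last step, whereas a certificate is assembled and replayed
  -- from its first item; this equation converts one view into the other.
  run-tl : ∀ k cert s → run (suc k) cert s ≡ run k (tl cert) (step s (hd cert))
  run-tl zero cert s = refl
  run-tl (suc k) cert s = cong₂ step (run-tl k cert s) (cong hd (sym (drop-tl-tl k cert)))

  run-empty : ∀ k cert → run k cert 0 ≡ 0
  run-empty zero cert = refl
  run-empty (suc k) cert rewrite run-empty k cert = stepE-empty 0 Π (nth k cert)

  replay : List ℕ → ℕ → ℕ
  replay [] s = s
  replay (it ∷ its) s = replay its (step s it)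

  replay-++ : ∀ is js s → replay (is ++ js) s ≡ replay js (replay is s)
  replay-++ [] js s = refl
  replay-++ (i ∷ is) js s = replay-++ is js (step s i)

  run-replay : ∀ k its s → length its ≤ k → replay its s ≡ 0 → run k (encList its) s ≡ 0
  run-replay k [] s _ refl = run-empty k 0
  run-replay (suc k) (it ∷ its) s (s≤s le) eq = ≡.trans (run-tl k (encList (it ∷ its)) s)
    (≡.trans (cong₂ (λ c i → run k c (step s i)) (tl-cons it (encList its)) (hd-cons it (encList its)))
      (run-replay k its (step s it) le eq))

  length≤encList : ∀ xs → length xs ≤ encList xs
  length≤encList [] = z≤n
  length≤encList (x ∷ xs) = s≤s (≤-trans (length≤encList xs) (pair-≥ʳ x (encList xs)))

  item : ∀ {n} → ℕ → Vec Tree n → ℕ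
  item i ρ = consℕ i (encList (Vec.toList (Vec.map τ ρ)))

  nth-item : ∀ {n} (ρ : Vec Tree n) i → nth (toℕ i) (encList (Vec.toList (Vec.map τ ρ))) ≡ τ (Vec.lookup ρ i)
  nth-item (t ∷ ρ) zero = hd-cons (τ t) (encList (Vec.toList (Vec.map τ ρ)))
  nth-item (t ∷ ρ) (suc i) = ≡.trans (cong hd (sym (drop-tl-tl (toℕ i) (encList (Vec.toList (Vec.map τ (t ∷ ρ)))))))
    (≡.trans (cong (nth (toℕ i)) (tl-cons (τ t) (encList (Vec.toList (Vec.map τ ρ))))) (nth-item ρ i))

  binds-item : ∀ {n} k (ρ : Vec Tree n) → Binds (item k ρ) ρ
  binds-item k ρ i = ≡.trans (cong hd (sym (drop-tl-tl (toℕ i) (item k ρ))))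
    (≡.trans (cong (nth (toℕ i)) (tl-cons k (encList (Vec.toList (Vec.map τ ρ))))) (nth-item ρ i))

  certify  : ∀ {f} → Der Π f → Σ[ its ∈ List ℕ ] ∀ s → replay its (consℕ (fact f) s) ≡ s
  certify* : ∀ {n} (as : List (Atom n)) (ρ : Vec Tree n) → All (λ a → Der Π (a ⟦ ρ ⟧ₐ)) as →
    Σ[ its ∈ List ℕ ] ∀ s → replay its (push (map (_⟦ ρ ⟧ₐ) as) s) ≡ s
  certify (der {c} m ρ ds) with certify* (body c) ρ ds
  ... | its , works = item (position m) ρ ∷ its , λ s → ≡.trans
    (cong (replay its) (stepE-complete 0 m s (item (position m) ρ) ρ (binds-item (position m) ρ)
      (hd-cons (position m) (encList (Vec.toList (Vec.map τ ρ)))))) (works s)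
  certify* [] ρ [] = [] , λ _ → refl
  certify* (a ∷ as) ρ (d ∷ ds) with certify d | certify* as ρ ds
  ... | is , works | js , works* = is ++ js , λ s → ≡.trans (replay-++ is js (push (map (_⟦ ρ ⟧ₐ) (a ∷ as)) s))
    (≡.trans (cong (replay js) (works (push (map (_⟦ ρ ⟧ₐ) as) s))) (works* s))

  -- The number searched for serves both as certificate and as number of steps. This loses nothing,
  -- because a list is no longer than its code and surplus steps leave the empty stack empty.
  semidecide : (goal : Fn 1) → Fn 2
  semidecide goal = fn (ap runFn (var #0 ∷ var #0 ∷ consE (ap goal (var #1 ∷ [])) (ap zeroFn []) ∷ []))

  semidecide-correct : ∀ goal f n → fun goal (n ∷ []) ≡ fact f →
    Der Π f ⇔ (∃ λ y → fun (semidecide goal) (y ∷ n ∷ []) ≡ 0)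
  semidecide-correct goal f n eq rewrite eq = mk⇔ to from
    where
    to : Der Π f → ∃ λ y → run y y (consℕ (fact f) 0) ≡ 0
    to d with certify d
    ... | its , works = encList its ,
      run-replay (encList its) its (consℕ (fact f) 0) (length≤encList its) (works 0)
    from : (∃ λ y → run y y (consℕ (fact f) 0) ≡ 0) → Der Π f
    from (y , eq₀) with run-sound y y (consℕ (fact f) 0) ([] , eq₀ , [])
    ... | g ∷ gs , eq₁ , d ∷ _ with consℕ-inj {fact f} {0} {fact g} {goals gs} eq₁
    ... | eq₂ , _ with fact-inj {f} {g} eq₂
    ... | refl = d

num : ℕ → Tree
num zero = leaf
num (suc n) = node leaf (num n)

num-inj : ∀ {m n} → num m ≡ num n → m ≡ n
num-inj {zero} {zero} _ = refl
num-inj {suc m} {suc n} eq = cong suc (num-inj (cong (λ { leaf → leaf ; (node _ t) → t }) eq))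

queryFn : ℕ → Fn 1
queryFn r = respec (fn (consE (litE r) (consE (ap (recFn (ap zeroFn []) numStep) (var #0 ∷ [])) (ap zeroFn []))))
  (λ { (n ∷ []) → fact (r , num n ∷ []) })
  λ { (n ∷ []) → cong₂ consℕ (evalE-lit r (n ∷ [])) (cong (λ k → consℕ k 0) (go n)) }
  where
  numStep : Ex 2
  numStep = consE (ap zeroFn []) (var #1)
  go : ∀ n → fun (recFn (ap zeroFn []) numStep) (n ∷ []) ≡ τ (num n)
  go zero = refl
  go (suc n) = cong (consℕ 0) (go n)

Der-RE : ∀ Π r → REℕ (λ n → Der Π (r , num n ∷ []))
Der-RE Π r = Mu (prog (semidecide (queryFn r))) , λ n →
  mk⇔ (Equivalence.from (halts n) ∘ Equivalence.to (correct n))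
      (Equivalence.from (correct n) ∘ Equivalence.to (halts n))
  where
  open Machine Π
  halts = λ n → Mu-halts (semidecide (queryFn r)) (n ∷ [])
  correct = λ n → semidecide-correct (queryFn r) (r , num n ∷ []) n refl

-- Terms, formulas and contexts as trees

⌜_⌝ᵗ : ∀ {n} → Tm n → Tree
⌜ fv x ⌝ᵗ = node leaf (num x)
⌜ bv i ⌝ᵗ = node (node leaf leaf) (num (toℕ i))

⌜_⌝ˡ : ∀ {n} → List (Tm n) → Tree
⌜ [] ⌝ˡ = leaf
⌜ t ∷ ts ⌝ˡ = node ⌜ t ⌝ᵗ ⌜ ts ⌝ˡ

⌜_⌝ : ∀ {n} → Fm n → Tree
⌜ atom p ts ⌝ = node (num 0) (node (num p) ⌜ ts ⌝ˡ)
⌜ A ⊗ B ⌝ = node (num 1) (node ⌜ A ⌝ ⌜ B ⌝)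
⌜ A ⊸ B ⌝ = node (num 2) (node ⌜ A ⌝ ⌜ B ⌝)
⌜ A & B ⌝ = node (num 3) (node ⌜ A ⌝ ⌜ B ⌝)
⌜ A ⊕ B ⌝ = node (num 4) (node ⌜ A ⌝ ⌜ B ⌝)
⌜ ! A ⌝ = node (num 5) ⌜ A ⌝
⌜ 𝟘 ⌝ = node (num 6) leaf
⌜ 𝟙 ⌝ = node (num 7) leaf
⌜ ⊤ ⌝ = node (num 8) leaf
⌜ ∀' A ⌝ = node (num 9) ⌜ A ⌝
⌜ ∃' A ⌝ = node (num 10) ⌜ A ⌝

⌜_⌝ᶜ : Ctx → Tree
⌜ [] ⌝ᶜ = leaf
⌜ A ∷ Γ ⌝ᶜ = node ⌜ A ⌝ ⌜ Γ ⌝ᶜ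

node-injˡ : ∀ {s t s′ t′ : Tree} → _≡_ {A = Tree} (node s t) (node s′ t′) → s ≡ s′
node-injˡ refl = refl

node-injʳ : ∀ {s t s′ t′ : Tree} → _≡_ {A = Tree} (node s t) (node s′ t′) → t ≡ t′
node-injʳ refl = refl

⌜⌝ᵗ-inj : ∀ {n} (s t : Tm n) → ⌜ s ⌝ᵗ ≡ ⌜ t ⌝ᵗ → s ≡ t
⌜⌝ᵗ-inj (fv x) (fv y) eq = cong fv (num-inj (node-injʳ eq))
⌜⌝ᵗ-inj (bv i) (bv j) eq = cong bv (toℕ-injective (num-inj (node-injʳ eq)))

⌜⌝ˡ-inj : ∀ {n} (ss ts : List (Tm n)) → ⌜ ss ⌝ˡ ≡ ⌜ ts ⌝ˡ → ss ≡ ts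
⌜⌝ˡ-inj [] [] eq = refl
⌜⌝ˡ-inj (s ∷ ss) (t ∷ ts) eq = cong₂ _∷_ (⌜⌝ᵗ-inj s t (node-injˡ eq)) (⌜⌝ˡ-inj ss ts (node-injʳ eq))

⌜⌝-inj : ∀ {n} (A B : Fm n) → ⌜ A ⌝ ≡ ⌜ B ⌝ → A ≡ B
⌜⌝-inj (atom p ss) (atom q ts) eq =
  cong₂ atom (num-inj (node-injˡ (node-injʳ eq))) (⌜⌝ˡ-inj ss ts (node-injʳ (node-injʳ eq)))
⌜⌝-inj (A ⊗ B) (A′ ⊗ B′) eq = cong₂ _⊗_ (⌜⌝-inj A A′ (node-injˡ (node-injʳ eq))) (⌜⌝-inj B B′ (node-injʳ (node-injʳ eq)))
⌜⌝-inj (A ⊸ B) (A′ ⊸ B′) eq = cong₂ _⊸_ (⌜⌝-inj A A′ (node-injˡ (node-injʳ eq))) (⌜⌝-inj B B′ (node-injʳ (node-injʳ eq)))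
⌜⌝-inj (A & B) (A′ & B′) eq = cong₂ _&_ (⌜⌝-inj A A′ (node-injˡ (node-injʳ eq))) (⌜⌝-inj B B′ (node-injʳ (node-injʳ eq)))
⌜⌝-inj (A ⊕ B) (A′ ⊕ B′) eq = cong₂ _⊕_ (⌜⌝-inj A A′ (node-injˡ (node-injʳ eq))) (⌜⌝-inj B B′ (node-injʳ (node-injʳ eq)))
⌜⌝-inj (! A) (! A′) eq = cong !_ (⌜⌝-inj A A′ (node-injʳ eq))
⌜⌝-inj 𝟘 𝟘 eq = refl
⌜⌝-inj 𝟙 𝟙 eq = refl
⌜⌝-inj ⊤ ⊤ eq = refl
⌜⌝-inj (∀' A) (∀' A′) eq = cong ∀' (⌜⌝-inj A A′ (node-injʳ eq))
⌜⌝-inj (∃' A) (∃' A′) eq = cong ∃' (⌜⌝-inj A A′ (node-injʳ eq))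

-- instσ n y is the substitution of inst - y under n binders.
instσ : ∀ n → Var → Fin (suc n) → Tm n
instσ zero y = λ _ → fv y
instσ (suc n) y = liftS (instσ n y)

wkT-bv : ∀ {n} (t : Tm n) m → ⌜ t ⌝ᵗ ≡ node (node leaf leaf) (num m) → ⌜ wkT t ⌝ᵗ ≡ node (node leaf leaf) (num (suc m))
wkT-bv (bv i) m eq with num-inj {toℕ i} {m} (node-injʳ eq)
... | refl = refl

instσ-< : ∀ n y (i : Fin (suc n)) → toℕ i < n → ⌜ instσ n y i ⌝ᵗ ≡ node (node leaf leaf) (num (toℕ i))
instσ-< (suc n) y zero lt = refl
instσ-< (suc n) y (suc i) (s≤s lt) = wkT-bv (instσ n y i) (toℕ i) (instσ-< n y i lt)

instσ-≡ : ∀ n y (i : Fin (suc n)) → toℕ i ≡ n → instσ n y i ≡ fv y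
instσ-≡ zero y i eq = refl
instσ-≡ (suc n) y (suc i) eq = cong wkT (instσ-≡ n y i (suc-injective eq))

-- A Horn program for derivability in ILL1, and its intended model

pattern LT m n        = 0 , m ∷ n ∷ []
pattern NEQ m n       = 1 , m ∷ n ∷ []
pattern PERM g d      = 2 , g ∷ d ∷ []
pattern APP g d e     = 3 , g ∷ d ∷ e ∷ []
pattern INSTT k y s t = 4 , k ∷ y ∷ s ∷ t ∷ []
pattern INSTL k y s t = 5 , k ∷ y ∷ s ∷ t ∷ []
pattern INST k y a b  = 6 , k ∷ y ∷ a ∷ b ∷ []
pattern FRESHT n y t  = 7 , n ∷ y ∷ t ∷ []
pattern FRESHL n y t  = 8 , n ∷ y ∷ t ∷ []
pattern FRESH n y a   = 9 , n ∷ y ∷ a ∷ []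
pattern FRESHC y g    = 10 , y ∷ g ∷ []
pattern BANG g        = 11 , g ∷ []
pattern SEQ g c       = 12 , g ∷ c ∷ []

-- The intended meaning of the predicates.  Arguments that a caller already knows to be codes
-- occur as hypotheses; this way, clauses may leave them unchecked.  J interprets further predicates.
infix 3 _⊨_
_⊨_ : (Fact → Set) → Fact → Set
J ⊨ LT m n = Σ[ i ∈ ℕ ] Σ[ j ∈ ℕ ] num i ≡ m × num j ≡ n × i < j
J ⊨ NEQ m n = Σ[ i ∈ ℕ ] Σ[ j ∈ ℕ ] num i ≡ m × num j ≡ n × i ≢ j
J ⊨ PERM g d = ∀ Δ → ⌜ Δ ⌝ᶜ ≡ d → Σ[ Γ ∈ Ctx ] ⌜ Γ ⌝ᶜ ≡ g × Γ ↭ Δ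
J ⊨ APP g d e = ∀ Θ → ⌜ Θ ⌝ᶜ ≡ e → Σ[ Γ ∈ Ctx ] Σ[ Δ ∈ Ctx ] ⌜ Γ ⌝ᶜ ≡ g × ⌜ Δ ⌝ᶜ ≡ d × Γ ++ Δ ≡ Θ
J ⊨ INSTT k y s t = ∀ n x (u : Tm (suc n)) → num n ≡ k → num x ≡ y → ⌜ u ⌝ᵗ ≡ s → ⌜ substT (instσ n x) u ⌝ᵗ ≡ t
J ⊨ INSTL k y s t = ∀ n x (us : List (Tm (suc n))) → num n ≡ k → num x ≡ y → ⌜ us ⌝ˡ ≡ s → ⌜ map (substT (instσ n x)) us ⌝ˡ ≡ t
J ⊨ INST k y a b = ∀ n x (A : Fm (suc n)) → num n ≡ k → num x ≡ y → ⌜ A ⌝ ≡ a → ⌜ substF (instσ n x) A ⌝ ≡ b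
J ⊨ FRESHT n y t = ∀ N x → num N ≡ n → num x ≡ y → Σ[ u ∈ Tm N ] ⌜ u ⌝ᵗ ≡ t × x ∉ fvT u
J ⊨ FRESHL n y t = ∀ N x → num N ≡ n → num x ≡ y → Σ[ us ∈ List (Tm N) ] ⌜ us ⌝ˡ ≡ t × x ∉ concatMap fvT us
J ⊨ FRESH n y a = ∀ N x → num N ≡ n → num x ≡ y → Σ[ A ∈ Fm N ] ⌜ A ⌝ ≡ a × x ∉ FV A
J ⊨ FRESHC y g = ∀ x → num x ≡ y → Σ[ Γ ∈ Ctx ] ⌜ Γ ⌝ᶜ ≡ g × x ∉ FVs Γ
J ⊨ BANG g = ∀ Γ → ⌜ Γ ⌝ᶜ ≡ g → Σ[ Δ ∈ Ctx ] map !_ Δ ≡ Γ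
J ⊨ SEQ g c = ∀ Γ C → ⌜ Γ ⌝ᶜ ≡ g → ⌜ C ⌝ ≡ c → Γ ⊢ C
J ⊨ f = J f

v0 : ∀ {n} → Pat (1 + n)
v0 = var zero
v1 : ∀ {n} → Pat (2 + n)
v1 = var (suc zero)
v2 : ∀ {n} → Pat (3 + n)
v2 = var (suc (suc zero))
v3 : ∀ {n} → Pat (4 + n)
v3 = var (suc (suc (suc zero)))
v4 : ∀ {n} → Pat (5 + n)
v4 = var (suc (suc (suc (suc zero))))
v5 : ∀ {n} → Pat (6 + n)
v5 = var (suc (suc (suc (suc (suc zero)))))
v6 : ∀ {n} → Pat (7 + n)
v6 = var (suc (suc (suc (suc (suc (suc zero))))))

numP : ∀ {n} → ℕ → Pat n
numP zero = leaf
numP (suc k) = node leaf (numP k)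

sucP : ∀ {n} → Pat n → Pat n
sucP p = node leaf p

un : ∀ {n} → ℕ → Pat n → Pat n
un k p = node (numP k) p

bin : ∀ {n} → ℕ → Pat n → Pat n → Pat n
bin k p q = node (numP k) (node p q)

fvP bvP : ∀ {n} → Pat n → Pat n
fvP = un 0
bvP = un 1

clause : (n : ℕ) → Atom n → List (Atom n) → Clause
clause n h b = h ⇐ b

orderClauses : List Clause
orderClauses
  = clause 0 (LT leaf (numP 1)) []
  ∷ clause 2 (LT v0 (sucP v1)) (LT v0 v1 ∷ [])
  ∷ clause 2 (LT (sucP v0) (sucP v1)) (LT v0 v1 ∷ [])
  ∷ clause 2 (NEQ v0 v1) (LT v0 v1 ∷ [])
  ∷ clause 2 (NEQ v0 v1) (LT v1 v0 ∷ [])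
  ∷ []

orderModel : ∀ {J} → Model orderClauses (J ⊨_)
orderModel
  = (λ { [] [] → 0 , 1 , refl , refl , s≤s z≤n })
  ∷ (λ { (_ ∷ _ ∷ []) ((i , j , refl , refl , lt) ∷ []) → i , suc j , refl , refl , m<n⇒m<1+n lt })
  ∷ (λ { (_ ∷ _ ∷ []) ((i , j , refl , refl , lt) ∷ []) → suc i , suc j , refl , refl , s≤s lt })
  ∷ (λ { (_ ∷ _ ∷ []) ((i , j , refl , refl , lt) ∷ []) → i , j , refl , refl , <⇒≢ lt })
  ∷ (λ { (_ ∷ _ ∷ []) ((i , j , refl , refl , lt) ∷ []) → j , i , refl , refl , >⇒≢ lt })
  ∷ []

contextClauses : List Clause
contextClauses
  = clause 1 (PERM v0 v0) []
  ∷ clause 3 (PERM (node v0 v1) (node v0 v2)) (PERM v1 v2 ∷ [])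
  ∷ clause 4 (PERM (node v0 (node v1 v2)) (node v1 (node v0 v3))) (PERM v2 v3 ∷ [])
  ∷ clause 3 (PERM v0 v2) (PERM v0 v1 ∷ PERM v1 v2 ∷ [])
  ∷ clause 1 (APP leaf v0 v0) []
  ∷ clause 4 (APP (node v0 v1) v2 (node v0 v3)) (APP v1 v2 v3 ∷ [])
  ∷ clause 0 (BANG leaf) []
  ∷ clause 2 (BANG (node (un 5 v0) v1)) (BANG v1 ∷ [])
  ∷ []

contextModel : ∀ {J} → Model contextClauses (J ⊨_)
contextModel
  = (λ { (_ ∷ []) [] Δ eq → Δ , eq , refl })
  ∷ (λ { (_ ∷ _ ∷ _ ∷ []) (h ∷ []) (A ∷ Δ) refl → let Γ , eq , p = h Δ refl in
         A ∷ Γ , cong (node ⌜ A ⌝) eq , prep A p })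
  ∷ (λ { (_ ∷ _ ∷ _ ∷ _ ∷ []) (h ∷ []) (A ∷ B ∷ Δ) refl → let Γ , eq , p = h Δ refl in
         B ∷ A ∷ Γ , cong (λ g → node ⌜ B ⌝ (node ⌜ A ⌝ g)) eq , swap B A p })
  ∷ (λ { (_ ∷ _ ∷ _ ∷ []) (h₁ ∷ h₂ ∷ []) Δ eq → let Θ , eq₂ , q = h₂ Δ eq ; Γ , eq₁ , p = h₁ Θ eq₂ in
         Γ , eq₁ , trans p q })
  ∷ (λ { (_ ∷ []) [] Θ eq → [] , Θ , refl , eq , refl })
  ∷ (λ { (_ ∷ _ ∷ _ ∷ _ ∷ []) (h ∷ []) (A ∷ Θ) refl → let Γ , Δ , eq₁ , eq₂ , eq₃ = h Θ refl in
         A ∷ Γ , Δ , cong (node ⌜ A ⌝) eq₁ , eq₂ , cong (A ∷_) eq₃ })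
  ∷ (λ { [] [] [] refl → [] , refl })
  ∷ (λ { (_ ∷ _ ∷ []) (h ∷ []) (! A ∷ Γ) refl → let Δ , eq = h Γ refl in A ∷ Δ , cong (! A ∷_) eq })
  ∷ []

instClauses : List Clause
instClauses
  = clause 3 (INSTT v0 v1 (fvP v2) (fvP v2)) []
  -- Under `k` binders the variable to be replaced has index `k`; smaller indices are bound further
  -- inside and stay.
  ∷ clause 3 (INSTT v0 v1 (bvP v2) (bvP v2)) (LT v2 v0 ∷ [])
  ∷ clause 2 (INSTT v0 v1 (bvP v0) (fvP v1)) []
  ∷ clause 2 (INSTL v0 v1 leaf leaf) []
  ∷ clause 6 (INSTL v0 v1 (node v2 v3) (node v4 v5)) (INSTT v0 v1 v2 v4 ∷ INSTL v0 v1 v3 v5 ∷ [])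
  ∷ clause 5 (INST v0 v1 (bin 0 v2 v3) (bin 0 v2 v4)) (INSTL v0 v1 v3 v4 ∷ [])
  ∷ clause 6 (INST v0 v1 (bin 1 v2 v3) (bin 1 v4 v5)) (INST v0 v1 v2 v4 ∷ INST v0 v1 v3 v5 ∷ [])
  ∷ clause 6 (INST v0 v1 (bin 2 v2 v3) (bin 2 v4 v5)) (INST v0 v1 v2 v4 ∷ INST v0 v1 v3 v5 ∷ [])
  ∷ clause 6 (INST v0 v1 (bin 3 v2 v3) (bin 3 v4 v5)) (INST v0 v1 v2 v4 ∷ INST v0 v1 v3 v5 ∷ [])
  ∷ clause 6 (INST v0 v1 (bin 4 v2 v3) (bin 4 v4 v5)) (INST v0 v1 v2 v4 ∷ INST v0 v1 v3 v5 ∷ [])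
  ∷ clause 4 (INST v0 v1 (un 5 v2) (un 5 v3)) (INST v0 v1 v2 v3 ∷ [])
  ∷ clause 2 (INST v0 v1 (un 6 leaf) (un 6 leaf)) []
  ∷ clause 2 (INST v0 v1 (un 7 leaf) (un 7 leaf)) []
  ∷ clause 2 (INST v0 v1 (un 8 leaf) (un 8 leaf)) []
  ∷ clause 4 (INST v0 v1 (un 9 v2) (un 9 v3)) (INST (sucP v0) v1 v2 v3 ∷ [])
  ∷ clause 4 (INST v0 v1 (un 10 v2) (un 10 v3)) (INST (sucP v0) v1 v2 v3 ∷ [])
  ∷ []

node-cong : ∀ k {s t s′ t′ : Tree} → s ≡ s′ → t ≡ t′ → _≡_ {A = Tree} (node (num k) (node s t)) (node (num k) (node s′ t′))
node-cong k refl refl = refl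

instModel : ∀ {J} → Model instClauses (J ⊨_)
instModel
  = (λ { (_ ∷ _ ∷ _ ∷ []) [] n x (fv _) refl refl refl → refl })
  ∷ (λ { (_ ∷ _ ∷ _ ∷ []) ((i , j , eq₁ , eq₂ , lt) ∷ []) n x (bv m) refl refl refl →
         instσ-< n x m (≡.subst₂ _<_ (num-inj eq₁) (num-inj eq₂) lt) })
  ∷ (λ { (_ ∷ _ ∷ []) [] n x (bv m) eq refl eq′ →
         cong ⌜_⌝ᵗ (instσ-≡ n x m (num-inj (≡.trans (node-injʳ eq′) (sym eq)))) })
  ∷ (λ { (_ ∷ _ ∷ []) [] n x [] refl refl refl → refl })
  ∷ (λ { (_ ∷ _ ∷ _ ∷ _ ∷ _ ∷ _ ∷ []) (h ∷ h′ ∷ []) n x (u ∷ us) refl refl refl →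
         cong₂ node (h n x u refl refl refl) (h′ n x us refl refl refl) })
  ∷ (λ { (_ ∷ _ ∷ _ ∷ _ ∷ _ ∷ []) (h ∷ []) n x (atom p us) refl refl refl →
         node-cong 0 refl (h n x us refl refl refl) })
  ∷ (λ { (_ ∷ _ ∷ _ ∷ _ ∷ _ ∷ _ ∷ []) (h ∷ h′ ∷ []) n x (A ⊗ B) refl refl refl →
         node-cong 1 (h n x A refl refl refl) (h′ n x B refl refl refl) })
  ∷ (λ { (_ ∷ _ ∷ _ ∷ _ ∷ _ ∷ _ ∷ []) (h ∷ h′ ∷ []) n x (A ⊸ B) refl refl refl →
         node-cong 2 (h n x A refl refl refl) (h′ n x B refl refl refl) })
  ∷ (λ { (_ ∷ _ ∷ _ ∷ _ ∷ _ ∷ _ ∷ []) (h ∷ h′ ∷ []) n x (A & B) refl refl refl →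
         node-cong 3 (h n x A refl refl refl) (h′ n x B refl refl refl) })
  ∷ (λ { (_ ∷ _ ∷ _ ∷ _ ∷ _ ∷ _ ∷ []) (h ∷ h′ ∷ []) n x (A ⊕ B) refl refl refl →
         node-cong 4 (h n x A refl refl refl) (h′ n x B refl refl refl) })
  ∷ (λ { (_ ∷ _ ∷ _ ∷ _ ∷ []) (h ∷ []) n x (! A) refl refl refl → cong (node (num 5)) (h n x A refl refl refl) })
  ∷ (λ { (_ ∷ _ ∷ []) [] n x 𝟘 refl refl refl → refl })
  ∷ (λ { (_ ∷ _ ∷ []) [] n x 𝟙 refl refl refl → refl })
  ∷ (λ { (_ ∷ _ ∷ []) [] n x ⊤ refl refl refl → refl })
  ∷ (λ { (_ ∷ _ ∷ _ ∷ _ ∷ []) (h ∷ []) n x (∀' A) refl refl refl →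
         cong (node (num 9)) (h (suc n) x A refl refl refl) })
  ∷ (λ { (_ ∷ _ ∷ _ ∷ _ ∷ []) (h ∷ []) n x (∃' A) refl refl refl →
         cong (node (num 10)) (h (suc n) x A refl refl refl) })
  ∷ []

freshClauses : List Clause
freshClauses
  = clause 3 (FRESHT v0 v1 (fvP v2)) (NEQ v1 v2 ∷ [])
  ∷ clause 3 (FRESHT v0 v1 (bvP v2)) (LT v2 v0 ∷ [])
  ∷ clause 2 (FRESHL v0 v1 leaf) []
  ∷ clause 4 (FRESHL v0 v1 (node v2 v3)) (FRESHT v0 v1 v2 ∷ FRESHL v0 v1 v3 ∷ [])
  -- The predicate symbol has to be a numeral; `LT v2 v4` with an arbitrary `v4` says so. `FRESH`
  -- thereby doubles as a test for being the code of a formula.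
  ∷ clause 5 (FRESH v0 v1 (bin 0 v2 v3)) (LT v2 v4 ∷ FRESHL v0 v1 v3 ∷ [])
  ∷ clause 4 (FRESH v0 v1 (bin 1 v2 v3)) (FRESH v0 v1 v2 ∷ FRESH v0 v1 v3 ∷ [])
  ∷ clause 4 (FRESH v0 v1 (bin 2 v2 v3)) (FRESH v0 v1 v2 ∷ FRESH v0 v1 v3 ∷ [])
  ∷ clause 4 (FRESH v0 v1 (bin 3 v2 v3)) (FRESH v0 v1 v2 ∷ FRESH v0 v1 v3 ∷ [])
  ∷ clause 4 (FRESH v0 v1 (bin 4 v2 v3)) (FRESH v0 v1 v2 ∷ FRESH v0 v1 v3 ∷ [])
  ∷ clause 3 (FRESH v0 v1 (un 5 v2)) (FRESH v0 v1 v2 ∷ [])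
  ∷ clause 2 (FRESH v0 v1 (un 6 leaf)) []
  ∷ clause 2 (FRESH v0 v1 (un 7 leaf)) []
  ∷ clause 2 (FRESH v0 v1 (un 8 leaf)) []
  ∷ clause 3 (FRESH v0 v1 (un 9 v2)) (FRESH (sucP v0) v1 v2 ∷ [])
  ∷ clause 3 (FRESH v0 v1 (un 10 v2)) (FRESH (sucP v0) v1 v2 ∷ [])
  ∷ clause 1 (FRESHC v0 leaf) []
  ∷ clause 3 (FRESHC v0 (node v1 v2)) (FRESH leaf v0 v1 ∷ FRESHC v0 v2 ∷ [])
  ∷ []

∉-++ : ∀ {x : Var} xs {ys} → x ∉ xs → x ∉ ys → x ∉ xs ++ ys
∉-++ xs p q = [ p , q ]′ ∘ ∈-++⁻ xs

freshModel : ∀ {J} → Model freshClauses (J ⊨_)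
freshModel
  = (λ { (_ ∷ _ ∷ _ ∷ []) ((i , j , eq , refl , i≢j) ∷ []) n x refl refl →
         fv j , refl , λ { (here refl) → i≢j (num-inj eq) } })
  ∷ (λ { (_ ∷ _ ∷ _ ∷ []) ((i , j , refl , eq , lt) ∷ []) n x refl refl →
         let lt′ = subst (i <_) (num-inj eq) lt in
         bv (Fin.fromℕ< lt′) , cong (node _ ∘ num) (toℕ-fromℕ< lt′) , λ () })
  ∷ (λ { (_ ∷ _ ∷ []) [] n x refl refl → [] , refl , λ () })
  ∷ (λ { (_ ∷ _ ∷ _ ∷ _ ∷ []) (h ∷ h′ ∷ []) n x refl refl →
         let u , eq , p = h n x refl refl ; us , eq′ , p′ = h′ n x refl refl in
         u ∷ us , cong₂ node eq eq′ , ∉-++ (fvT u) p p′ })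
  ∷ (λ { (_ ∷ _ ∷ _ ∷ _ ∷ _ ∷ []) ((i , j , eq , _ , _) ∷ h ∷ []) n x refl refl →
         let us , eq′ , p = h n x refl refl in atom i us , node-cong 0 eq eq′ , p })
  ∷ (λ { (_ ∷ _ ∷ _ ∷ _ ∷ []) (h ∷ h′ ∷ []) n x refl refl →
         let A , eq , p = h n x refl refl ; B , eq′ , p′ = h′ n x refl refl in
         A ⊗ B , node-cong 1 eq eq′ , ∉-++ (FV A) p p′ })
  ∷ (λ { (_ ∷ _ ∷ _ ∷ _ ∷ []) (h ∷ h′ ∷ []) n x refl refl →
         let A , eq , p = h n x refl refl ; B , eq′ , p′ = h′ n x refl refl in
         A ⊸ B , node-cong 2 eq eq′ , ∉-++ (FV A) p p′ })
  ∷ (λ { (_ ∷ _ ∷ _ ∷ _ ∷ []) (h ∷ h′ ∷ []) n x refl refl →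
         let A , eq , p = h n x refl refl ; B , eq′ , p′ = h′ n x refl refl in
         A & B , node-cong 3 eq eq′ , ∉-++ (FV A) p p′ })
  ∷ (λ { (_ ∷ _ ∷ _ ∷ _ ∷ []) (h ∷ h′ ∷ []) n x refl refl →
         let A , eq , p = h n x refl refl ; B , eq′ , p′ = h′ n x refl refl in
         A ⊕ B , node-cong 4 eq eq′ , ∉-++ (FV A) p p′ })
  ∷ (λ { (_ ∷ _ ∷ _ ∷ []) (h ∷ []) n x refl refl →
         let A , eq , p = h n x refl refl in ! A , cong (node (num 5)) eq , p })
  ∷ (λ { (_ ∷ _ ∷ []) [] n x refl refl → 𝟘 , refl , λ () })
  ∷ (λ { (_ ∷ _ ∷ []) [] n x refl refl → 𝟙 , refl , λ () })
  ∷ (λ { (_ ∷ _ ∷ []) [] n x refl refl → ⊤ , refl , λ () })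
  ∷ (λ { (_ ∷ _ ∷ _ ∷ []) (h ∷ []) n x refl refl →
         let A , eq , p = h (suc n) x refl refl in ∀' A , cong (node (num 9)) eq , p })
  ∷ (λ { (_ ∷ _ ∷ _ ∷ []) (h ∷ []) n x refl refl →
         let A , eq , p = h (suc n) x refl refl in ∃' A , cong (node (num 10)) eq , p })
  ∷ (λ { (_ ∷ []) [] x refl → [] , refl , λ () })
  ∷ (λ { (_ ∷ _ ∷ _ ∷ []) (h ∷ h′ ∷ []) x refl →
         let A , eq , p = h 0 x refl refl ; Γ , eq′ , p′ = h′ x refl in
         A ∷ Γ , cong₂ node eq eq′ , ∉-++ (FV A) p p′ })
  ∷ []

⌜⌝ᶜ-inj : ∀ Γ Δ → ⌜ Γ ⌝ᶜ ≡ ⌜ Δ ⌝ᶜ → Γ ≡ Δ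
⌜⌝ᶜ-inj [] [] eq = refl
⌜⌝ᶜ-inj (A ∷ Γ) (B ∷ Δ) eq = cong₂ _∷_ (⌜⌝-inj A B (node-injˡ eq)) (⌜⌝ᶜ-inj Γ Δ (node-injʳ eq))

-- Rules are read from the conclusion upwards: if the conclusion consists of codes, then so do the
-- premises. Whatever a premise introduces must be certified by a further atom: a split context by
-- `APP`, an instance by `INST`, a variable by an atom `LT` that makes it a numeral.
sequentClauses : List Clause
sequentClauses
  = clause 1 (SEQ (node v0 leaf) v0) []
  ∷ clause 3 (SEQ v1 v2) (PERM v0 v1 ∷ SEQ v0 v2 ∷ [])
  -- The cut formula `v3` does not occur in the conclusion, so it has to be shown to be a formula;
  -- freshness of some variable `v5` for it does this.
  ∷ clause 7 (SEQ v2 v4) (FRESH leaf v5 v3 ∷ LT v5 v6 ∷ APP v0 v1 v2 ∷ SEQ v0 v3 ∷ SEQ (node v3 v1) v4 ∷ [])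
  ∷ clause 4 (SEQ (node (bin 1 v0 v1) v2) v3) (SEQ (node v0 (node v1 v2)) v3 ∷ [])
  ∷ clause 5 (SEQ v2 (bin 1 v3 v4)) (APP v0 v1 v2 ∷ SEQ v0 v3 ∷ SEQ v1 v4 ∷ [])
  ∷ clause 6 (SEQ (node (bin 2 v3 v4) v2) v5) (APP v0 v1 v2 ∷ SEQ v0 v3 ∷ SEQ (node v4 v1) v5 ∷ [])
  ∷ clause 3 (SEQ v0 (bin 2 v1 v2)) (SEQ (node v1 v0) v2 ∷ [])
  ∷ clause 4 (SEQ (node (bin 3 v0 v1) v2) v3) (SEQ (node v0 v2) v3 ∷ [])
  ∷ clause 4 (SEQ (node (bin 3 v0 v1) v2) v3) (SEQ (node v1 v2) v3 ∷ [])
  ∷ clause 3 (SEQ v0 (bin 3 v1 v2)) (SEQ v0 v1 ∷ SEQ v0 v2 ∷ [])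
  ∷ clause 4 (SEQ (node (bin 4 v0 v1) v2) v3) (SEQ (node v0 v2) v3 ∷ SEQ (node v1 v2) v3 ∷ [])
  ∷ clause 3 (SEQ v0 (bin 4 v1 v2)) (SEQ v0 v1 ∷ [])
  ∷ clause 3 (SEQ v0 (bin 4 v1 v2)) (SEQ v0 v2 ∷ [])
  ∷ clause 2 (SEQ (node (un 6 leaf) v0) v1) []
  ∷ clause 2 (SEQ (node (un 7 leaf) v0) v1) (SEQ v0 v1 ∷ [])
  ∷ clause 0 (SEQ leaf (un 7 leaf)) []
  ∷ clause 1 (SEQ v0 (un 8 leaf)) []
  ∷ clause 3 (SEQ (node (un 5 v0) v1) v2) (SEQ (node v0 v1) v2 ∷ [])
  ∷ clause 3 (SEQ (node (un 5 v0) v1) v2) (SEQ v1 v2 ∷ [])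
  ∷ clause 3 (SEQ (node (un 5 v0) v1) v2) (SEQ (node (un 5 v0) (node (un 5 v0) v1)) v2 ∷ [])
  ∷ clause 2 (SEQ v0 (un 5 v1)) (BANG v0 ∷ SEQ v0 v1 ∷ [])
  ∷ clause 6 (SEQ (node (un 9 v0) v1) v2) (LT v3 v4 ∷ INST leaf v3 v0 v5 ∷ SEQ (node v5 v1) v2 ∷ [])
  ∷ clause 5 (SEQ v0 (un 9 v1))
      (LT v2 v3 ∷ FRESHC v2 v0 ∷ FRESH (numP 1) v2 v1 ∷ INST leaf v2 v1 v4 ∷ SEQ v0 v4 ∷ [])
  ∷ clause 6 (SEQ (node (un 10 v0) v1) v2)
      (LT v3 v4 ∷ FRESHC v3 v1 ∷ FRESH (numP 1) v3 v0 ∷ FRESH leaf v3 v2 ∷ INST leaf v3 v0 v5 ∷ SEQ (node v5 v1) v2 ∷ [])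
  ∷ clause 5 (SEQ v0 (un 10 v1)) (LT v2 v3 ∷ INST leaf v2 v1 v4 ∷ SEQ v0 v4 ∷ [])
  ∷ []

-- The model only promises some formula with the given code; injectivity of codes identifies it with
-- `A`.
fresh⇒∉ : ∀ J {N} y (A : Fm N) → (J ⊨ FRESH (num N) (num y) ⌜ A ⌝) → y ∉ FV A
fresh⇒∉ J {N} y A h with h N y refl refl
... | B , eq , p with ⌜⌝-inj B A eq
... | refl = p

freshC⇒∉ : ∀ J y Γ → (J ⊨ FRESHC (num y) ⌜ Γ ⌝ᶜ) → y ∉ FVs Γ
freshC⇒∉ J y Γ h with h y refl
... | Δ , eq , p with ⌜⌝ᶜ-inj Δ Γ eq
... | refl = p

sequentModel : ∀ {J} → Model sequentClauses (J ⊨_)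
sequentModel {J}
  = (λ { (_ ∷ []) [] (A ∷ []) C refl eq → subst (A ∷ [] ⊢_) (⌜⌝-inj A C (sym eq)) ax })
  ∷ (λ { (_ ∷ _ ∷ _ ∷ []) (p ∷ h ∷ []) Δ C refl refl → let Γ , eq , q = p Δ refl in exch q (h Γ C eq refl) })
  ∷ (λ { (_ ∷ _ ∷ _ ∷ _ ∷ _ ∷ _ ∷ _ ∷ []) (f ∷ (y , _ , refl , _) ∷ p ∷ h₁ ∷ h₂ ∷ []) Θ C refl refl →
         let Γ , Δ , eq₁ , eq₂ , eq = p Θ refl ; A , eq₃ , _ = f 0 y refl refl in
         subst (_⊢ C) eq (cut (h₁ Γ A eq₁ eq₃) (h₂ (A ∷ Δ) C (cong₂ node eq₃ eq₂) refl)) })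
  ∷ (λ { (_ ∷ _ ∷ _ ∷ _ ∷ []) (h ∷ []) (A ⊗ B ∷ Γ) C refl refl → ⊗L (h (A ∷ B ∷ Γ) C refl refl) })
  ∷ (λ { (_ ∷ _ ∷ _ ∷ _ ∷ _ ∷ []) (p ∷ h₁ ∷ h₂ ∷ []) Θ (A ⊗ B) refl refl →
         let Γ , Δ , eq₁ , eq₂ , eq = p Θ refl in
         subst (_⊢ A ⊗ B) eq (⊗R (h₁ Γ A eq₁ refl) (h₂ Δ B eq₂ refl)) })
  ∷ (λ { (_ ∷ _ ∷ _ ∷ _ ∷ _ ∷ _ ∷ []) (p ∷ h₁ ∷ h₂ ∷ []) ((A ⊸ B) ∷ Θ) C refl refl →
         let Γ , Δ , eq₁ , eq₂ , eq = p Θ refl in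
         subst (λ Θ → (A ⊸ B) ∷ Θ ⊢ C) eq (⊸L (h₁ Γ A eq₁ refl) (h₂ (B ∷ Δ) C (cong (node ⌜ B ⌝) eq₂) refl)) })
  ∷ (λ { (_ ∷ _ ∷ _ ∷ []) (h ∷ []) Γ (A ⊸ B) refl refl → ⊸R (h (A ∷ Γ) B refl refl) })
  ∷ (λ { (_ ∷ _ ∷ _ ∷ _ ∷ []) (h ∷ []) (A & B ∷ Γ) C refl refl → &L₁ (h (A ∷ Γ) C refl refl) })
  ∷ (λ { (_ ∷ _ ∷ _ ∷ _ ∷ []) (h ∷ []) (A & B ∷ Γ) C refl refl → &L₂ (h (B ∷ Γ) C refl refl) })
  ∷ (λ { (_ ∷ _ ∷ _ ∷ []) (h₁ ∷ h₂ ∷ []) Γ (A & B) refl refl → &R (h₁ Γ A refl refl) (h₂ Γ B refl refl) })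
  ∷ (λ { (_ ∷ _ ∷ _ ∷ _ ∷ []) (h₁ ∷ h₂ ∷ []) (A ⊕ B ∷ Γ) C refl refl →
         ⊕L (h₁ (A ∷ Γ) C refl refl) (h₂ (B ∷ Γ) C refl refl) })
  ∷ (λ { (_ ∷ _ ∷ _ ∷ []) (h ∷ []) Γ (A ⊕ B) refl refl → ⊕R₁ (h Γ A refl refl) })
  ∷ (λ { (_ ∷ _ ∷ _ ∷ []) (h ∷ []) Γ (A ⊕ B) refl refl → ⊕R₂ (h Γ B refl refl) })
  ∷ (λ { (_ ∷ _ ∷ []) [] (𝟘 ∷ Γ) C refl refl → 𝟘L })
  ∷ (λ { (_ ∷ _ ∷ []) (h ∷ []) (𝟙 ∷ Γ) C refl refl → 𝟙L (h Γ C refl refl) })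
  ∷ (λ { [] [] [] 𝟙 refl refl → 𝟙R })
  ∷ (λ { (_ ∷ []) [] Γ ⊤ refl refl → ⊤R })
  ∷ (λ { (_ ∷ _ ∷ _ ∷ []) (h ∷ []) (! A ∷ Γ) C refl refl → !L (h (A ∷ Γ) C refl refl) })
  ∷ (λ { (_ ∷ _ ∷ _ ∷ []) (h ∷ []) (! A ∷ Γ) C refl refl → !W (h Γ C refl refl) })
  ∷ (λ { (_ ∷ _ ∷ _ ∷ []) (h ∷ []) (! A ∷ Γ) C refl refl → !C (h (! A ∷ ! A ∷ Γ) C refl refl) })
  ∷ (λ { (_ ∷ _ ∷ []) (b ∷ h ∷ []) Γ (! A) refl refl → let Δ , eq = b Γ refl in
         subst (_⊢ ! A) eq (!R (subst (_⊢ A) (sym eq) (h Γ A refl refl))) })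
  ∷ (λ { (_ ∷ _ ∷ _ ∷ _ ∷ _ ∷ _ ∷ []) ((y , _ , refl , _) ∷ i ∷ h ∷ []) (∀' A ∷ Γ) C refl refl →
         ∀L y (h (inst A y ∷ Γ) C (cong (λ b → node b ⌜ Γ ⌝ᶜ) (i 0 y A refl refl refl)) refl) })
  ∷ (λ { (_ ∷ _ ∷ _ ∷ _ ∷ _ ∷ []) ((y , _ , refl , _) ∷ f ∷ f′ ∷ i ∷ h ∷ []) Γ (∀' A) refl refl →
         ∀R y (freshC⇒∉ J y Γ f) (fresh⇒∉ J y A f′) (h Γ (inst A y) refl (i 0 y A refl refl refl)) })
  ∷ (λ { (_ ∷ _ ∷ _ ∷ _ ∷ _ ∷ _ ∷ []) ((y , _ , refl , _) ∷ f ∷ f′ ∷ f″ ∷ i ∷ h ∷ []) (∃' A ∷ Γ) C refl refl →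
         ∃L y (freshC⇒∉ J y Γ f) (fresh⇒∉ J y A f′) (fresh⇒∉ J y C f″)
           (h (inst A y ∷ Γ) C (cong (λ b → node b ⌜ Γ ⌝ᶜ) (i 0 y A refl refl refl)) refl) })
  ∷ (λ { (_ ∷ _ ∷ _ ∷ _ ∷ _ ∷ []) ((y , _ , refl , _) ∷ i ∷ h ∷ []) Γ (∃' A) refl refl →
         ∃R y (h Γ (inst A y) refl (i 0 y A refl refl refl)) })
  ∷ []

logicClauses : List Clause
logicClauses = orderClauses ++ contextClauses ++ instClauses ++ freshClauses ++ sequentClauses

logicModel : ∀ {J} → Model logicClauses (J ⊨_)
logicModel = AllP.++⁺ orderModel (AllP.++⁺ contextModel (AllP.++⁺ instModel (AllP.++⁺ freshModel sequentModel)))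

-- Derivations of ILL1 as derivations of the Horn program

module Complete {Π : List Clause} (sub : ∀ {c} → c ∈ logicClauses → c ∈ Π) where

  ord : ∀ i → List.lookup orderClauses i ∈ Π
  ord i = sub (∈-++⁺ˡ (∈-lookup {xs = orderClauses} i))

  con : ∀ i → List.lookup contextClauses i ∈ Π
  con i = sub (∈-++⁺ʳ orderClauses (∈-++⁺ˡ (∈-lookup {xs = contextClauses} i)))

  ins : ∀ i → List.lookup instClauses i ∈ Π
  ins i = sub (∈-++⁺ʳ orderClauses (∈-++⁺ʳ contextClauses (∈-++⁺ˡ (∈-lookup {xs = instClauses} i))))

  fre : ∀ i → List.lookup freshClauses i ∈ Π
  fre i = sub (∈-++⁺ʳ orderClauses (∈-++⁺ʳ contextClauses (∈-++⁺ʳ instClauses (∈-++⁺ˡ (∈-lookup {xs = freshClauses} i)))))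

  seq : ∀ i → List.lookup sequentClauses i ∈ Π
  seq i = sub (∈-++⁺ʳ orderClauses (∈-++⁺ʳ contextClauses (∈-++⁺ʳ instClauses (∈-++⁺ʳ freshClauses (∈-lookup {xs = sequentClauses} i)))))

  Der-LT : ∀ {i j} → i < j → Der Π (LT (num i) (num j))
  Der-LT {zero} {suc zero} _ = der (ord (# 0)) [] []
  Der-LT {zero} {suc (suc j)} _ = der (ord (# 1)) (leaf ∷ num (suc j) ∷ []) (Der-LT {0} {suc j} (s≤s z≤n) ∷ [])
  Der-LT {suc i} {suc j} (s≤s lt) = der (ord (# 2)) (num i ∷ num j ∷ []) (Der-LT lt ∷ [])

  Der-NEQ : ∀ {i j} → i ≢ j → Der Π (NEQ (num i) (num j))
  Der-NEQ {i} {j} i≢j with <-cmp i j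
  ... | tri< lt _ _ = der (ord (# 3)) (num i ∷ num j ∷ []) (Der-LT lt ∷ [])
  ... | tri≈ _ eq _ = contradiction eq i≢j
  ... | tri> _ _ gt = der (ord (# 4)) (num i ∷ num j ∷ []) (Der-LT gt ∷ [])

  Der-PERM : ∀ {Γ Δ} → Γ ↭ Δ → Der Π (PERM ⌜ Γ ⌝ᶜ ⌜ Δ ⌝ᶜ)
  Der-PERM {Γ} refl = der (con (# 0)) (⌜ Γ ⌝ᶜ ∷ []) []
  Der-PERM (prep {Γ} {Δ} A p) = der (con (# 1)) (⌜ A ⌝ ∷ ⌜ Γ ⌝ᶜ ∷ ⌜ Δ ⌝ᶜ ∷ []) (Der-PERM p ∷ [])
  Der-PERM (swap {Γ} {Δ} A B p) = der (con (# 2)) (⌜ A ⌝ ∷ ⌜ B ⌝ ∷ ⌜ Γ ⌝ᶜ ∷ ⌜ Δ ⌝ᶜ ∷ []) (Der-PERM p ∷ [])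
  Der-PERM (trans {Γ} {Δ} {Θ} p q) = der (con (# 3)) (⌜ Γ ⌝ᶜ ∷ ⌜ Δ ⌝ᶜ ∷ ⌜ Θ ⌝ᶜ ∷ []) (Der-PERM p ∷ Der-PERM q ∷ [])

  Der-APP : ∀ Γ Δ → Der Π (APP ⌜ Γ ⌝ᶜ ⌜ Δ ⌝ᶜ ⌜ Γ ++ Δ ⌝ᶜ)
  Der-APP [] Δ = der (con (# 4)) (⌜ Δ ⌝ᶜ ∷ []) []
  Der-APP (A ∷ Γ) Δ = der (con (# 5)) (⌜ A ⌝ ∷ ⌜ Γ ⌝ᶜ ∷ ⌜ Δ ⌝ᶜ ∷ ⌜ Γ ++ Δ ⌝ᶜ ∷ []) (Der-APP Γ Δ ∷ [])

  Der-BANG : ∀ Γ → Der Π (BANG ⌜ map !_ Γ ⌝ᶜ)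
  Der-BANG [] = der (con (# 6)) [] []
  Der-BANG (A ∷ Γ) = der (con (# 7)) (⌜ A ⌝ ∷ ⌜ map !_ Γ ⌝ᶜ ∷ []) (Der-BANG Γ ∷ [])

  Der-INSTT : ∀ n y (u : Tm (suc n)) → Der Π (INSTT (num n) (num y) ⌜ u ⌝ᵗ ⌜ substT (instσ n y) u ⌝ᵗ)
  Der-INSTT n y (fv x) = der (ins (# 0)) (num n ∷ num y ∷ num x ∷ []) []
  Der-INSTT n y (bv i) with m≤n⇒m<n∨m≡n (≤-pred (toℕ<n i))
  ... | inj₁ lt rewrite instσ-< n y i lt = der (ins (# 1)) (num n ∷ num y ∷ num (toℕ i) ∷ []) (Der-LT lt ∷ [])
  ... | inj₂ eq rewrite instσ-≡ n y i eq | eq = der (ins (# 2)) (num n ∷ num y ∷ []) []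

  Der-INSTL : ∀ n y (us : List (Tm (suc n))) → Der Π (INSTL (num n) (num y) ⌜ us ⌝ˡ ⌜ map (substT (instσ n y)) us ⌝ˡ)
  Der-INSTL n y [] = der (ins (# 3)) (num n ∷ num y ∷ []) []
  Der-INSTL n y (u ∷ us) = der (ins (# 4))
    (num n ∷ num y ∷ ⌜ u ⌝ᵗ ∷ ⌜ us ⌝ˡ ∷ ⌜ substT (instσ n y) u ⌝ᵗ ∷ ⌜ map (substT (instσ n y)) us ⌝ˡ ∷ [])
    (Der-INSTT n y u ∷ Der-INSTL n y us ∷ [])

  Der-INST : ∀ n y (A : Fm (suc n)) → Der Π (INST (num n) (num y) ⌜ A ⌝ ⌜ substF (instσ n y) A ⌝)
  Der-INST n y (atom p us) = der (ins (# 5))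
    (num n ∷ num y ∷ num p ∷ ⌜ us ⌝ˡ ∷ ⌜ map (substT (instσ n y)) us ⌝ˡ ∷ []) (Der-INSTL n y us ∷ [])
  Der-INST n y (A ⊗ B) = der (ins (# 6))
    (num n ∷ num y ∷ ⌜ A ⌝ ∷ ⌜ B ⌝ ∷ ⌜ substF (instσ n y) A ⌝ ∷ ⌜ substF (instσ n y) B ⌝ ∷ [])
    (Der-INST n y A ∷ Der-INST n y B ∷ [])
  Der-INST n y (A ⊸ B) = der (ins (# 7))
    (num n ∷ num y ∷ ⌜ A ⌝ ∷ ⌜ B ⌝ ∷ ⌜ substF (instσ n y) A ⌝ ∷ ⌜ substF (instσ n y) B ⌝ ∷ [])
    (Der-INST n y A ∷ Der-INST n y B ∷ [])
  Der-INST n y (A & B) = der (ins (# 8))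
    (num n ∷ num y ∷ ⌜ A ⌝ ∷ ⌜ B ⌝ ∷ ⌜ substF (instσ n y) A ⌝ ∷ ⌜ substF (instσ n y) B ⌝ ∷ [])
    (Der-INST n y A ∷ Der-INST n y B ∷ [])
  Der-INST n y (A ⊕ B) = der (ins (# 9))
    (num n ∷ num y ∷ ⌜ A ⌝ ∷ ⌜ B ⌝ ∷ ⌜ substF (instσ n y) A ⌝ ∷ ⌜ substF (instσ n y) B ⌝ ∷ [])
    (Der-INST n y A ∷ Der-INST n y B ∷ [])
  Der-INST n y (! A) = der (ins (# 10)) (num n ∷ num y ∷ ⌜ A ⌝ ∷ ⌜ substF (instσ n y) A ⌝ ∷ []) (Der-INST n y A ∷ [])
  Der-INST n y 𝟘 = der (ins (# 11)) (num n ∷ num y ∷ []) []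
  Der-INST n y 𝟙 = der (ins (# 12)) (num n ∷ num y ∷ []) []
  Der-INST n y ⊤ = der (ins (# 13)) (num n ∷ num y ∷ []) []
  Der-INST n y (∀' A) = der (ins (# 14))
    (num n ∷ num y ∷ ⌜ A ⌝ ∷ ⌜ substF (instσ (suc n) y) A ⌝ ∷ []) (Der-INST (suc n) y A ∷ [])
  Der-INST n y (∃' A) = der (ins (# 15))
    (num n ∷ num y ∷ ⌜ A ⌝ ∷ ⌜ substF (instσ (suc n) y) A ⌝ ∷ []) (Der-INST (suc n) y A ∷ [])

  Der-FRESHT : ∀ {n} y (u : Tm n) → y ∉ fvT u → Der Π (FRESHT (num n) (num y) ⌜ u ⌝ᵗ)
  Der-FRESHT {n} y (fv x) y∉ = der (fre (# 0)) (num n ∷ num y ∷ num x ∷ []) (Der-NEQ (y∉ ∘ here) ∷ [])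
  Der-FRESHT {n} y (bv i) y∉ = der (fre (# 1)) (num n ∷ num y ∷ num (toℕ i) ∷ []) (Der-LT (toℕ<n i) ∷ [])

  Der-FRESHL : ∀ {n} y (us : List (Tm n)) → y ∉ concatMap fvT us → Der Π (FRESHL (num n) (num y) ⌜ us ⌝ˡ)
  Der-FRESHL {n} y [] y∉ = der (fre (# 2)) (num n ∷ num y ∷ []) []
  Der-FRESHL {n} y (u ∷ us) y∉ = der (fre (# 3)) (num n ∷ num y ∷ ⌜ u ⌝ᵗ ∷ ⌜ us ⌝ˡ ∷ [])
    (Der-FRESHT y u (y∉ ∘ ∈-++⁺ˡ) ∷ Der-FRESHL y us (y∉ ∘ ∈-++⁺ʳ (fvT u)) ∷ [])

  Der-FRESH : ∀ {n} y (A : Fm n) → y ∉ FV A → Der Π (FRESH (num n) (num y) ⌜ A ⌝)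
  Der-FRESH {n} y (atom p us) y∉ = der (fre (# 4)) (num n ∷ num y ∷ num p ∷ ⌜ us ⌝ˡ ∷ num (suc p) ∷ [])
    (Der-LT (n<1+n p) ∷ Der-FRESHL y us y∉ ∷ [])
  Der-FRESH {n} y (A ⊗ B) y∉ = der (fre (# 5)) (num n ∷ num y ∷ ⌜ A ⌝ ∷ ⌜ B ⌝ ∷ [])
    (Der-FRESH y A (y∉ ∘ ∈-++⁺ˡ) ∷ Der-FRESH y B (y∉ ∘ ∈-++⁺ʳ (FV A)) ∷ [])
  Der-FRESH {n} y (A ⊸ B) y∉ = der (fre (# 6)) (num n ∷ num y ∷ ⌜ A ⌝ ∷ ⌜ B ⌝ ∷ [])
    (Der-FRESH y A (y∉ ∘ ∈-++⁺ˡ) ∷ Der-FRESH y B (y∉ ∘ ∈-++⁺ʳ (FV A)) ∷ [])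
  Der-FRESH {n} y (A & B) y∉ = der (fre (# 7)) (num n ∷ num y ∷ ⌜ A ⌝ ∷ ⌜ B ⌝ ∷ [])
    (Der-FRESH y A (y∉ ∘ ∈-++⁺ˡ) ∷ Der-FRESH y B (y∉ ∘ ∈-++⁺ʳ (FV A)) ∷ [])
  Der-FRESH {n} y (A ⊕ B) y∉ = der (fre (# 8)) (num n ∷ num y ∷ ⌜ A ⌝ ∷ ⌜ B ⌝ ∷ [])
    (Der-FRESH y A (y∉ ∘ ∈-++⁺ˡ) ∷ Der-FRESH y B (y∉ ∘ ∈-++⁺ʳ (FV A)) ∷ [])
  Der-FRESH {n} y (! A) y∉ = der (fre (# 9)) (num n ∷ num y ∷ ⌜ A ⌝ ∷ []) (Der-FRESH y A y∉ ∷ [])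
  Der-FRESH {n} y 𝟘 y∉ = der (fre (# 10)) (num n ∷ num y ∷ []) []
  Der-FRESH {n} y 𝟙 y∉ = der (fre (# 11)) (num n ∷ num y ∷ []) []
  Der-FRESH {n} y ⊤ y∉ = der (fre (# 12)) (num n ∷ num y ∷ []) []
  Der-FRESH {n} y (∀' A) y∉ = der (fre (# 13)) (num n ∷ num y ∷ ⌜ A ⌝ ∷ []) (Der-FRESH y A y∉ ∷ [])
  Der-FRESH {n} y (∃' A) y∉ = der (fre (# 14)) (num n ∷ num y ∷ ⌜ A ⌝ ∷ []) (Der-FRESH y A y∉ ∷ [])

  Der-FRESHC : ∀ y Γ → y ∉ FVs Γ → Der Π (FRESHC (num y) ⌜ Γ ⌝ᶜ)
  Der-FRESHC y [] y∉ = der (fre (# 15)) (num y ∷ []) []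
  Der-FRESHC y (A ∷ Γ) y∉ = der (fre (# 16)) (num y ∷ ⌜ A ⌝ ∷ ⌜ Γ ⌝ᶜ ∷ [])
    (Der-FRESH y A (y∉ ∘ ∈-++⁺ˡ) ∷ Der-FRESHC y Γ (y∉ ∘ ∈-++⁺ʳ (FV A)) ∷ [])

  fresh-for : ∀ xs → suc (max 0 xs) ∉ xs
  fresh-for xs m = <⇒≱ (n<1+n (max 0 xs)) (All.lookup (xs≤max 0 xs) m)

  Der-SEQ : ∀ {Γ C} → Γ ⊢ C → Der Π (SEQ ⌜ Γ ⌝ᶜ ⌜ C ⌝)
  Der-SEQ (ax {A}) = der (seq (# 0)) (⌜ A ⌝ ∷ []) []
  Der-SEQ (exch {Γ} {Δ} {C} p d) = der (seq (# 1)) (⌜ Γ ⌝ᶜ ∷ ⌜ Δ ⌝ᶜ ∷ ⌜ C ⌝ ∷ []) (Der-PERM p ∷ Der-SEQ d ∷ [])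
  Der-SEQ (cut {Γ} {Δ} {A} {C} d e) = der (seq (# 2))
    (⌜ Γ ⌝ᶜ ∷ ⌜ Δ ⌝ᶜ ∷ ⌜ Γ ++ Δ ⌝ᶜ ∷ ⌜ A ⌝ ∷ ⌜ C ⌝ ∷ num y ∷ num (suc y) ∷ [])
    (Der-FRESH y A (fresh-for (FV A)) ∷ Der-LT (n<1+n y) ∷ Der-APP Γ Δ ∷ Der-SEQ d ∷ Der-SEQ e ∷ [])
    where y = suc (max 0 (FV A))
  Der-SEQ (⊗L {Γ} {A} {B} {C} d) = der (seq (# 3)) (⌜ A ⌝ ∷ ⌜ B ⌝ ∷ ⌜ Γ ⌝ᶜ ∷ ⌜ C ⌝ ∷ []) (Der-SEQ d ∷ [])
  Der-SEQ (⊗R {Γ} {Δ} {A} {B} d e) = der (seq (# 4)) (⌜ Γ ⌝ᶜ ∷ ⌜ Δ ⌝ᶜ ∷ ⌜ Γ ++ Δ ⌝ᶜ ∷ ⌜ A ⌝ ∷ ⌜ B ⌝ ∷ [])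
    (Der-APP Γ Δ ∷ Der-SEQ d ∷ Der-SEQ e ∷ [])
  Der-SEQ (⊸L {Γ} {Δ} {A} {B} {C} d e) = der (seq (# 5))
    (⌜ Γ ⌝ᶜ ∷ ⌜ Δ ⌝ᶜ ∷ ⌜ Γ ++ Δ ⌝ᶜ ∷ ⌜ A ⌝ ∷ ⌜ B ⌝ ∷ ⌜ C ⌝ ∷ []) (Der-APP Γ Δ ∷ Der-SEQ d ∷ Der-SEQ e ∷ [])
  Der-SEQ (⊸R {Γ} {A} {B} d) = der (seq (# 6)) (⌜ Γ ⌝ᶜ ∷ ⌜ A ⌝ ∷ ⌜ B ⌝ ∷ []) (Der-SEQ d ∷ [])
  Der-SEQ (&L₁ {Γ} {A} {B} {C} d) = der (seq (# 7)) (⌜ A ⌝ ∷ ⌜ B ⌝ ∷ ⌜ Γ ⌝ᶜ ∷ ⌜ C ⌝ ∷ []) (Der-SEQ d ∷ [])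
  Der-SEQ (&L₂ {Γ} {A} {B} {C} d) = der (seq (# 8)) (⌜ A ⌝ ∷ ⌜ B ⌝ ∷ ⌜ Γ ⌝ᶜ ∷ ⌜ C ⌝ ∷ []) (Der-SEQ d ∷ [])
  Der-SEQ (&R {Γ} {A} {B} d e) = der (seq (# 9)) (⌜ Γ ⌝ᶜ ∷ ⌜ A ⌝ ∷ ⌜ B ⌝ ∷ []) (Der-SEQ d ∷ Der-SEQ e ∷ [])
  Der-SEQ (⊕L {Γ} {A} {B} {C} d e) = der (seq (# 10)) (⌜ A ⌝ ∷ ⌜ B ⌝ ∷ ⌜ Γ ⌝ᶜ ∷ ⌜ C ⌝ ∷ [])
    (Der-SEQ d ∷ Der-SEQ e ∷ [])
  Der-SEQ (⊕R₁ {Γ} {A} {B} d) = der (seq (# 11)) (⌜ Γ ⌝ᶜ ∷ ⌜ A ⌝ ∷ ⌜ B ⌝ ∷ []) (Der-SEQ d ∷ [])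
  Der-SEQ (⊕R₂ {Γ} {A} {B} d) = der (seq (# 12)) (⌜ Γ ⌝ᶜ ∷ ⌜ A ⌝ ∷ ⌜ B ⌝ ∷ []) (Der-SEQ d ∷ [])
  Der-SEQ (𝟘L {Γ} {C}) = der (seq (# 13)) (⌜ Γ ⌝ᶜ ∷ ⌜ C ⌝ ∷ []) []
  Der-SEQ (𝟙L {Γ} {C} d) = der (seq (# 14)) (⌜ Γ ⌝ᶜ ∷ ⌜ C ⌝ ∷ []) (Der-SEQ d ∷ [])
  Der-SEQ 𝟙R = der (seq (# 15)) [] []
  Der-SEQ (⊤R {Γ}) = der (seq (# 16)) (⌜ Γ ⌝ᶜ ∷ []) []
  Der-SEQ (!L {Γ} {A} {C} d) = der (seq (# 17)) (⌜ A ⌝ ∷ ⌜ Γ ⌝ᶜ ∷ ⌜ C ⌝ ∷ []) (Der-SEQ d ∷ [])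
  Der-SEQ (!W {Γ} {A} {C} d) = der (seq (# 18)) (⌜ A ⌝ ∷ ⌜ Γ ⌝ᶜ ∷ ⌜ C ⌝ ∷ []) (Der-SEQ d ∷ [])
  Der-SEQ (!C {Γ} {A} {C} d) = der (seq (# 19)) (⌜ A ⌝ ∷ ⌜ Γ ⌝ᶜ ∷ ⌜ C ⌝ ∷ []) (Der-SEQ d ∷ [])
  Der-SEQ (!R {Γ} {A} d) = der (seq (# 20)) (⌜ map !_ Γ ⌝ᶜ ∷ ⌜ A ⌝ ∷ []) (Der-BANG Γ ∷ Der-SEQ d ∷ [])
  Der-SEQ (∀L {Γ} {A} {C} y d) = der (seq (# 21))
    (⌜ A ⌝ ∷ ⌜ Γ ⌝ᶜ ∷ ⌜ C ⌝ ∷ num y ∷ num (suc y) ∷ ⌜ inst A y ⌝ ∷ [])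
    (Der-LT (n<1+n y) ∷ Der-INST 0 y A ∷ Der-SEQ d ∷ [])
  Der-SEQ (∀R {Γ} {A} y p q d) = der (seq (# 22)) (⌜ Γ ⌝ᶜ ∷ ⌜ A ⌝ ∷ num y ∷ num (suc y) ∷ ⌜ inst A y ⌝ ∷ [])
    (Der-LT (n<1+n y) ∷ Der-FRESHC y Γ p ∷ Der-FRESH y A q ∷ Der-INST 0 y A ∷ Der-SEQ d ∷ [])
  Der-SEQ (∃L {Γ} {A} {C} y p q r d) = der (seq (# 23))
    (⌜ A ⌝ ∷ ⌜ Γ ⌝ᶜ ∷ ⌜ C ⌝ ∷ num y ∷ num (suc y) ∷ ⌜ inst A y ⌝ ∷ [])
    (Der-LT (n<1+n y) ∷ Der-FRESHC y Γ p ∷ Der-FRESH y A q ∷ Der-FRESH y C r ∷ Der-INST 0 y A ∷ Der-SEQ d ∷ [])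
  Der-SEQ (∃R {Γ} {A} y d) = der (seq (# 24)) (⌜ Γ ⌝ᶜ ∷ ⌜ A ⌝ ∷ num y ∷ num (suc y) ∷ ⌜ inst A y ⌝ ∷ [])
    (Der-LT (n<1+n y) ∷ Der-INST 0 y A ∷ Der-SEQ d ∷ [])

-- Substituted formulas as patterns

renTP : ∀ {m n} → (Var → Pat n) → Tm m → Pat n
renTP h (fv x) = fvP (h x)
renTP h (bv i) = bvP (numP (toℕ i))

renLP : ∀ {m n} → (Var → Pat n) → List (Tm m) → Pat n
renLP h [] = leaf
renLP h (t ∷ ts) = node (renTP h t) (renLP h ts)

-- Free variables go to patterns, in particular to variables of a clause, so that a single clause
-- covers all instances of a grammar rule, whatever nodes it is applied to.
renP : ∀ {m n} → (Var → Pat n) → Fm m → Pat n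
renP h (atom p ts) = bin 0 (numP p) (renLP h ts)
renP h (A ⊗ B) = bin 1 (renP h A) (renP h B)
renP h (A ⊸ B) = bin 2 (renP h A) (renP h B)
renP h (A & B) = bin 3 (renP h A) (renP h B)
renP h (A ⊕ B) = bin 4 (renP h A) (renP h B)
renP h (! A) = un 5 (renP h A)
renP h 𝟘 = un 6 leaf
renP h 𝟙 = un 7 leaf
renP h ⊤ = un 8 leaf
renP h (∀' A) = un 9 (renP h A)
renP h (∃' A) = un 10 (renP h A)

numP-eval : ∀ {n} k (ρ : Vec Tree n) → numP k ⟦ ρ ⟧ ≡ num k
numP-eval zero ρ = refl
numP-eval (suc k) ρ = cong (node leaf) (numP-eval k ρ)

module _ {n} (h : Var → Pat n) (h′ : Var → Var) (ρ : Vec Tree n) (eq : ∀ x → h x ⟦ ρ ⟧ ≡ num (h′ x)) where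

  renTP-eval : ∀ {m} (t : Tm m) → renTP h t ⟦ ρ ⟧ ≡ ⌜ renT h′ t ⌝ᵗ
  renTP-eval (fv x) = cong (node leaf) (eq x)
  renTP-eval (bv i) = cong (node (node leaf leaf)) (numP-eval (toℕ i) ρ)

  renLP-eval : ∀ {m} (ts : List (Tm m)) → renLP h ts ⟦ ρ ⟧ ≡ ⌜ map (renT h′) ts ⌝ˡ
  renLP-eval [] = refl
  renLP-eval (t ∷ ts) = cong₂ node (renTP-eval t) (renLP-eval ts)

  renP-eval : ∀ {m} (A : Fm m) → renP h A ⟦ ρ ⟧ ≡ ⌜ ren h′ A ⌝
  renP-eval (atom p ts) = node-cong 0 (numP-eval p ρ) (renLP-eval ts)
  renP-eval (A ⊗ B) = node-cong 1 (renP-eval A) (renP-eval B)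
  renP-eval (A ⊸ B) = node-cong 2 (renP-eval A) (renP-eval B)
  renP-eval (A & B) = node-cong 3 (renP-eval A) (renP-eval B)
  renP-eval (A ⊕ B) = node-cong 4 (renP-eval A) (renP-eval B)
  renP-eval (! A) = cong (node (num 5)) (renP-eval A)
  renP-eval 𝟘 = refl
  renP-eval 𝟙 = refl
  renP-eval ⊤ = refl
  renP-eval (∀' A) = cong (node (num 9)) (renP-eval A)
  renP-eval (∃' A) = cong (node (num 10)) (renP-eval A)

selSubP : ∀ {n} (l : List Var) → (Fin (length l) → Pat n) → Var → Pat n
selSubP [] h x = numP x
selSubP (σ ∷ l) h x with x ≟ σ
... | yes _ = h zero
... | no _ = selSubP l (h ∘ suc) x

selSubP-eval : ∀ {n} l (h : Fin (length l) → Pat n) h′ ρ → (∀ i → h i ⟦ ρ ⟧ ≡ num (h′ i)) →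
  ∀ x → selSubP l h x ⟦ ρ ⟧ ≡ num (selSub l h′ x)
selSubP-eval [] h h′ ρ eq x = numP-eval x ρ
selSubP-eval (σ ∷ l) h h′ ρ eq x with x ≟ σ
... | yes _ = eq zero
... | no _ = selSubP-eval l (h ∘ suc) (h′ ∘ suc) ρ (eq ∘ suc) x

pointSubP : ∀ {n} → Var → Pat n → Var → Pat n
pointSubP x• p x with x ≟ x•
... | yes _ = p
... | no _ = numP x

pointSubP-eval : ∀ {n} x• (p : Pat n) k ρ → p ⟦ ρ ⟧ ≡ num k → ∀ x → pointSubP x• p x ⟦ ρ ⟧ ≡ num (pointSub x• k x)
pointSubP-eval x• p k ρ eq x with x ≟ x•
... | yes _ = eq
... | no _ = numP-eval x ρ

treeList : List Tree → Tree
treeList [] = leaf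
treeList (t ∷ ts) = node t (treeList ts)

listP : ∀ {n} k → (Fin k → Pat n) → Pat n
listP zero f = leaf
listP (suc k) f = node (f zero) (listP k (f ∘ suc))

listP-eval : ∀ {n} k (f : Fin k → Pat n) (g : Fin k → Tree) ρ → (∀ i → f i ⟦ ρ ⟧ ≡ g i) →
  listP k f ⟦ ρ ⟧ ≡ treeList (tabulate g)
listP-eval zero f g ρ eq = refl
listP-eval (suc k) f g ρ eq = cong₂ node (eq zero) (listP-eval k (f ∘ suc) (g ∘ suc) ρ (eq ∘ suc))

numTree : ∀ {N} → Fin N → Tree
numTree = num ∘ toℕ

untab : ∀ {N n} k (xs : List (Fin N)) (f : Fin k → Pat n) ρ → treeList (map numTree xs) ≡ listP k f ⟦ ρ ⟧ →
  Σ[ a ∈ (Fin k → Fin N) ] xs ≡ tabulate a × (∀ i → f i ⟦ ρ ⟧ ≡ num (toℕ (a i)))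
untab zero [] f ρ eq = (λ ()) , refl , λ ()
untab (suc k) (x ∷ xs) f ρ eq with untab k xs (f ∘ suc) ρ (node-injʳ eq)
... | a , refl , eqs = (λ { zero → x ; (suc i) → a i }) , refl ,
  λ { zero → sym (node-injˡ eq) ; (suc i) → eqs i }

-- A Horn program for membership in the language of a grammar

pattern ADD m n k            = 13 , m ∷ n ∷ k ∷ []
pattern TRI m n              = 14 , m ∷ n ∷ []
pattern CONS a b c           = 15 , a ∷ b ∷ c ∷ []
pattern LIST v n t           = 16 , v ∷ n ∷ t ∷ []
pattern NODES v k g c        = 17 , v ∷ k ∷ g ∷ c ∷ []
pattern EDGES v n ls as g c  = 18 , v ∷ n ∷ ls ∷ as ∷ g ∷ c ∷ []
pattern TOP n                = 19 , n ∷ []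

v7 : ∀ {n} → Pat (8 + n)
v7 = var (suc (suc (suc (suc (suc (suc (suc zero)))))))
v8 : ∀ {n} → Pat (9 + n)
v8 = var (suc (suc (suc (suc (suc (suc (suc (suc zero))))))))
v9 : ∀ {n} → Pat (10 + n)
v9 = var (suc (suc (suc (suc (suc (suc (suc (suc (suc zero)))))))))

10+ 9+ : ∀ {n} → Fin n → Pat _
9+ i = var (suc (suc (suc (suc (suc (suc (suc (suc (suc i)))))))))
10+ i = var (suc (suc (suc (suc (suc (suc (suc (suc (suc (suc i))))))))))

module GrammarRE {x• : Var} {T : Alphabet} {X : List Var} (G : Grammar x• T X) where

  Edge : ℕ → Set
  Edge N = Σ[ c ∈ Fin (size T) ] (Fin (length (type T c)) → Fin N)

  edgeFm : ∀ {N} → Edge N → Fm 0 → Fm 0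
  edgeFm (c , a) A = ren (selSub (type T c) (toℕ ∘ a)) A

  nodeFm : ℕ → Fm 0 → Fm 0
  nodeFm k B = ren (pointSub x• k) B

  attCode : ∀ {N} → Edge N → ℕ
  attCode (c , a) = encList (tabulate (toℕ ∘ a))

  -- A loop invariant: `Γ` holds the formulas chosen so far, node `K` is the next one and `N` nodes
  -- remain. `EdgesProvable` is its analogue for the phase that treats the hyperedges, in which all
  -- nodes are still to come.
  NodesProvable : ℕ → ℕ → Ctx → Fm 0 → Set
  NodesProvable N K Γ C = Σ[ hV ∈ (Fin N → Fm 0) ] (∀ i → (nothing , hV i) ∈ rules G) ×
    (tabulate (λ i → nodeFm (K + toℕ i) (hV i)) ++ Γ ⊢ C)

  EdgesProvable : (N n : ℕ) → (Fin n → Edge N) → Ctx → Fm 0 → Set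
  EdgesProvable N n ed Γ C = Σ[ hV ∈ (Fin N → Fm 0) ] Σ[ hE ∈ (Fin n → Fm 0) ]
    (∀ v → (nothing , hV v) ∈ rules G) × (∀ e → (just (proj₁ (ed e)) , hE e) ∈ rules G) ×
    ((tabulate (λ e → edgeFm (ed e) (hE e)) ++ tabulate (λ v → nodeFm (toℕ v) (hV v))) ++ Γ ⊢ C)

  J : Fact → Set
  J (ADD m n k) = Σ[ i ∈ ℕ ] Σ[ j ∈ ℕ ] num i ≡ m × num j ≡ n × num (i + j) ≡ k
  J (TRI m n) = Σ[ i ∈ ℕ ] num i ≡ m × num (tri i) ≡ n
  J (CONS a b c) = Σ[ i ∈ ℕ ] Σ[ j ∈ ℕ ] num i ≡ a × num j ≡ b × num (consℕ i j) ≡ c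
  J (LIST v n t) = ∀ N → num N ≡ v →
    Σ[ xs ∈ List (Fin N) ] num (encList (map toℕ xs)) ≡ n × treeList (map numTree xs) ≡ t
  J (NODES v k g c) = ∀ K Γ C → num K ≡ k → ⌜ Γ ⌝ᶜ ≡ g → ⌜ C ⌝ ≡ c →
    Σ[ N ∈ ℕ ] num N ≡ v × NodesProvable N K Γ C
  J (EDGES v n ls as g c) = ∀ N Γ C → num N ≡ v → ⌜ Γ ⌝ᶜ ≡ g → ⌜ C ⌝ ≡ c → Σ[ k ∈ ℕ ] Σ[ ed ∈ (Fin k → Edge N) ]
    num k ≡ n × num (encList (tabulate (toℕ ∘ proj₁ ∘ ed))) ≡ ls ×
    num (encList (tabulate (attCode ∘ ed))) ≡ as × EdgesProvable N k ed Γ C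
  J (TOP n) = Σ[ H ∈ HG T X ] num (encode H) ≡ n × InL G H
  J _ = ⊥

  arithmeticClauses : List Clause
  arithmeticClauses
    -- Starting from `0 + 0` and counting up both summands, instead of starting from `0 + n`,
    -- ensures that all three arguments of a derivable fact are numerals.
    = clause 0 (ADD leaf leaf leaf) []
    ∷ clause 3 (ADD (sucP v0) v1 (sucP v2)) (ADD v0 v1 v2 ∷ [])
    ∷ clause 3 (ADD v0 (sucP v1) (sucP v2)) (ADD v0 v1 v2 ∷ [])
    ∷ clause 0 (TRI leaf leaf) []
    ∷ clause 3 (TRI (sucP v0) (sucP v2)) (TRI v0 v1 ∷ ADD v0 v1 v2 ∷ [])
    ∷ clause 5 (CONS v0 v1 (sucP v4)) (ADD v0 v1 v2 ∷ TRI v2 v3 ∷ ADD v3 v1 v4 ∷ [])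
    ∷ clause 1 (LIST v0 leaf leaf) []
    ∷ clause 5 (LIST v0 v1 (node v2 v4)) (LT v2 v0 ∷ CONS v2 v3 v1 ∷ LIST v0 v3 v4 ∷ [])
    ∷ []

  arithmeticModel : Model arithmeticClauses (J ⊨_)
  arithmeticModel
    = (λ { [] [] → 0 , 0 , refl , refl , refl })
    ∷ (λ { (_ ∷ _ ∷ _ ∷ []) ((i , j , refl , refl , refl) ∷ []) → suc i , j , refl , refl , refl })
    ∷ (λ { (_ ∷ _ ∷ _ ∷ []) ((i , j , refl , refl , refl) ∷ []) → i , suc j , refl , refl , cong num (+-suc i j) })
    ∷ (λ { [] [] → 0 , refl , refl })
    ∷ (λ { (_ ∷ _ ∷ _ ∷ []) ((i , eq₁ , refl) ∷ (i′ , j , eq₂ , eq₃ , refl) ∷ []) →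
           suc i , cong (node leaf) eq₁ ,
           cong (node leaf) (cong num (cong₂ _+_ (num-inj (≡.trans eq₁ (sym eq₂))) (num-inj (sym eq₃)))) })
    ∷ (λ { (_ ∷ _ ∷ _ ∷ _ ∷ _ ∷ [])
           ((i , j , refl , refl , refl) ∷ (s , eq₁ , refl) ∷ (t , j′ , eq₂ , eq₃ , refl) ∷ []) →
           i , j , refl , refl , cong (node leaf) (cong num (cong₂ _+_
             (≡.trans (cong tri (sym (num-inj {s} eq₁))) (num-inj (sym eq₂))) (num-inj (sym eq₃)))) })
    ∷ (λ { (_ ∷ []) [] N refl → [] , refl , refl })
    ∷ (λ { (_ ∷ _ ∷ _ ∷ _ ∷ _ ∷ []) ((a , _ , refl , eq , lt) ∷ (a′ , b , eq₂ , refl , refl) ∷ h ∷ []) N refl →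
           let xs , eq₃ , eq₄ = h N refl
               lt′ = subst (a <_) (num-inj eq) lt
               fa = toℕ-fromℕ< lt′ in
           Fin.fromℕ< lt′ ∷ xs ,
           cong num (cong₂ consℕ (≡.trans fa (num-inj (sym eq₂))) (num-inj eq₃)) ,
           cong₂ node (cong num fa) eq₄ })
    ∷ []

  -- A grammar rule becomes a clause that applies it to the next node or hyperedge and adds the
  -- resulting formula to the context. In the clause for a hyperedge the variables from the tenth on
  -- are its attachment nodes; `LIST` checks that they are below the number `v0` of nodes and that
  -- `v7` is the code of their list.
  ruleClause : Maybe (Fin (size T)) × Fm 0 → Clause
  ruleClause (nothing , B) =
    clause 4 (NODES (sucP v0) v1 v2 v3) (NODES v0 (sucP v1) (node (renP (pointSubP x• v1) B) v2) v3 ∷ [])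
  ruleClause (just c , A) = clause (9 + k)
    (EDGES v0 (sucP v1) v2 v3 v4 v5)
    ( CONS (numP (toℕ c)) v6 v2 ∷ CONS v7 v8 v3 ∷ LIST v0 v7 (listP k 9+)
    ∷ EDGES v0 v1 v6 v8 (node (renP (selSubP (type T c) 9+) A) v4) v5 ∷ [])
    where k = length (type T c)

  finalClauses : List Clause
  finalClauses
    = clause 3 (NODES leaf v0 v1 v2) (SEQ v1 v2 ∷ [])
    -- With no hyperedge left both lists have code 0, and the nodes follow, numbered from 0.
    ∷ clause 3 (EDGES v0 leaf leaf leaf v1 v2) (NODES v0 leaf v1 v2 ∷ [])
    ∷ clause (10 + length X) (TOP v0)
        ( CONS v1 v2 v0 ∷ CONS v3 v4 v2 ∷ CONS v5 v6 v4 ∷ CONS v7 v8 v6 ∷ CONS v9 leaf v8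
        ∷ LIST v1 v9 (listP (length X) 10+)
        ∷ EDGES v1 v3 v5 v7 leaf (renP (selSubP X 10+) (start G)) ∷ [])
    ∷ []

  clauses : List Clause
  clauses = logicClauses ++ arithmeticClauses ++ finalClauses ++ map ruleClause (rules G)

  ruleModel : ∀ {r} → r ∈ rules G → (ρ : Vec Tree (arity (ruleClause r))) →
    All (λ a → J ⊨ (a ⟦ ρ ⟧ₐ)) (body (ruleClause r)) → J ⊨ (head (ruleClause r) ⟦ ρ ⟧ₐ)
  ruleModel {nothing , B} r∈ (_ ∷ _ ∷ _ ∷ _ ∷ []) (h ∷ []) K Γ C refl refl refl
    with h (suc K) (nodeFm K B ∷ Γ) C refl
           (cong (λ b → node b ⌜ Γ ⌝ᶜ) (sym (renP-eval _ _ _ (pointSubP-eval x• v1 K _ refl) B))) refl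
  ... | N , refl , hV , ok , d = suc N , refl , (λ { zero → B ; (suc i) → hV i }) , (λ { zero → r∈ ; (suc i) → ok i }) ,
    exch (↭-trans (shift (nodeFm K B) (tabulate (λ i → nodeFm (suc K + toℕ i) (hV i))) Γ)
      (↭-reflexive (cong₂ (λ k Δ → nodeFm k B ∷ Δ ++ Γ) (sym (+-identityʳ K))
        (tabulate-cong (λ i → cong (λ k → nodeFm k (hV i)) (sym (+-suc K (toℕ i)))))))) d
  ruleModel {just c , A} r∈ (_ ∷ _ ∷ _ ∷ _ ∷ _ ∷ _ ∷ _ ∷ _ ∷ _ ∷ ρ)
    ((i , j , eq₁ , refl , refl) ∷ (i′ , j′ , refl , refl , refl) ∷ l ∷ h ∷ []) N Γ C refl refl refl
    with l N refl
  ... | xs , eq₂ , eq₃ with untab (length (type T c)) xs (var {length (type T c)}) ρ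
        (≡.trans eq₃ (≡.trans (listP-eval _ _ (Vec.lookup ρ) _ (λ _ → refl)) (sym (listP-eval _ _ (Vec.lookup ρ) ρ (λ _ → refl)))))
  ... | a , refl , att≡ with h N (edgeFm (c , a) A ∷ Γ) C refl
         (cong (λ b → node b ⌜ Γ ⌝ᶜ) (sym (renP-eval _ _ _ (selSubP-eval (type T c) 9+ (toℕ ∘ a) _ att≡) A))) refl
  ... | n , ed , refl , ls≡ , as≡ , hV , hE , okV , okE , d =
    suc n , ed′ , refl ,
    cong num (cong₂ consℕ (num-inj (≡.trans (sym (numP-eval (toℕ c) _)) (sym eq₁))) (num-inj ls≡)) ,
    cong num (cong₂ consℕ (num-inj (≡.trans (cong (num ∘ encList) (sym (map-tabulate a toℕ))) eq₂)) (num-inj as≡)) ,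
    hV , hE′ , okV , okE′ ,
    exch (shift (edgeFm (c , a) A) (tabulate (λ e → edgeFm (ed e) (hE e)) ++ tabulate (λ v → nodeFm (toℕ v) (hV v))) Γ) d
    where
    ed′ : Fin (suc n) → Edge N
    ed′ zero = c , a
    ed′ (suc e) = ed e
    hE′ : Fin (suc n) → Fm 0
    hE′ zero = A
    hE′ (suc e) = hE e
    okE′ : ∀ e → (just (proj₁ (ed′ e)) , hE′ e) ∈ rules G
    okE′ zero = r∈
    okE′ (suc e) = okE e

  rulesModel : ∀ rs → (∀ {r} → r ∈ rs → r ∈ rules G) → Model (map ruleClause rs) (J ⊨_)
  rulesModel [] sub = []
  rulesModel (r ∷ rs) sub = ruleModel (sub (here refl)) ∷ rulesModel rs (sub ∘ there)

  finalModel : Model finalClauses (J ⊨_)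
  finalModel
    = (λ { (_ ∷ _ ∷ _ ∷ []) (h ∷ []) K Γ C refl refl refl → 0 , refl , (λ ()) , (λ ()) , h Γ C refl refl })
    ∷ (λ { (_ ∷ _ ∷ _ ∷ []) (h ∷ []) N Γ C refl refl refl → let N′ , eq , p = h 0 Γ C refl refl refl in
           0 , (λ ()) , refl , refl , refl , noEdges (num-inj {N′} {N} eq) p })
    ∷ top
    ∷ []
    where
    noEdges : ∀ {N′ N Γ C} → N′ ≡ N → NodesProvable N′ 0 Γ C → EdgesProvable N 0 (λ ()) Γ C
    noEdges refl (hV , ok , d) = hV , (λ ()) , ok , (λ ()) , d

    top : (ρ : Vec Tree (10 + length X)) → All (λ a → J ⊨ (a ⟦ ρ ⟧ₐ)) _ → J ⊨ TOP (Vec.lookup ρ zero)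
    top (_ ∷ _ ∷ _ ∷ _ ∷ _ ∷ _ ∷ _ ∷ _ ∷ _ ∷ _ ∷ ρ)
      ( (i₁ , j₁ , refl , refl , refl) ∷ (i₂ , j₂ , refl , refl , eq₁) ∷ (i₃ , j₃ , refl , refl , eq₂)
      ∷ (i₄ , j₄ , refl , refl , eq₃) ∷ (i₅ , j₅ , refl , eq₅ , eq₄) ∷ l ∷ h ∷ [])
      with l i₁ refl
    ... | xs , eqx , eqt with untab (length X) xs (var {length X}) ρ
          (≡.trans eqt (≡.trans (listP-eval _ _ (Vec.lookup ρ) _ (λ _ → refl)) (sym (listP-eval _ _ (Vec.lookup ρ) ρ (λ _ → refl)))))
    ... | a , refl , ext≡ with h i₁ [] (ren (selSub X (toℕ ∘ a)) (start G)) refl refl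
          (sym (renP-eval _ _ _ (selSubP-eval X 10+ (toℕ ∘ a) _ ext≡) (start G)))
    ... | k , ed , k≡ , ls≡ , as≡ , hV , hE , okV , okE , d =
      record { nV = i₁ ; nE = k ; lab = proj₁ ∘ ed ; att = proj₂ ∘ ed ; ext = a } ,
      cong num (cong (consℕ i₁) (≡.trans (cong₂ consℕ (num-inj k≡) (≡.trans (cong₂ consℕ (num-inj ls≡)
        (≡.trans (cong₂ consℕ (num-inj as≡) (≡.trans (cong₂ consℕ ex≡ (sym (num-inj {j₅} {0} eq₅))) (num-inj eq₄)))
          (num-inj eq₃))) (num-inj eq₂))) (num-inj eq₁))) ,
      hV , hE , okV , okE , subst (_⊢ _) (++-identityʳ _) d
      where
      ex≡ : encList (tabulate (toℕ ∘ a)) ≡ i₅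
      ex≡ = ≡.trans (cong encList (sym (map-tabulate a toℕ))) (num-inj eqx)

  model : Model clauses (J ⊨_)
  model = AllP.++⁺ logicModel (AllP.++⁺ arithmeticModel (AllP.++⁺ finalModel (rulesModel (rules G) (λ r∈ → r∈))))

  open Complete {clauses} ∈-++⁺ˡ

  ari : ∀ i → List.lookup arithmeticClauses i ∈ clauses
  ari i = ∈-++⁺ʳ logicClauses (∈-++⁺ˡ (∈-lookup {xs = arithmeticClauses} i))

  fin : ∀ i → List.lookup finalClauses i ∈ clauses
  fin i = ∈-++⁺ʳ logicClauses (∈-++⁺ʳ arithmeticClauses (∈-++⁺ˡ (∈-lookup {xs = finalClauses} i)))

  rul : ∀ {r} → r ∈ rules G → ruleClause r ∈ clauses
  rul r∈ = ∈-++⁺ʳ logicClauses (∈-++⁺ʳ arithmeticClauses (∈-++⁺ʳ finalClauses (∈-map⁺ ruleClause r∈)))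

  Der-ADD : ∀ m n → Der clauses (ADD (num m) (num n) (num (m + n)))
  Der-ADD zero zero = der (ari (# 0)) [] []
  Der-ADD zero (suc n) = der (ari (# 2)) (leaf ∷ num n ∷ num n ∷ []) (Der-ADD zero n ∷ [])
  Der-ADD (suc m) n = der (ari (# 1)) (num m ∷ num n ∷ num (m + n) ∷ []) (Der-ADD m n ∷ [])

  Der-TRI : ∀ n → Der clauses (TRI (num n) (num (tri n)))
  Der-TRI zero = der (ari (# 3)) [] []
  Der-TRI (suc n) = der (ari (# 4)) (num n ∷ num (tri n) ∷ num (n + tri n) ∷ []) (Der-TRI n ∷ Der-ADD n (tri n) ∷ [])

  Der-CONS : ∀ a b → Der clauses (CONS (num a) (num b) (num (consℕ a b)))
  Der-CONS a b = der (ari (# 5)) (num a ∷ num b ∷ num (a + b) ∷ num (tri (a + b)) ∷ num (tri (a + b) + b) ∷ [])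
    (Der-ADD a b ∷ Der-TRI (a + b) ∷ Der-ADD (tri (a + b)) b ∷ [])

  Der-LIST : ∀ {N} k (a : Fin k → Fin N) →
    Der clauses (LIST (num N) (num (encList (tabulate (toℕ ∘ a)))) (treeList (tabulate (numTree ∘ a))))
  Der-LIST {N} zero a = der (ari (# 6)) (num N ∷ []) []
  Der-LIST {N} (suc k) a = der (ari (# 7))
    (num N ∷ num (encList (tabulate (toℕ ∘ a))) ∷ numTree (a zero) ∷ num (encList (tabulate (toℕ ∘ a ∘ suc)))
      ∷ treeList (tabulate (numTree ∘ a ∘ suc)) ∷ [])
    (Der-LT (toℕ<n (a zero)) ∷ Der-CONS (toℕ (a zero)) (encList (tabulate (toℕ ∘ a ∘ suc))) ∷ Der-LIST k (a ∘ suc) ∷ [])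

  Der-NODES : ∀ N K Γ C → NodesProvable N K Γ C → Der clauses (NODES (num N) (num K) ⌜ Γ ⌝ᶜ ⌜ C ⌝)
  Der-NODES zero K Γ C (hV , ok , d) = der (fin (# 0)) (num K ∷ ⌜ Γ ⌝ᶜ ∷ ⌜ C ⌝ ∷ []) (Der-SEQ d ∷ [])
  Der-NODES (suc N) K Γ C (hV , ok , d) = der (rul (ok zero)) ρ
    (subst (λ b → Der clauses (NODES (num N) (num (suc K)) (node b ⌜ Γ ⌝ᶜ) ⌜ C ⌝))
      (sym (renP-eval _ _ ρ (pointSubP-eval x• v1 K ρ refl) (hV zero)))
      (Der-NODES N (suc K) (nodeFm K (hV zero) ∷ Γ) C (hV ∘ suc , ok ∘ suc ,
        exch (↭-sym (↭-trans (shift (nodeFm K (hV zero)) (tabulate (λ i → nodeFm (suc K + toℕ i) (hV (suc i)))) Γ)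
      (↭-reflexive (cong₂ (λ k Δ → nodeFm k (hV zero) ∷ Δ ++ Γ) (sym (+-identityʳ K))
        (tabulate-cong (λ i → cong (λ k → nodeFm k (hV (suc i))) (sym (+-suc K (toℕ i))))))))) d)) ∷ [])
    where ρ = num N ∷ num K ∷ ⌜ Γ ⌝ᶜ ∷ ⌜ C ⌝ ∷ []

  edges-step : ∀ {v n ls as ls′ as₀ as′ g s b c A} (ρ : Vec Tree (length (type T c))) → (just c , A) ∈ rules G →
    Der clauses (CONS (num (toℕ c)) ls′ ls) → Der clauses (CONS as₀ as′ as) →
    Der clauses (LIST v as₀ (treeList (tabulate (Vec.lookup ρ)))) →
    (∀ ρ′ → (∀ i → (9+ i ⟦ ρ′ ⟧) ≡ Vec.lookup ρ i) → renP (selSubP (type T c) 9+) A ⟦ ρ′ ⟧ ≡ b) →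
    Der clauses (EDGES v n ls′ as′ (node b g) s) → Der clauses (EDGES v (node leaf n) ls as g s)
  edges-step {v} {n} {ls} {as} {ls′} {as₀} {as′} {g} {s} {b} {c} {A} ρ r∈ d₁ d₂ d₃ eq d₄ = der (rul r∈) ρ′
    ( subst (λ k → Der clauses (CONS k ls′ ls)) (sym (numP-eval (toℕ c) ρ′)) d₁
    ∷ d₂
    ∷ subst (λ t → Der clauses (LIST v as₀ t)) (sym (listP-eval _ 9+ (Vec.lookup ρ) ρ′ λ _ → refl)) d₃
    ∷ subst (λ b → Der clauses (EDGES v n ls′ as′ (node b g) s)) (sym (eq ρ′ λ _ → refl)) d₄
    ∷ [])
    where
    ρ′ : Vec Tree (9 + length (type T c))
    ρ′ = v ∷ n ∷ ls ∷ as ∷ g ∷ s ∷ ls′ ∷ as₀ ∷ as′ ∷ ρ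

  Der-EDGES : ∀ N n ed Γ C → EdgesProvable N n ed Γ C → Der clauses (EDGES (num N) (num n)
    (num (encList (tabulate (toℕ ∘ proj₁ ∘ ed)))) (num (encList (tabulate (attCode ∘ ed)))) ⌜ Γ ⌝ᶜ ⌜ C ⌝)
  Der-EDGES N zero ed Γ C (hV , hE , okV , okE , d) = der (fin (# 1)) (num N ∷ ⌜ Γ ⌝ᶜ ∷ ⌜ C ⌝ ∷ [])
    (Der-NODES N 0 Γ C (hV , okV , d) ∷ [])
  Der-EDGES N (suc n) ed Γ C (hV , hE , okV , okE , d) = edges-step (Vec.tabulate (numTree ∘ a)) (okE zero)
    (Der-CONS (toℕ (proj₁ (ed zero))) (encList (tabulate (toℕ ∘ proj₁ ∘ ed ∘ suc))))
    (Der-CONS (attCode (ed zero)) (encList (tabulate (attCode ∘ ed ∘ suc))))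
    (subst (λ ts → Der clauses (LIST (num N) (num (attCode (ed zero))) (treeList ts)))
      (tabulate-cong (sym ∘ lookup∘tabulate (numTree ∘ a))) (Der-LIST _ a))
    (λ ρ′ eq → renP-eval _ _ ρ′ (selSubP-eval (type T (proj₁ (ed zero))) 9+ (toℕ ∘ a) ρ′ λ i → ≡.trans (eq i) (lookup∘tabulate (numTree ∘ a) i)) (hE zero))
    (Der-EDGES N n (ed ∘ suc) (edgeFm (ed zero) (hE zero) ∷ Γ) C (hV , hE ∘ suc , okV , okE ∘ suc ,
          exch (↭-sym (shift (edgeFm (ed zero) (hE zero))
            (tabulate (λ e → edgeFm (ed (suc e)) (hE (suc e))) ++ tabulate (λ v → nodeFm (toℕ v) (hV v))) Γ)) d))
    where a = proj₂ (ed zero)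

  top-step : ∀ {n v r₁ e r₂ ls r₃ as r₄ xs s} (ρ : Vec Tree (length X)) →
    Der clauses (CONS v r₁ n) → Der clauses (CONS e r₂ r₁) → Der clauses (CONS ls r₃ r₂) →
    Der clauses (CONS as r₄ r₃) → Der clauses (CONS xs leaf r₄) →
    Der clauses (LIST v xs (treeList (tabulate (Vec.lookup ρ)))) →
    (∀ ρ′ → (∀ i → (10+ i ⟦ ρ′ ⟧) ≡ Vec.lookup ρ i) → renP (selSubP X 10+) (start G) ⟦ ρ′ ⟧ ≡ s) →
    Der clauses (EDGES v e ls as leaf s) → Der clauses (TOP n)
  top-step {n} {v} {r₁} {e} {r₂} {ls} {r₃} {as} {r₄} {xs} {s} ρ d₁ d₂ d₃ d₄ d₅ d₆ eq d₇ = der (fin (# 2)) ρ′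
    ( d₁ ∷ d₂ ∷ d₃ ∷ d₄ ∷ d₅
    ∷ subst (λ t → Der clauses (LIST v xs t)) (sym (listP-eval _ 10+ (Vec.lookup ρ) ρ′ λ _ → refl)) d₆
    ∷ subst (λ s → Der clauses (EDGES v e ls as leaf s)) (sym (eq ρ′ λ _ → refl)) d₇
    ∷ [])
    where
    ρ′ : Vec Tree (10 + length X)
    ρ′ = n ∷ v ∷ r₁ ∷ e ∷ r₂ ∷ ls ∷ r₃ ∷ as ∷ r₄ ∷ xs ∷ ρ

  Der-TOP : ∀ H → InL G H → Der clauses (TOP (num (encode H)))
  Der-TOP H (hV , hE , okV , okE , d) = top-step (Vec.tabulate (numTree ∘ ext H))
    (Der-CONS (nV H) (consℕ (nE H) (consℕ labs (consℕ atts (consℕ exts 0)))))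
    (Der-CONS (nE H) (consℕ labs (consℕ atts (consℕ exts 0))))
    (Der-CONS labs (consℕ atts (consℕ exts 0)))
    (Der-CONS atts (consℕ exts 0))
    (Der-CONS exts 0)
    (subst (λ ts → Der clauses (LIST (num (nV H)) (num exts) (treeList ts)))
      (tabulate-cong (sym ∘ lookup∘tabulate (numTree ∘ ext H))) (Der-LIST _ (ext H)))
    (λ ρ′ eq → renP-eval _ _ ρ′ (selSubP-eval X 10+ (toℕ ∘ ext H) ρ′
       λ i → ≡.trans (eq i) (lookup∘tabulate (numTree ∘ ext H) i)) (start G))
    (Der-EDGES (nV H) (nE H) (λ e → lab H e , att H e) [] (ren (selSub X (toℕ ∘ ext H)) (start G))
          (hV , hE , okV , okE , subst (_⊢ _) (sym (++-identityʳ _)) d))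
    where
    labs = encList (tabulate (toℕ ∘ lab H))
    atts = encList (tabulate (λ e → encList (tabulate (toℕ ∘ att H e))))
    exts = encList (tabulate (toℕ ∘ ext H))

  REℕ-resp : ∀ {A B : ℕ → Set} → (∀ n → A n ⇔ B n) → REℕ B → REℕ A
  REℕ-resp A⇔B (f , f-correct) = f , λ n → mk⇔
    (Equivalence.to (f-correct n) ∘ Equivalence.to (A⇔B n))
    (Equivalence.from (A⇔B n) ∘ Equivalence.from (f-correct n))

  generated⇒RE : (L : HG T X → Set) → Generates G L → RE L
  generated⇒RE L gen = REℕ-resp (λ n → mk⇔ to (from n)) (Der-RE clauses 19)
    where
    to : ∀ {n} → Σ[ H ∈ HG T X ] (encode H ≡ n × L H) → Der clauses (TOP (num n))
    to (H , refl , H∈) = Der-TOP H (Equivalence.to (gen H) H∈)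
    from : ∀ n → Der clauses (TOP (num n)) → Σ[ H ∈ HG T X ] (encode H ≡ n × L H)
    from n d = let H , eq , H∈ = Der-least (J ⊨_) model d in H , num-inj eq , Equivalence.from (gen H) H∈

-- Resource semantics: a formula denotes a predicate on multisets of tokens, ⊗ is interpreted by
-- splitting the multiset, and !A holds of the empty multiset only.
module Semantics {D Tok : Set} (I : ℕ → List D → List Tok → Set)
  (I-resp : ∀ {p ds r r′} → r ↭ r′ → I p ds r → I p ds r′) where

  Pred : Set₁
  Pred = List Tok → Set

  Env : Set
  Env = Var → D

  tm : ∀ {n} → Env → (Fin n → D) → Tm n → D
  tm ρ δ (fv x) = ρ x
  tm ρ δ (bv i) = δ i

  infixr 5 _▹_
  _▹_ : ∀ {n} → D → (Fin n → D) → Fin (suc n) → D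
  (d ▹ δ) zero = d
  (d ▹ δ) (suc i) = δ i

  Sem : ∀ {n} → Fm n → Env → (Fin n → D) → Pred
  Sem (atom p ts) ρ δ r = I p (map (tm ρ δ) ts) r
  Sem (A ⊗ B) ρ δ r = Σ[ r₁ ∈ List Tok ] Σ[ r₂ ∈ List Tok ] r₁ ++ r₂ ↭ r × Sem A ρ δ r₁ × Sem B ρ δ r₂
  Sem (A ⊸ B) ρ δ r = ∀ r′ → Sem A ρ δ r′ → Sem B ρ δ (r′ ++ r)
  Sem (A & B) ρ δ r = Sem A ρ δ r × Sem B ρ δ r
  Sem (A ⊕ B) ρ δ r = Sem A ρ δ r ⊎ Sem B ρ δ r
  Sem (! A) ρ δ r = r ≡ [] × Sem A ρ δ []
  Sem 𝟘 ρ δ r = ⊥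
  Sem 𝟙 ρ δ r = r ≡ []
  Sem ⊤ ρ δ r = Unit
  Sem (∀' A) ρ δ r = ∀ d → Sem A ρ (d ▹ δ) r
  Sem (∃' A) ρ δ r = Σ[ d ∈ D ] Sem A ρ (d ▹ δ) r

  []-inv : ∀ {r r′ : List Tok} → r ↭ r′ → r ≡ [] → r′ ≡ []
  []-inv p refl = ↭-empty-inv (↭-sym p)

  resp : ∀ {n} (A : Fm n) {ρ δ r r′} → r ↭ r′ → Sem A ρ δ r → Sem A ρ δ r′
  resp (atom p ts) q a = I-resp q a
  resp (A ⊗ B) q (r₁ , r₂ , p , a , b) = r₁ , r₂ , ↭-trans p q , a , b
  resp (A ⊸ B) q f r′ a = resp B (++⁺ˡ r′ q) (f r′ a)
  resp (A & B) q (a , b) = resp A q a , resp B q b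
  resp (A ⊕ B) q (inj₁ a) = inj₁ (resp A q a)
  resp (A ⊕ B) q (inj₂ b) = inj₂ (resp B q b)
  resp (! A) q (eq , a) = []-inv q eq , a
  resp 𝟙 q eq = []-inv q eq
  resp ⊤ q _ = tt
  resp (∀' A) q f d = resp A q (f d)
  resp (∃' A) q (d , a) = d , resp A q a

  infix 4 _≋_
  _≋_ : Pred → Pred → Set
  U ≋ V = ∀ {r} → (U r → V r) × (V r → U r)

  I-≋ : ∀ p {ds ds′} → ds ≡ ds′ → I p ds ≋ I p ds′
  I-≋ p refl = (λ a → a) , (λ a → a)

  lift-eq : ∀ {m n ρ} {σ : Fin n → Tm m} {δ δ′} → (∀ i → tm ρ δ (σ i) ≡ δ′ i) →
    ∀ d i → tm ρ (d ▹ δ) (liftS σ i) ≡ (d ▹ δ′) i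
  lift-eq eq d zero = refl
  lift-eq {σ = σ} eq d (suc i) with σ i | eq i
  ... | fv x | e = e
  ... | bv j | e = e

  Sem-subst : ∀ {m n} (A : Fm n) {σ : Fin n → Tm m} {ρ δ δ′} → (∀ i → tm ρ δ (σ i) ≡ δ′ i) →
    Sem (substF σ A) ρ δ ≋ Sem A ρ δ′
  Sem-subst {m} {n} (atom p ts) {σ} {ρ} {δ} {δ′} eq = I-≋ p (≡.trans (sym (map-∘ ts)) (map-cong lem ts))
    where
    lem : ∀ t → tm ρ δ (substT σ t) ≡ tm ρ δ′ t
    lem (fv x) = refl
    lem (bv i) = eq i
  Sem-subst (A ⊗ B) eq =
    (λ (r₁ , r₂ , p , a , b) → r₁ , r₂ , p , proj₁ (Sem-subst A eq) a , proj₁ (Sem-subst B eq) b) ,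
    (λ (r₁ , r₂ , p , a , b) → r₁ , r₂ , p , proj₂ (Sem-subst A eq) a , proj₂ (Sem-subst B eq) b)
  Sem-subst (A ⊸ B) eq =
    (λ f r′ a → proj₁ (Sem-subst B eq) (f r′ (proj₂ (Sem-subst A eq) a))) ,
    (λ f r′ a → proj₂ (Sem-subst B eq) (f r′ (proj₁ (Sem-subst A eq) a)))
  Sem-subst (A & B) eq =
    (λ (a , b) → proj₁ (Sem-subst A eq) a , proj₁ (Sem-subst B eq) b) ,
    (λ (a , b) → proj₂ (Sem-subst A eq) a , proj₂ (Sem-subst B eq) b)
  Sem-subst (A ⊕ B) eq =
    (λ { (inj₁ a) → inj₁ (proj₁ (Sem-subst A eq) a) ; (inj₂ b) → inj₂ (proj₁ (Sem-subst B eq) b) }) ,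
    (λ { (inj₁ a) → inj₁ (proj₂ (Sem-subst A eq) a) ; (inj₂ b) → inj₂ (proj₂ (Sem-subst B eq) b) })
  Sem-subst (! A) eq = (λ (e , a) → e , proj₁ (Sem-subst A eq) a) , (λ (e , a) → e , proj₂ (Sem-subst A eq) a)
  Sem-subst 𝟘 eq = (λ a → a) , (λ a → a)
  Sem-subst 𝟙 eq = (λ a → a) , (λ a → a)
  Sem-subst ⊤ eq = (λ a → a) , (λ a → a)
  Sem-subst (∀' A) eq =
    (λ f d → proj₁ (Sem-subst A (lift-eq eq d)) (f d)) , (λ f d → proj₂ (Sem-subst A (lift-eq eq d)) (f d))
  Sem-subst (∃' A) eq =
    (λ (d , a) → d , proj₁ (Sem-subst A (lift-eq eq d)) a) , (λ (d , a) → d , proj₂ (Sem-subst A (lift-eq eq d)) a)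

  Sem-cong : ∀ {n} (A : Fm n) {ρ ρ′ δ} → (∀ x → x ∈ FV A → ρ x ≡ ρ′ x) → Sem A ρ δ ≋ Sem A ρ′ δ
  Sem-cong (atom p ts) {ρ} {ρ′} {δ} eq = I-≋ p (lem ts eq)
    where
    lem : ∀ ts → (∀ x → x ∈ concatMap fvT ts → ρ x ≡ ρ′ x) → map (tm ρ δ) ts ≡ map (tm ρ′ δ) ts
    lem [] eq = refl
    lem (fv x ∷ ts) eq = cong₂ _∷_ (eq x (here refl)) (lem ts (λ y → eq y ∘ there))
    lem (bv i ∷ ts) eq = cong (δ i ∷_) (lem ts eq)
  Sem-cong (A ⊗ B) eq =
    (λ (r₁ , r₂ , p , a , b) → r₁ , r₂ , p , proj₁ (Sem-cong A (λ x → eq x ∘ ∈-++⁺ˡ)) a , proj₁ (Sem-cong B (λ x → eq x ∘ ∈-++⁺ʳ (FV A))) b) ,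
    (λ (r₁ , r₂ , p , a , b) → r₁ , r₂ , p , proj₂ (Sem-cong A (λ x → eq x ∘ ∈-++⁺ˡ)) a , proj₂ (Sem-cong B (λ x → eq x ∘ ∈-++⁺ʳ (FV A))) b)
  Sem-cong (A ⊸ B) eq =
    (λ f r′ a → proj₁ (Sem-cong B (λ x → eq x ∘ ∈-++⁺ʳ (FV A))) (f r′ (proj₂ (Sem-cong A (λ x → eq x ∘ ∈-++⁺ˡ)) a))) ,
    (λ f r′ a → proj₂ (Sem-cong B (λ x → eq x ∘ ∈-++⁺ʳ (FV A))) (f r′ (proj₁ (Sem-cong A (λ x → eq x ∘ ∈-++⁺ˡ)) a)))
  Sem-cong (A & B) eq =
    (λ (a , b) → proj₁ (Sem-cong A (λ x → eq x ∘ ∈-++⁺ˡ)) a , proj₁ (Sem-cong B (λ x → eq x ∘ ∈-++⁺ʳ (FV A))) b) ,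
    (λ (a , b) → proj₂ (Sem-cong A (λ x → eq x ∘ ∈-++⁺ˡ)) a , proj₂ (Sem-cong B (λ x → eq x ∘ ∈-++⁺ʳ (FV A))) b)
  Sem-cong (A ⊕ B) eq =
    (λ { (inj₁ a) → inj₁ (proj₁ (Sem-cong A (λ x → eq x ∘ ∈-++⁺ˡ)) a)
       ; (inj₂ b) → inj₂ (proj₁ (Sem-cong B (λ x → eq x ∘ ∈-++⁺ʳ (FV A))) b) }) ,
    (λ { (inj₁ a) → inj₁ (proj₂ (Sem-cong A (λ x → eq x ∘ ∈-++⁺ˡ)) a)
       ; (inj₂ b) → inj₂ (proj₂ (Sem-cong B (λ x → eq x ∘ ∈-++⁺ʳ (FV A))) b) })
  Sem-cong (! A) eq = (λ (e , a) → e , proj₁ (Sem-cong A eq) a) , (λ (e , a) → e , proj₂ (Sem-cong A eq) a)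
  Sem-cong 𝟘 eq = (λ a → a) , (λ a → a)
  Sem-cong 𝟙 eq = (λ a → a) , (λ a → a)
  Sem-cong ⊤ eq = (λ a → a) , (λ a → a)
  Sem-cong (∀' A) eq = (λ f d → proj₁ (Sem-cong A eq) (f d)) , (λ f d → proj₂ (Sem-cong A eq) (f d))
  Sem-cong (∃' A) eq = (λ (d , a) → d , proj₁ (Sem-cong A eq) a) , (λ (d , a) → d , proj₂ (Sem-cong A eq) a)

  Sem₀ : Fm 0 → Env → Pred
  Sem₀ A ρ = Sem A ρ (λ ())

  Sem-inst : ∀ (A : Fm 1) y {ρ} → Sem₀ (inst A y) ρ ≋ Sem A ρ (ρ y ▹ λ ())
  Sem-inst A y = Sem-subst A λ { zero → refl }

  SemC : Ctx → Env → Pred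
  SemC [] ρ r = r ≡ []
  SemC (A ∷ Γ) ρ r = Σ[ r₁ ∈ List Tok ] Σ[ r₂ ∈ List Tok ] r₁ ++ r₂ ↭ r × Sem₀ A ρ r₁ × SemC Γ ρ r₂

  respC : ∀ Γ {ρ r r′} → r ↭ r′ → SemC Γ ρ r → SemC Γ ρ r′
  respC [] q eq = []-inv q eq
  respC (A ∷ Γ) q (r₁ , r₂ , p , a , g) = r₁ , r₂ , ↭-trans p q , a , g

  congC : ∀ Γ {ρ ρ′ r} → (∀ x → x ∈ FVs Γ → ρ x ≡ ρ′ x) → SemC Γ ρ r → SemC Γ ρ′ r
  congC [] eq g = g
  congC (A ∷ Γ) eq (r₁ , r₂ , p , a , g) =
    r₁ , r₂ , p , proj₁ (Sem-cong A (λ x → eq x ∘ ∈-++⁺ˡ)) a , congC Γ (λ x → eq x ∘ ∈-++⁺ʳ (FV A)) g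

  permC : ∀ {Γ Δ ρ r} → Γ ↭ Δ → SemC Γ ρ r → SemC Δ ρ r
  permC refl g = g
  permC (prep A p) (r₁ , r₂ , q , a , g) = r₁ , r₂ , q , a , permC p g
  permC (swap A B p) (r₁ , r₂ , q , a , (r₃ , r₄ , q′ , b , g)) =
    r₃ , r₁ ++ r₄ , ↭-trans (shifts r₃ r₁) (↭-trans (++⁺ˡ r₁ q′) q) , b , (r₁ , r₄ , ↭-refl , a , permC p g)
  permC (trans p p′) g = permC p′ (permC p g)

  splitC : ∀ Γ {Δ ρ r} → SemC (Γ ++ Δ) ρ r →
    Σ[ r₁ ∈ List Tok ] Σ[ r₂ ∈ List Tok ] r₁ ++ r₂ ↭ r × SemC Γ ρ r₁ × SemC Δ ρ r₂
  splitC [] {r = r} g = [] , r , ↭-refl , refl , g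
  splitC (A ∷ Γ) (r₁ , r₂ , p , a , g) with splitC Γ g
  ... | r₃ , r₄ , q , g₁ , g₂ = r₁ ++ r₃ , r₄ ,
    ↭-trans (↭-reflexive (++-assoc r₁ r₃ r₄)) (↭-trans (++⁺ˡ r₁ q) p) , (r₁ , r₃ , ↭-refl , a , g₁) , g₂

  joinC : ∀ Γ {Δ ρ r₁ r₂} → SemC Γ ρ r₁ → SemC Δ ρ r₂ → SemC (Γ ++ Δ) ρ (r₁ ++ r₂)
  joinC [] refl h = h
  joinC (A ∷ Γ) {r₂ = r₂} (r , r′ , p , a , g) h =
    r , r′ ++ r₂ , ↭-trans (↭-reflexive (sym (++-assoc r r′ r₂))) (++⁺ʳ r₂ p) , a , joinC Γ g h

  -- This is what makes promotion sound: formulas under `!` own no tokens, so neither does a context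
  -- that consists of them.
  !C-empty : ∀ Γ {ρ r} → SemC (map !_ Γ) ρ r → r ≡ []
  !C-empty [] eq = eq
  !C-empty (A ∷ Γ) (r₁ , r₂ , p , (refl , _) , g) = []-inv p (!C-empty Γ g)

  _[_↦_] : Env → Var → D → Env
  (ρ [ y ↦ d ]) x with x ≟ y
  ... | yes _ = d
  ... | no _ = ρ x

  update-≡ : ∀ ρ y d → (ρ [ y ↦ d ]) y ≡ d
  update-≡ ρ y d with y ≟ y
  ... | yes _ = refl
  ... | no y≢y = contradiction refl y≢y

  update-∉ : ∀ {ρ y d xs} → y ∉ xs → ∀ x → x ∈ xs → ρ x ≡ (ρ [ y ↦ d ]) x
  update-∉ {y = y} y∉ x x∈ with x ≟ y
  ... | yes refl = contradiction x∈ y∉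
  ... | no _ = refl

  ▹-cong : ∀ (A : Fm 1) {ρ d d′ r} → d ≡ d′ → Sem A ρ (d ▹ λ ()) r → Sem A ρ (d′ ▹ λ ()) r
  ▹-cong A refl a = a

  sound : ∀ {Γ C} → Γ ⊢ C → ∀ {ρ r} → SemC Γ ρ r → Sem₀ C ρ r
  sound {C = C} ax (r₁ , _ , p , a , refl) = resp C (↭-trans (↭-reflexive (sym (++-identityʳ r₁))) p) a
  sound (exch p d) g = sound d (permC (↭-sym p) g)
  sound (cut {Γ} {Δ} d e) g with splitC Γ g
  ... | r₁ , r₂ , p , g₁ , g₂ = sound e (r₁ , r₂ , p , sound d g₁ , g₂)
  sound (⊗L d) (r₁ , r₂ , p , (s₁ , s₂ , q , a , b) , g) =
    sound d (s₁ , s₂ ++ r₂ , ↭-trans (↭-reflexive (sym (++-assoc s₁ s₂ r₂))) (↭-trans (++⁺ʳ r₂ q) p) , a , (s₂ , r₂ , ↭-refl , b , g))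
  sound (⊗R {Γ} d e) g with splitC Γ g
  ... | r₁ , r₂ , p , g₁ , g₂ = r₁ , r₂ , p , sound d g₁ , sound e g₂
  sound (⊸L {Γ} {Δ} d e) (r₁ , r₂ , p , f , g) with splitC Γ g
  ... | s₁ , s₂ , q , g₁ , g₂ = sound e (s₁ ++ r₁ , s₂ ,
    ↭-trans (↭-reflexive (++-assoc s₁ r₁ s₂)) (↭-trans (shifts s₁ r₁) (↭-trans (++⁺ˡ r₁ q) p)) , f s₁ (sound d g₁) , g₂)
  sound (⊸R d) g r′ a = sound d (r′ , _ , ↭-refl , a , g)
  sound (&L₁ d) (r₁ , r₂ , p , (a , b) , g) = sound d (r₁ , r₂ , p , a , g)
  sound (&L₂ d) (r₁ , r₂ , p , (a , b) , g) = sound d (r₁ , r₂ , p , b , g)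
  sound (&R d e) g = sound d g , sound e g
  sound (⊕L d e) (r₁ , r₂ , p , inj₁ a , g) = sound d (r₁ , r₂ , p , a , g)
  sound (⊕L d e) (r₁ , r₂ , p , inj₂ b , g) = sound e (r₁ , r₂ , p , b , g)
  sound (⊕R₁ d) g = inj₁ (sound d g)
  sound (⊕R₂ d) g = inj₂ (sound d g)
  sound 𝟘L (_ , _ , _ , () , _)
  sound (𝟙L {Γ} d) (_ , r₂ , p , refl , g) = sound d (respC Γ p g)
  sound 𝟙R g = g
  sound ⊤R g = tt
  sound (!L d) (_ , r₂ , p , (refl , a) , g) = sound d ([] , r₂ , p , a , g)
  sound (!W {Γ} d) (_ , r₂ , p , (refl , a) , g) = sound d (respC Γ p g)
  sound (!C d) (_ , r₂ , p , (refl , a) , g) =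
    sound d ([] , r₂ , p , (refl , a) , ([] , r₂ , ↭-refl , (refl , a) , g))
  sound (!R {Γ} d) g with !C-empty Γ g
  ... | refl = refl , sound d g
  sound (∀L {A = A} y d) (r₁ , r₂ , p , f , g) = sound d (r₁ , r₂ , p , proj₂ (Sem-inst A y) (f _) , g)
  -- The eigenvariable is reassigned to the arbitrary element `d′`; by freshness this changes
  -- neither the meaning of the context nor that of `A`. The case of `∃L` does the same with the
  -- witness.
  sound (∀R {Γ} {A} y y∉Γ y∉A d) {ρ} g d′ =
    proj₂ (Sem-cong A (update-∉ {ρ} {y} {d′} y∉A)) (▹-cong A (update-≡ ρ y d′)
      (proj₁ (Sem-inst A y) (sound d {ρ [ y ↦ d′ ]} (congC Γ (update-∉ y∉Γ) g))))
  sound (∃L {Γ} {A} {C} y y∉Γ y∉A y∉C d) {ρ} (r₁ , r₂ , p , (d′ , a) , g) =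
    proj₂ (Sem-cong C (update-∉ {ρ} {y} {d′} y∉C)) (sound d {ρ [ y ↦ d′ ]} (r₁ , r₂ , p ,
      proj₂ (Sem-inst A y) (▹-cong A (sym (update-≡ ρ y d′)) (proj₁ (Sem-cong A (update-∉ y∉A)) a)) ,
      congC Γ (update-∉ y∉Γ) g))
  sound (∃R {A = A} y d) {ρ} g = ρ y , proj₁ (Sem-inst A y) (sound d g)

-- Natural deduction with a reusable context Ψ and a linear context Δ

infix 3 _∣_⊩_
_∣_⊩_ : Ctx → Ctx → Fm 0 → Set
Ψ ∣ Δ ⊩ C = map !_ Ψ ++ Δ ⊢ C

weaken : ∀ Ψ {Γ C} → Γ ⊢ C → map !_ Ψ ++ Γ ⊢ C
weaken [] d = d
weaken (A ∷ Ψ) d = !W (weaken Ψ d)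

contract : ∀ Ψ {Γ C} → map !_ Ψ ++ map !_ Ψ ++ Γ ⊢ C → map !_ Ψ ++ Γ ⊢ C
contract [] d = d
contract (A ∷ Ψ) {Γ} d = !C (exch (shifts (map !_ Ψ) (! A ∷ ! A ∷ []))
  (contract Ψ (exch (↭-sym (↭-trans (++⁺ˡ (map !_ Ψ) (shifts (map !_ Ψ) (! A ∷ ! A ∷ [])))
    (↭-trans (shifts (map !_ Ψ) (! A ∷ ! A ∷ [])) (prep (! A) (↭-sym (shift (! A) (map !_ Ψ) (map !_ Ψ ++ Γ))))))) d)))

linear : ∀ {Ψ A} → Ψ ∣ A ∷ [] ⊩ A
linear {Ψ} = weaken Ψ ax

reuse : ∀ {Ψ A} → A ∈ Ψ → Ψ ∣ [] ⊩ A
reuse {A ∷ Ψ} (here refl) = !L (exch (shift A (map !_ Ψ) []) (weaken Ψ ax))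
reuse {A ∷ Ψ} (there A∈Ψ) = !W (reuse A∈Ψ)

-- Both premises may use all of `Ψ`, so the cut produces two copies of it, which contraction merges.
cutΨ : ∀ {Ψ Δ₁ Δ₂ A C} → Ψ ∣ Δ₁ ⊩ A → A ∷ map !_ Ψ ++ Δ₂ ⊢ C → Ψ ∣ Δ₁ ++ Δ₂ ⊩ C
cutΨ {Ψ} {Δ₁} {Δ₂} d e = contract Ψ (exch
  (↭-trans (↭-reflexive (++-assoc (map !_ Ψ) Δ₁ (map !_ Ψ ++ Δ₂))) (++⁺ˡ (map !_ Ψ) (shifts Δ₁ (map !_ Ψ))))
  (cut d e))

apply : ∀ {Ψ Δ₁ Δ₂ A B} → Ψ ∣ Δ₁ ⊩ A ⊸ B → Ψ ∣ Δ₂ ⊩ A → Ψ ∣ Δ₁ ++ Δ₂ ⊩ B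
apply {Ψ} {Δ₁} {Δ₂} {A} {B} d e = cutΨ {Ψ} {Δ₁} {Δ₂} d
  (subst (λ Γ → (A ⊸ B) ∷ Γ ⊢ B) (++-identityʳ (map !_ Ψ ++ Δ₂)) (⊸L e ax))

instantiate : ∀ {Ψ Δ} (A : Fm 1) y → Ψ ∣ Δ ⊩ ∀' A → Ψ ∣ Δ ⊩ inst A y
instantiate {Ψ} {Δ} A y d = subst (λ Δ → Ψ ∣ Δ ⊩ inst A y) (++-identityʳ Δ)
  (cutΨ {Ψ} {Δ} d (∀L y (exch (shift (inst A y) (map !_ Ψ) []) (weaken Ψ ax))))

FVs-! : ∀ Ψ Δ → FVs (map !_ Ψ ++ Δ) ≡ FVs (Ψ ++ Δ)
FVs-! [] Δ = refl
FVs-! (A ∷ Ψ) Δ = cong (FV A ++_) (FVs-! Ψ Δ)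

-- The eigenvariable `y` becomes the name of a new object. The `!` below the quantifier is what lets
-- the fact about `y` enter the reusable context.
open∃ : ∀ {Ψ Δ C} (B : Fm 1) y → y ∉ FVs (Ψ ++ Δ) → y ∉ FV B → y ∉ FV C →
  Ψ ∣ [] ⊩ ∃' (! B) → inst B y ∷ Ψ ∣ Δ ⊩ C → Ψ ∣ Δ ⊩ C
open∃ {Ψ} {Δ} B y y∉ y∉B y∉C d e = cutΨ {Ψ} {[]} {Δ} d (∃L y (y∉ ∘ subst (y ∈_) (FVs-! Ψ Δ)) y∉B y∉C e)

impls : Ctx → Fm 0 → Fm 0
impls [] C = C
impls (A ∷ Ψ) C = ! A ⊸ impls Ψ C

impls-intro : ∀ Ψ {Δ C} → Ψ ∣ Δ ⊩ C → Δ ⊢ impls Ψ C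
impls-intro [] d = d
impls-intro (A ∷ Ψ) {Δ} d = ⊸R (impls-intro Ψ (exch (↭-sym (shift (! A) (map !_ Ψ) Δ)) d))

ren-impls : ∀ h Ψ C → All (λ A → ren h A ≡ A) Ψ → ren h (impls Ψ C) ≡ impls Ψ (ren h C)
ren-impls h [] C [] = refl
ren-impls h (A ∷ Ψ) C (eq ∷ eqs) = cong₂ (λ A B → ! A ⊸ B) eq (ren-impls h Ψ C eqs)

FV-impls : ∀ Ψ C → All (λ A → FV A ≡ []) Ψ → FV (impls Ψ C) ≡ FV C
FV-impls [] C [] = refl
FV-impls (A ∷ Ψ) C (eq ∷ eqs) rewrite eq = FV-impls Ψ C eqs

-- Horn axioms ∀ x₁ … xₙ (b₁ ⊸ … ⊸ bₖ ⊸ h)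

HAtom : ℕ → Set
HAtom n = ℕ × List (Fin n)

record Axiom : Set where
  constructor axiom
  field
    vars : ℕ
    prem : List (HAtom vars)
    conc : HAtom vars
open Axiom public

hatom : ∀ {n m} → (Fin n → Tm m) → HAtom n → Fm m
hatom σ (p , is) = atom p (map σ is)

matrix : ∀ {n m} → (Fin n → Tm m) → List (HAtom n) → HAtom n → Fm m
matrix σ [] h = hatom σ h
matrix σ (b ∷ bs) h = hatom σ b ⊸ matrix σ bs h

∀* : ∀ n → Fm n → Fm 0
∀* zero A = A
∀* (suc n) A = ∀* n (∀' A)

axiomFm : Axiom → Fm 0
axiomFm (axiom n bs h) = ∀* n (matrix bv bs h)

matrix-subst : ∀ {n m k} (σ : Fin n → Tm m) (τ : Fin m → Tm k) υ → (∀ i → substT τ (σ i) ≡ υ i) → ∀ bs h →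
  substF τ (matrix σ bs h) ≡ matrix υ bs h
matrix-subst σ τ υ eq [] (p , is) = cong (atom p) (≡.trans (sym (map-∘ is)) (map-cong eq is))
matrix-subst σ τ υ eq ((p , is) ∷ bs) h =
  cong₂ _⊸_ (cong (atom p) (≡.trans (sym (map-∘ is)) (map-cong eq is))) (matrix-subst σ τ υ eq bs h)

lift-∘ : ∀ {n m k} {σ : Fin n → Tm m} {τ : Fin m → Tm k} {υ} → (∀ i → substT τ (σ i) ≡ υ i) →
  ∀ i → substT (liftS τ) (liftS σ i) ≡ liftS υ i
lift-∘ eq zero = refl
lift-∘ {σ = σ} eq (suc i) with σ i | eq i
... | fv x | e = cong wkT e
... | bv j | e = cong wkT e

substF-∘ : ∀ {n m k} (A : Fm n) {σ : Fin n → Tm m} {τ : Fin m → Tm k} {υ} → (∀ i → substT τ (σ i) ≡ υ i) →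
  substF τ (substF σ A) ≡ substF υ A
substF-∘ (atom p ts) eq = cong (atom p) (≡.trans (sym (map-∘ ts)) (map-cong (λ { (fv x) → refl ; (bv i) → eq i }) ts))
substF-∘ (A ⊗ B) eq = cong₂ _⊗_ (substF-∘ A eq) (substF-∘ B eq)
substF-∘ (A ⊸ B) eq = cong₂ _⊸_ (substF-∘ A eq) (substF-∘ B eq)
substF-∘ (A & B) eq = cong₂ _&_ (substF-∘ A eq) (substF-∘ B eq)
substF-∘ (A ⊕ B) eq = cong₂ _⊕_ (substF-∘ A eq) (substF-∘ B eq)
substF-∘ (! A) eq = cong !_ (substF-∘ A eq)
substF-∘ 𝟘 eq = refl
substF-∘ 𝟙 eq = refl
substF-∘ ⊤ eq = refl
substF-∘ (∀' A) eq = cong ∀' (substF-∘ A (lift-∘ eq))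
substF-∘ (∃' A) eq = cong ∃' (substF-∘ A (lift-∘ eq))

lift-id : ∀ {n} {σ : Fin n → Tm n} → (∀ i → σ i ≡ bv i) → ∀ i → liftS σ i ≡ bv i
lift-id eq zero = refl
lift-id eq (suc i) = cong wkT (eq i)

substF-id : ∀ {n} (A : Fm n) {σ : Fin n → Tm n} → (∀ i → σ i ≡ bv i) → substF σ A ≡ A
substF-id (atom p ts) eq = cong (atom p) (≡.trans (map-cong (λ { (fv x) → refl ; (bv i) → eq i }) ts) (map-id ts))
substF-id (A ⊗ B) eq = cong₂ _⊗_ (substF-id A eq) (substF-id B eq)
substF-id (A ⊸ B) eq = cong₂ _⊸_ (substF-id A eq) (substF-id B eq)
substF-id (A & B) eq = cong₂ _&_ (substF-id A eq) (substF-id B eq)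
substF-id (A ⊕ B) eq = cong₂ _⊕_ (substF-id A eq) (substF-id B eq)
substF-id (! A) eq = cong !_ (substF-id A eq)
substF-id 𝟘 eq = refl
substF-id 𝟙 eq = refl
substF-id ⊤ eq = refl
substF-id (∀' A) eq = cong ∀' (substF-id A (lift-id eq))
substF-id (∃' A) eq = cong ∃' (substF-id A (lift-id eq))

-- Index `zero` belongs to the innermost quantifier of `∀*` and is therefore instantiated last;
-- `substF-∘` fuses the two substitutions.
specialize : ∀ {Ψ Δ} n (A : Fm n) (ρ : Fin n → Var) → Ψ ∣ Δ ⊩ ∀* n A → Ψ ∣ Δ ⊩ substF (fv ∘ ρ) A
specialize {Ψ} {Δ} zero A ρ d = subst (Ψ ∣ Δ ⊩_) (sym (substF-id A λ ())) d
specialize {Ψ} {Δ} (suc n) A ρ d = subst (Ψ ∣ Δ ⊩_) (substF-∘ A λ { zero → refl ; (suc i) → refl })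
  (instantiate {Ψ} {Δ} (substF (liftS (fv ∘ ρ ∘ suc)) A) (ρ zero) (specialize {Ψ} {Δ} n (∀' A) (ρ ∘ suc) d))

infixr 5 _∷_
data Premises (Ψ : Ctx) : Ctx → Ctx → Set where
  [] : Premises Ψ [] []
  _∷_ : ∀ {Δ Δ′ A As} → Ψ ∣ Δ ⊩ A → Premises Ψ As Δ′ → Premises Ψ (A ∷ As) (Δ ++ Δ′)

module _ {n} (σ : Fin n → Tm 0) where

  apply-matrix : ∀ {Ψ Δ Δ′} bs h → Ψ ∣ Δ ⊩ matrix σ bs h → Premises Ψ (map (hatom σ) bs) Δ′ → Ψ ∣ Δ ++ Δ′ ⊩ hatom σ h
  apply-matrix {Ψ} {Δ} [] h d [] = subst (λ Δ → Ψ ∣ Δ ⊩ hatom σ h) (sym (++-identityʳ Δ)) d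
  apply-matrix {Ψ} {Δ} (b ∷ bs) h d (_∷_ {Δ₁} {Δ₂} e es) = subst (λ Δ → Ψ ∣ Δ ⊩ hatom σ h) (++-assoc Δ Δ₁ Δ₂)
    (apply-matrix {Ψ} {Δ ++ Δ₁} bs h (apply {Ψ} {Δ} {Δ₁} d e) es)

apply-axiom : ∀ {Ψ Δ} (a : Axiom) → axiomFm a ∈ Ψ → (ρ : Fin (vars a) → Var) →
  Premises Ψ (map (hatom (fv ∘ ρ)) (prem a)) Δ → Ψ ∣ Δ ⊩ hatom (fv ∘ ρ) (conc a)
apply-axiom {Ψ} (axiom n bs h) a∈Ψ ρ = apply-matrix (fv ∘ ρ) {Ψ} {[]} bs h
  (subst (Ψ ∣ [] ⊩_) (matrix-subst bv (fv ∘ ρ) (fv ∘ ρ) (λ _ → refl) bs h)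
    (specialize {Ψ} {[]} n (matrix bv bs h) ρ (reuse a∈Ψ)))

ren-matrix : ∀ h {n} (bs : List (HAtom n)) c → ren h (matrix bv bs c) ≡ matrix bv bs c
ren-matrix h [] (p , is) = cong (atom p) (sym (map-∘ is))
ren-matrix h ((p , is) ∷ bs) c = cong₂ _⊸_ (cong (atom p) (sym (map-∘ is))) (ren-matrix h bs c)

ren-∀* : ∀ h n (A : Fm n) → ren h A ≡ A → ren h (∀* n A) ≡ ∀* n A
ren-∀* h zero A eq = eq
ren-∀* h (suc n) A eq = ren-∀* h n (∀' A) (cong ∀' eq)

ren-axiomFm : ∀ h a → ren h (axiomFm a) ≡ axiomFm a
ren-axiomFm h (axiom n bs c) = ren-∀* h n (matrix bv bs c) (ren-matrix h bs c)

FV-bv : ∀ {n} (is : List (Fin n)) → concatMap fvT (map (bv {n}) is) ≡ []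
FV-bv [] = refl
FV-bv (i ∷ is) = FV-bv is

FV-matrix : ∀ {n} (bs : List (HAtom n)) c → FV (matrix bv bs c) ≡ []
FV-matrix [] (p , is) = FV-bv is
FV-matrix ((p , is) ∷ bs) c rewrite FV-bv is = FV-matrix bs c

FV-∀* : ∀ n (A : Fm n) → FV (∀* n A) ≡ FV A
FV-∀* zero A = refl
FV-∀* (suc n) A = FV-∀* n (∀' A)

FV-axiomFm : ∀ a → FV (axiomFm a) ≡ []
FV-axiomFm (axiom n bs c) = ≡.trans (FV-∀* n (matrix bv bs c)) (FV-matrix bs c)

-- Eventual derivability along a growing sequence of reusable contexts
module Stages (Ψ : ℕ → Ctx) (step : ∀ N {Δ C} → Ψ N ∣ Δ ⊩ C → Ψ (suc N) ∣ Δ ⊩ C) where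

  infix 3 _⊪_
  _⊪_ : Ctx → Fm 0 → Set
  Δ ⊪ C = Σ[ N ∈ ℕ ] Ψ N ∣ Δ ⊩ C

  raise : ∀ {M N Δ C} → M ≤ N → Ψ M ∣ Δ ⊩ C → Ψ N ∣ Δ ⊩ C
  raise {M} {N} {Δ} {C} M≤N d = go (≤⇒≤′ M≤N)
    where
    go : ∀ {N} → M ≤′ N → Ψ N ∣ Δ ⊩ C
    go ≤′-refl = d
    go (≤′-step le) = step _ (go le)

  infixr 5 _∷_
  data Premises∞ : Ctx → Ctx → Set where
    [] : Premises∞ [] []
    _∷_ : ∀ {Δ Δ′ A As} → Δ ⊪ A → Premises∞ As Δ′ → Premises∞ (A ∷ As) (Δ ++ Δ′)

  raise* : ∀ {M N Γ Δ} → M ≤ N → Premises (Ψ M) Γ Δ → Premises (Ψ N) Γ Δ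
  raise* M≤N [] = []
  raise* M≤N (_∷_ {Δ} d ds) = raise {Δ = Δ} M≤N d ∷ raise* M≤N ds

  -- The premises of an axiom may require different supplies of named numbers; since stages only
  -- grow, the largest one serves all of them.
  collect : ∀ {Γ Δ} → Premises∞ Γ Δ → Σ[ N ∈ ℕ ] Premises (Ψ N) Γ Δ
  collect [] = 0 , []
  collect (_∷_ {Δ} (M , d) ds) with collect ds
  ... | N , es = M ⊔ N , raise {Δ = Δ} (m≤m⊔n M N) d ∷ raise* (m≤n⊔m M N) es

  apply∞ : ∀ {Δ} (a : Axiom) → (∀ N → axiomFm a ∈ Ψ N) → (ρ : Fin (vars a) → Var) →
    Premises∞ (map (hatom (fv ∘ ρ)) (prem a)) Δ → Δ ⊪ hatom (fv ∘ ρ) (conc a)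
  apply∞ a a∈Ψ ρ ds with collect ds
  ... | N , es = N , apply-axiom a (a∈Ψ N) ρ es

-- Validity of Horn axioms in the resource semantics

module HornValid {D Tok : Set} (I : ℕ → List D → List Tok → Set)
  (I-resp : ∀ {p ds r r′} → r ↭ r′ → I p ds r → I p ds r′) where

  open Semantics I I-resp

  Holds : ∀ {n} → (Fin n → D) → List (HAtom n) → HAtom n → List Tok → Set
  Holds δ [] (p , is) r = I p (map δ is) r
  Holds δ ((p , is) ∷ bs) h r = ∀ r′ → I p (map δ is) r′ → Holds δ bs h (r′ ++ r)

  -- Axioms stand under `!`, so they have to hold of the empty multiset: the tokens of the
  -- conclusion are just those brought in by the premises.
  Valid : Axiom → Set
  Valid (axiom n bs h) = ∀ δ → Holds δ bs h []

  Sem-matrix : ∀ {n ρ} {δ : Fin n → D} bs h {r} → Holds δ bs h r → Sem (matrix bv bs h) ρ δ r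
  Sem-matrix [] (p , is) v = subst (λ ds → I p ds _) (map-∘ is) v
  Sem-matrix ((p , is) ∷ bs) h v r′ a = Sem-matrix bs h (v r′ (subst (λ ds → I p ds r′) (sym (map-∘ is)) a))

  Sem-∀* : ∀ n (A : Fm n) {ρ r} → (∀ δ → Sem A ρ δ r) → Sem₀ (∀* n A) ρ r
  Sem-∀* zero A f = f (λ ())
  Sem-∀* (suc n) A f = Sem-∀* n (∀' A) λ δ d → f (d ▹ δ)

  Valid-sound : ∀ a → Valid a → ∀ {ρ} → Sem₀ (axiomFm a) ρ []
  Valid-sound (axiom n bs h) v = Sem-∀* n (matrix bv bs h) λ δ → Sem-matrix bs h (v δ)

  Sem-impls : ∀ Ψ {C ρ r} → All (λ A → Sem₀ A ρ []) Ψ → Sem₀ (impls Ψ C) ρ r → Sem₀ C ρ r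
  Sem-impls [] [] c = c
  Sem-impls (A ∷ Ψ) (a ∷ as) f = Sem-impls Ψ as (f [] (refl , a))

-- Predicate symbols

prTree  : ∀ {n} → PR n → Tree
prTree* : ∀ {n m} → Vec (PR n) m → Tree
prTree Z = node (num 0) leaf
prTree S = node (num 1) leaf
prTree (P i) = node (num 2) (num (toℕ i))
prTree (Comp {m} f gs) = node (num 3) (node (num m) (node (prTree f) (prTree* gs)))
prTree (Rec g h) = node (num 4) (node (prTree g) (prTree h))
prTree (Mu f) = node (num 5) (prTree f)
prTree* [] = leaf
prTree* (f ∷ fs) = node (prTree f) (prTree* fs)

prTree-inj  : ∀ {n} (f g : PR n) → prTree f ≡ prTree g → f ≡ g
prTree*-inj : ∀ {n m} (fs gs : Vec (PR n) m) → prTree* fs ≡ prTree* gs → fs ≡ gs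
prTree-inj Z Z eq = refl
prTree-inj S S eq = refl
prTree-inj (P i) (P j) eq = cong P (toℕ-injective (num-inj (node-injʳ eq)))
prTree-inj (Comp {m} f gs) (Comp {m′} f′ gs′) eq with num-inj {m} {m′} (node-injˡ (node-injʳ eq))
... | refl = cong₂ Comp (prTree-inj f f′ (node-injˡ (node-injʳ (node-injʳ eq))))
                        (prTree*-inj gs gs′ (node-injʳ (node-injʳ (node-injʳ eq))))
prTree-inj (Rec g h) (Rec g′ h′) eq = cong₂ Rec (prTree-inj g g′ (node-injˡ (node-injʳ eq))) (prTree-inj h h′ (node-injʳ (node-injʳ eq)))
prTree-inj (Mu f) (Mu f′) eq = cong Mu (prTree-inj f f′ (node-injʳ eq))
prTree*-inj [] [] eq = refl
prTree*-inj (f ∷ fs) (g ∷ gs) eq = cong₂ _∷_ (prTree-inj f g (node-injˡ eq)) (prTree*-inj fs gs (node-injʳ eq))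

-- Every program has its own graph predicate, so that the axioms of a program can refer to its
-- subprograms. As predicate symbols of ILL1 are numbers, programs have to be coded, which is the
-- purpose of `prTree`; arities are recorded so that the coding is injective across them.
data Sym : Set where
  zeroS sucS consS posS nodeS queueS readS acceptS : Sym
  edgeS : ℕ → Sym
  evalS : ∀ n → PR n → Sym
  boundS : ∀ n → PR (suc n) → Sym

symTree : Sym → Tree
symTree zeroS = node (num 0) leaf
symTree sucS = node (num 1) leaf
symTree consS = node (num 2) leaf
symTree posS = node (num 3) leaf
symTree nodeS = node (num 4) leaf
symTree queueS = node (num 5) leaf
symTree readS = node (num 6) leaf
symTree acceptS = node (num 7) leaf
symTree (edgeS c) = node (num 8) (num c)
symTree (evalS n f) = node (num 9) (node (num n) (prTree f))
symTree (boundS n f) = node (num 10) (node (num n) (prTree f))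

symTree-inj : ∀ s t → symTree s ≡ symTree t → s ≡ t
symTree-inj zeroS zeroS eq = refl
symTree-inj sucS sucS eq = refl
symTree-inj consS consS eq = refl
symTree-inj posS posS eq = refl
symTree-inj nodeS nodeS eq = refl
symTree-inj queueS queueS eq = refl
symTree-inj readS readS eq = refl
symTree-inj acceptS acceptS eq = refl
symTree-inj (edgeS c) (edgeS d) eq = cong edgeS (num-inj (node-injʳ eq))
symTree-inj (evalS n f) (evalS m g) eq with num-inj {n} {m} (node-injˡ (node-injʳ eq))
... | refl = cong (evalS n) (prTree-inj f g (node-injʳ (node-injʳ eq)))
symTree-inj (boundS n f) (boundS m g) eq with num-inj {n} {m} (node-injˡ (node-injʳ eq))
... | refl = cong (boundS n) (prTree-inj f g (node-injʳ (node-injʳ eq)))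

-- Only injectivity of the coding is ever used; unfolding it would expose enormous numerals.
opaque
  symCode : Sym → ℕ
  symCode = τ ∘ symTree

  symCode-inj : ∀ {s t} → symCode s ≡ symCode t → s ≡ t
  symCode-inj {s} {t} eq = symTree-inj s t (τ-inj (symTree s) (symTree t) eq)

infixr 5 _◂_
_◂_ : ∀ {A : Set} {n} → A → (Fin n → A) → Fin (suc n) → A
(x ◂ xs) zero = x
(x ◂ xs) (suc i) = xs i

-- The same predicate marks the number 0 and the empty list of nodes, so that `existsZero` provides
-- both.
zeroA : ∀ {n} → Fin n → HAtom n
zeroA x = symCode zeroS , x ∷ []
sucA : ∀ {n} → Fin n → Fin n → HAtom n
sucA x y = symCode sucS , x ∷ y ∷ []
consA : ∀ {n} → Fin n → Fin n → Fin n → HAtom n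
consA v l l′ = symCode consS , v ∷ l ∷ l′ ∷ []
posA : ∀ {n} → Fin n → Fin n → Fin n → HAtom n
posA l v a = symCode posS , l ∷ v ∷ a ∷ []
nodeA : ∀ {n} → Fin n → HAtom n
nodeA v = symCode nodeS , v ∷ []
-- `queueA` and `readA` are the states of the reading process. The first accounts for the nodes of
-- the list `l`, `k` many, as consumed; the second in addition for `j` hyperedges, with `ls` the
-- code of their labels and `as` the code of their attachments.
queueA : ∀ {n} → Fin n → Fin n → HAtom n
queueA l k = symCode queueS , l ∷ k ∷ []
readA : ∀ {n} → Fin n → Fin n → Fin n → Fin n → Fin n → HAtom n
readA l k j ls as = symCode readS , l ∷ k ∷ j ∷ ls ∷ as ∷ []
edgeA : ∀ {n k} → ℕ → (Fin k → Fin n) → HAtom n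
edgeA c vs = symCode (edgeS c) , tabulate vs
acceptA : ∀ {n k} → (Fin k → Fin n) → HAtom n
acceptA xs = symCode acceptS , tabulate xs
evalA : ∀ {n k} → PR k → Fin n → (Fin k → Fin n) → HAtom n
evalA {k = k} f y xs = symCode (evalS k f) , y ∷ tabulate xs
boundA : ∀ {n k} → PR (suc k) → Fin n → (Fin k → Fin n) → HAtom n
boundA {k = k} f y xs = symCode (boundS k f) , y ∷ tabulate xs

-- Axioms describing the graph of a partial recursive function; boundA f y states that f is
-- defined and positive below y.

argsA : ∀ {n k m} → Vec (PR k) m → (Fin m → Fin n) → (Fin k → Fin n) → List (HAtom n)
argsA [] ys xs = []
argsA (g ∷ gs) ys xs = evalA g (ys zero) xs ∷ argsA gs (ys ∘ suc) xs

compAxiom : ∀ {m n} → PR m → Vec (PR n) m → Axiom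
compAxiom {m} {n} f gs = axiom (suc (m + n)) (argsA gs ys xs ++ evalA f zero ys ∷ []) (evalA (Comp f gs) zero xs)
  where
  ys : Fin m → Fin (suc (m + n))
  ys j = suc (j ↑ˡ n)
  xs : Fin n → Fin (suc (m + n))
  xs i = suc (m ↑ʳ i)

recZeroAxiom recSucAxiom : ∀ {n} → PR n → PR (suc (suc n)) → Axiom
recZeroAxiom {n} g h = axiom (2 + n) (zeroA #0 ∷ evalA g #1 xs ∷ []) (evalA (Rec g h) #1 (#0 ◂ xs))
  where
  xs : Fin n → Fin (2 + n)
  xs i = suc (suc i)
recSucAxiom {n} g h = axiom (4 + n)
  (evalA (Rec g h) #2 (#0 ◂ xs) ∷ evalA h #3 (#0 ◂ #2 ◂ xs) ∷ sucA #0 #1 ∷ []) (evalA (Rec g h) #3 (#1 ◂ xs))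
  where
  xs : Fin n → Fin (4 + n)
  xs i = suc (suc (suc (suc i)))

boundZeroAxiom boundSucAxiom muAxiom : ∀ {n} → PR (suc n) → Axiom
boundZeroAxiom {n} f = axiom (1 + n) (zeroA #0 ∷ []) (boundA f #0 suc)
boundSucAxiom {n} f = axiom (4 + n)
  -- The value `#3` of `f` at `#0` is positive, being the successor of `#2`.
  (boundA f #0 xs ∷ evalA f #3 (#0 ◂ xs) ∷ sucA #2 #3 ∷ sucA #0 #1 ∷ []) (boundA f #1 xs)
  where
  xs : Fin n → Fin (4 + n)
  xs i = suc (suc (suc (suc i)))
muAxiom {n} f = axiom (2 + n) (boundA f #0 xs ∷ zeroA #1 ∷ evalA f #1 (#0 ◂ xs) ∷ []) (evalA (Mu f) #0 xs)
  where
  xs : Fin n → Fin (2 + n)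
  xs i = suc (suc i)

zAxiom : ℕ → Axiom
zAxiom n = axiom (1 + n) (zeroA #0 ∷ []) (evalA (Z {n}) #0 suc)

sAxiom : Axiom
sAxiom = axiom 2 (sucA #0 #1 ∷ []) (evalA S #1 λ _ → #0)

pAxiom : ∀ {n} → Fin n → Axiom
pAxiom {n} i = axiom n [] (evalA (P i) i λ j → j)

prAxioms  : ∀ {n} → PR n → List Axiom
prAxioms* : ∀ {n m} → Vec (PR n) m → List Axiom
prAxioms (Z {n}) = zAxiom n ∷ []
prAxioms S = sAxiom ∷ []
prAxioms (P i) = pAxiom i ∷ []
prAxioms (Comp f gs) = compAxiom f gs ∷ prAxioms f ++ prAxioms* gs
prAxioms (Rec g h) = recZeroAxiom g h ∷ recSucAxiom g h ∷ prAxioms g ++ prAxioms h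
prAxioms (Mu f) = boundZeroAxiom f ∷ boundSucAxiom f ∷ muAxiom f ∷ prAxioms f
prAxioms* [] = []
prAxioms* (f ∷ fs) = prAxioms f ++ prAxioms* fs

-- Functions assembling the code of a hypergraph

encE : ∀ {n m} → Vec (Ex n) m → Ex n
encE [] = litE 0
encE (e ∷ es) = consE e (encE es)

evalE-enc : ∀ {n m} (es : Vec (Ex n) m) xs → evalE (encE es) xs ≡ encList (Vec.toList (evalE* es xs))
evalE-enc [] xs = refl
evalE-enc (e ∷ es) xs = cong (consℕ (evalE e xs)) (evalE-enc es xs)

labelFn : ℕ → Fn 1
labelFn c = respec (fn (consE (litE c) (var #0))) (λ { (x ∷ []) → consℕ c x })
  λ { (x ∷ []) → cong (λ k → consℕ k x) (evalE-lit c (x ∷ [])) }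

varsE : ∀ {n m} → (Fin m → Fin n) → Vec (Ex n) m
varsE f = Vec.tabulate (var ∘ f)

lookupV-tabulate : ∀ {n} (h : Fin n → ℕ) i → lookupV (Vec.tabulate h) i ≡ h i
lookupV-tabulate h zero = refl
lookupV-tabulate h (suc i) = lookupV-tabulate (h ∘ suc) i

evalE-vars : ∀ {n m} (f : Fin m → Fin n) xs (h : Fin m → ℕ) → (∀ i → lookupV xs (f i) ≡ h i) →
  Vec.toList (evalE* (varsE f) xs) ≡ tabulate h
evalE-vars {m = zero} f xs h eq = refl
evalE-vars {m = suc m} f xs h eq = cong₂ _∷_ (eq zero) (evalE-vars (f ∘ suc) xs (h ∘ suc) (eq ∘ suc))

toList-lookup : ∀ {n} (xs : Vec ℕ n) → tabulate (lookupV xs) ≡ Vec.toList xs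
toList-lookup [] = refl
toList-lookup (x ∷ xs) = cong (x ∷_) (toList-lookup xs)

attFn : ∀ k → Fn (suc k)
attFn k = respec (fn (consE (encE (varsE {suc k} suc)) (var #0))) (λ { (x ∷ as) → consℕ (encList (Vec.toList as)) x })
  λ { (x ∷ as) → cong (λ l → consℕ l x) (≡.trans (evalE-enc (varsE suc) (x ∷ as))
       (cong encList (≡.trans (evalE-vars suc (x ∷ as) (lookupV as) λ _ → refl) (toList-lookup as)))) }

graphFn : ∀ m → Fn (4 + m)
graphFn m = respec
  (fn (consE (var #0) (consE (var #1) (consE (var #2) (consE (var #3) (consE (encE exts) (litE 0)))))))
  (λ { (n ∷ j ∷ ls ∷ as ∷ bs) → encList (n ∷ j ∷ ls ∷ as ∷ encList (Vec.toList bs) ∷ []) })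
  λ { (n ∷ j ∷ ls ∷ as ∷ bs) → cong (λ l → encList (n ∷ j ∷ ls ∷ as ∷ l ∷ []))
       (≡.trans (evalE-enc exts (n ∷ j ∷ ls ∷ as ∷ bs))
         (cong encList (≡.trans (evalE-vars _ (n ∷ j ∷ ls ∷ as ∷ bs) (lookupV bs) λ _ → refl) (toList-lookup bs)))) }
  where exts = varsE {4 + m} {m} λ i → suc (suc (suc (suc i)))

-- The axioms driving the reading of a hypergraph

module Reading (T : Alphabet) (X : List Var) (f : PR 1) where

  rank : Fin (size T) → ℕ
  rank c = length (type T c)

  acceptPR : PR (4 + length X)
  acceptPR = Comp f (prog (graphFn (length X)) ∷ [])

  posZeroAxiom posSucAxiom queueZeroAxiom queueSucAxiom readZeroAxiom acceptAxiom : Axiom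
  posZeroAxiom = axiom 4 (consA #0 #1 #2 ∷ zeroA #3 ∷ []) (posA #2 #0 #3)
  posSucAxiom = axiom 6 (consA #0 #1 #2 ∷ sucA #3 #4 ∷ posA #1 #5 #3 ∷ []) (posA #2 #5 #4)
  queueZeroAxiom = axiom 2 (zeroA #0 ∷ zeroA #1 ∷ []) (queueA #0 #1)
  queueSucAxiom = axiom 5 (consA #0 #1 #2 ∷ sucA #3 #4 ∷ nodeA #0 ∷ queueA #1 #3 ∷ []) (queueA #2 #4)
  -- The empty list has code 0, so the one zero `#2` is the number of hyperedges as well as the code
  -- of both lists.
  readZeroAxiom = axiom 3 (zeroA #2 ∷ queueA #0 #1 ∷ []) (readA #0 #1 #2 #2 #2)

  module ReadSuc (c : Fin (size T)) where
    k = rank c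
    vs as : Fin k → Fin (8 + (k + k))
    vs i = 8 ↑ʳ (i ↑ˡ k)
    as i = 8 ↑ʳ (k ↑ʳ i)

  -- All nodes are consumed before the first hyperedge, so the list `#0` is final and a position in
  -- it can serve as the number of a node in the code. The variables `vs` are the attachment nodes,
  -- as they occur in the hyperedge atom, and `as` their positions; `#5`, `#6` and `#7` are the
  -- updated count and codes.
  readSucAxiom : Fin (size T) → Axiom
  readSucAxiom c = axiom (8 + (k + k))
    (tabulate (λ i → posA #0 (vs i) (as i)) ++
      sucA #2 #5 ∷ evalA (prog (labelFn (toℕ c))) #6 (λ _ → #3) ∷ evalA (prog (attFn k)) #7 (#4 ◂ as)
      ∷ edgeA (toℕ c) vs ∷ readA #0 #1 #2 #3 #4 ∷ [])
    (readA #0 #1 #5 #6 #7)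
    where open ReadSuc c

  module Accept where
    m = length X
    xs bs : Fin m → Fin (6 + (m + m))
    xs i = 6 ↑ʳ (i ↑ˡ m)
    bs i = 6 ↑ʳ (m ↑ʳ i)

  acceptAxiom = axiom (6 + (m + m))
    (tabulate (λ i → posA #0 (xs i) (bs i)) ++
      evalA acceptPR #5 (#1 ◂ #2 ◂ #3 ◂ #4 ◂ bs) ∷ readA #0 #1 #2 #3 #4 ∷ [])
    (acceptA xs)
    where open Accept

  labelAxioms : Fin (size T) → List Axiom
  labelAxioms c = readSucAxiom c ∷ prAxioms (prog (labelFn (toℕ c))) ++ prAxioms (prog (attFn (rank c)))

  axioms : List Axiom
  axioms = posZeroAxiom ∷ posSucAxiom ∷ queueZeroAxiom ∷ queueSucAxiom ∷ readZeroAxiom ∷ acceptAxiom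
    ∷ prAxioms acceptPR ++ List.concat (tabulate labelAxioms)

  existsZero existsSuc existsCons : Fm 0
  existsZero = ∃' (! atom (symCode zeroS) (bv #0 ∷ []))
  existsSuc = ∀' (∃' (! atom (symCode sucS) (bv #1 ∷ bv #0 ∷ [])))
  existsCons = ∀' (∀' (∃' (! atom (symCode consS) (bv #2 ∷ bv #1 ∷ bv #0 ∷ []))))

  theory : Ctx
  theory = existsZero ∷ existsSuc ∷ existsCons ∷ map axiomFm axioms

  -- An element of the domain is used both as a number and as a list of nodes.
  D : Set
  D = ℕ × List ℕ

  val : D → ℕ
  val = proj₁

  nodes : D → List ℕ
  nodes = proj₂

  data Tok : Set where
    node : ℕ → Tok
    edge : Fin (size T) → List ℕ → Tok

  data At : List ℕ → ℕ → ℕ → Set where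
    here  : ∀ {v l} → At (v ∷ l) 0 v
    there : ∀ {v w l a} → At l a v → At (w ∷ l) (suc a) v

  -- A hyperedge read so far, with the positions of its attachment nodes in the list l
  record Item (l : List ℕ) : Set where
    constructor item
    field
      label     : Fin (size T)
      attached  : Fin (rank label) → ℕ
      positions : Fin (rank label) → ℕ
      at        : ∀ i → At l (positions i) (attached i)
  open Item public

  tok : ∀ {l} → Item l → Tok
  tok e = edge (label e) (tabulate (attached e))

  toks : (l : List ℕ) → List (Item l) → List Tok
  toks l es = map node l ++ map tok es

  labCode posCode : ∀ {l} → List (Item l) → ℕ
  labCode = encList ∘ map (toℕ ∘ label)
  posCode = encList ∘ map (λ e → encList (tabulate (positions e)))

  record Accepted (xs : List ℕ) (r : List Tok) : Set where
    field
      order    : List ℕ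
      items    : List (Item order)
      tokens   : r ↭ toks order items
      extPos   : Fin (length X) → ℕ
      extNode  : Fin (length X) → ℕ
      extAt    : ∀ i → At order (extPos i) (extNode i)
      extNode≡ : xs ≡ tabulate extNode
      halts    : ∃ λ y → f [ encList (length order ∷ length items ∷ labCode items ∷ posCode items
                              ∷ encList (tabulate extPos) ∷ []) ∷ [] ]↓ y

  -- The predicates about numbers, lists and programs own no tokens, as is necessary for the facts
  -- that stand under `!`. They speak of an element only through `val` or `nodes`, so the same
  -- number may have many names without harm.
  Mean : Sym → List D → List Tok → Set
  Mean zeroS (d ∷ []) r = r ≡ [] × val d ≡ 0 × nodes d ≡ []
  Mean sucS (d ∷ e ∷ []) r = r ≡ [] × val e ≡ suc (val d)
  Mean consS (v ∷ l ∷ l′ ∷ []) r = r ≡ [] × nodes l′ ≡ val v ∷ nodes l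
  Mean posS (l ∷ v ∷ a ∷ []) r = r ≡ [] × At (nodes l) (val a) (val v)
  Mean nodeS (v ∷ []) r = r ≡ node (val v) ∷ []
  Mean queueS (l ∷ n ∷ []) r = r ↭ map node (nodes l) × val n ≡ length (nodes l)
  Mean readS (l ∷ n ∷ j ∷ ls ∷ as ∷ []) r = Σ[ es ∈ List (Item (nodes l)) ] r ↭ toks (nodes l) es ×
    val n ≡ length (nodes l) × val j ≡ length es × val ls ≡ labCode es × val as ≡ posCode es
  Mean acceptS ds r = Accepted (map val ds) r
  Mean (edgeS k) ds r = Σ[ c ∈ Fin (size T) ] toℕ c ≡ k × r ≡ edge c (map val ds) ∷ []
  Mean (evalS n g) ds r = r ≡ [] × Σ[ y ∈ ℕ ] Σ[ xs ∈ Vec ℕ n ] map val ds ≡ y ∷ Vec.toList xs × g [ xs ]↓ y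
  Mean (boundS n g) ds r = r ≡ [] × Σ[ y ∈ ℕ ] Σ[ xs ∈ Vec ℕ n ] map val ds ≡ y ∷ Vec.toList xs ×
    (∀ z → z < y → ∃ λ w → g [ z ∷ xs ]↓ suc w)
  Mean _ _ _ = ⊥

  []-resp : ∀ {r r′ : List Tok} → r ↭ r′ → r ≡ [] → r′ ≡ []
  []-resp p refl = ↭-empty-inv (↭-sym p)

  [-]-resp : ∀ {r r′ : List Tok} {t} → r ↭ r′ → r ≡ t ∷ [] → r′ ≡ t ∷ []
  [-]-resp p refl = ↭-singleton-inv (↭-sym p)

  Mean-resp : ∀ s ds {r r′} → r ↭ r′ → Mean s ds r → Mean s ds r′
  Mean-resp zeroS (_ ∷ []) p (eq , m) = []-resp p eq , m
  Mean-resp sucS (_ ∷ _ ∷ []) p (eq , m) = []-resp p eq , m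
  Mean-resp consS (_ ∷ _ ∷ _ ∷ []) p (eq , m) = []-resp p eq , m
  Mean-resp posS (_ ∷ _ ∷ _ ∷ []) p (eq , m) = []-resp p eq , m
  Mean-resp nodeS (_ ∷ []) p eq = [-]-resp p eq
  Mean-resp queueS (_ ∷ _ ∷ []) p (q , m) = ↭-trans (↭-sym p) q , m
  Mean-resp readS (_ ∷ _ ∷ _ ∷ _ ∷ _ ∷ []) p (es , q , m) = es , ↭-trans (↭-sym p) q , m
  Mean-resp acceptS ds p a = record { Accepted a ; tokens = ↭-trans (↭-sym p) (Accepted.tokens a) }
  Mean-resp (edgeS k) ds p (c , eq , eq′) = c , eq , [-]-resp p eq′
  Mean-resp (evalS n g) ds p (eq , m) = []-resp p eq , m
  Mean-resp (boundS n g) ds p (eq , m) = []-resp p eq , m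

  I : ℕ → List D → List Tok → Set
  I p ds r = Σ[ s ∈ Sym ] symCode s ≡ p × Mean s ds r

  I-resp : ∀ {p ds r r′} → r ↭ r′ → I p ds r → I p ds r′
  I-resp {ds = ds} p (s , eq , m) = s , eq , Mean-resp s ds p m

  meaning : ∀ s {ds r} → I (symCode s) ds r → Mean s ds r
  meaning s (s′ , eq , m) with symCode-inj eq
  ... | refl = m

  means : ∀ s {ds r} → Mean s ds r → I (symCode s) ds r
  means s m = s , refl , m

-- Truth of the theory in the resource semantics

toList-tabulate : ∀ {n} (h : Fin n → ℕ) → Vec.toList (Vec.tabulate h) ≡ tabulate h
toList-tabulate {zero} h = refl
toList-tabulate {suc n} h = cong (h zero ∷_) (toList-tabulate (h ∘ suc))

tabulate-toList : ∀ {n} (xs : Vec ℕ n) (h : Fin n → ℕ) → tabulate h ≡ Vec.toList xs → xs ≡ Vec.tabulate h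
tabulate-toList [] h eq = refl
tabulate-toList (x ∷ xs) h eq = cong₂ _∷_ (sym (proj₁ (∷-injective eq))) (tabulate-toList xs (h ∘ suc) (proj₂ (∷-injective eq)))

module Validity (T : Alphabet) (X : List Var) (f : PR 1) where
  open Reading T X f
  open HornValid I (λ {p} {ds} → I-resp {p} {ds}) public
  open Semantics I (λ {p} {ds} → I-resp {p} {ds}) public

  module _ {n} (δ : Fin n → D) where

    args : ∀ {k} → (Fin k → Fin n) → Vec ℕ k
    args xs = Vec.tabulate (val ∘ δ ∘ xs)

    vals : ∀ {k} (xs : Fin k → Fin n) → map val (map δ (tabulate xs)) ≡ tabulate (val ∘ δ ∘ xs)
    vals xs = ≡.trans (cong (map val) (map-tabulate xs δ)) (map-tabulate (δ ∘ xs) val)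

    vals-args : ∀ {k} (xs : Fin k → Fin n) → map val (map δ (tabulate xs)) ≡ Vec.toList (args xs)
    vals-args xs = ≡.trans (vals xs) (sym (toList-tabulate (val ∘ δ ∘ xs)))

    fromVals : ∀ {k} (xs : Fin k → Fin n) (ys : Vec ℕ k) → map val (map δ (tabulate xs)) ≡ Vec.toList ys → ys ≡ args xs
    fromVals xs ys eq = tabulate-toList ys _ (≡.trans (sym (vals xs)) eq)

    eval-intro : ∀ {k} (g : PR k) y xs → g [ args xs ]↓ val (δ y) → I (symCode (evalS k g)) (map δ (y ∷ tabulate xs)) []
    eval-intro g y xs d = means (evalS _ g) (refl , _ , _ , cong (val (δ y) ∷_) (vals-args xs) , d)

    eval-elim : ∀ {k} (g : PR k) y xs {r} → I (symCode (evalS k g)) (map δ (y ∷ tabulate xs)) r → r ≡ [] × g [ args xs ]↓ val (δ y)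
    eval-elim {k} g y xs i with meaning (evalS k g) i
    ... | eq , _ , ys , eqs , d with ∷-injective eqs
    ... | refl , eqs′ with fromVals xs ys eqs′
    ... | refl = eq , d

    bound-intro : ∀ {k} (g : PR (suc k)) y xs → (∀ z → z < val (δ y) → ∃ λ w → g [ z ∷ args xs ]↓ suc w) →
      I (symCode (boundS k g)) (map δ (y ∷ tabulate xs)) []
    bound-intro g y xs d = means (boundS _ g) (refl , _ , _ , cong (val (δ y) ∷_) (vals-args xs) , d)

    bound-elim : ∀ {k} (g : PR (suc k)) y xs {r} → I (symCode (boundS k g)) (map δ (y ∷ tabulate xs)) r →
      r ≡ [] × (∀ z → z < val (δ y) → ∃ λ w → g [ z ∷ args xs ]↓ suc w)
    bound-elim {k} g y xs i with meaning (boundS k g) i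
    ... | eq , _ , ys , eqs , d with ∷-injective eqs
    ... | refl , eqs′ with fromVals xs ys eqs′
    ... | refl = eq , d

    -- The number of premises depends on an arity, so the rest of the axiom is treated by a
    -- continuation that receives what these premises say. They own no tokens, whence the multiset
    -- is still empty afterwards.
    Holds-args : ∀ {k m} (gs : Vec (PR k) m) ys xs {bs h} → (gs [ args xs ]↓* args ys → Holds δ bs h []) →
      Holds δ (argsA gs ys xs ++ bs) h []
    Holds-args [] ys xs cont = cont e[]
    Holds-args (g ∷ gs) ys xs cont r i with eval-elim g (ys zero) xs i
    ... | refl , d = Holds-args gs (ys ∘ suc) xs (cont ∘ e∷ d)

    Holds-pos : ∀ {k} l (vs as : Fin k → Fin n) {bs h} →
      ((∀ i → At (nodes (δ l)) (val (δ (as i))) (val (δ (vs i)))) → Holds δ bs h []) →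
      Holds δ (tabulate (λ i → posA l (vs i) (as i)) ++ bs) h []
    Holds-pos {zero} l vs as cont = cont λ ()
    Holds-pos {suc k} l vs as cont r i with meaning posS i
    ... | refl , at = Holds-pos l (vs ∘ suc) (as ∘ suc) λ ats → cont λ { zero → at ; (suc i) → ats i }

  ↓-subst : ∀ {n} {g : PR n} {xs y z} → z ≡ y → g [ xs ]↓ y → g [ xs ]↓ z
  ↓-subst refl d = d

  arg-subst : ∀ {n} {g : PR (suc n)} {xs y u v} → u ≡ v → g [ v ∷ xs ]↓ y → g [ u ∷ xs ]↓ y
  arg-subst refl d = d

  prValid  : ∀ {n} (g : PR n) → All Valid (prAxioms g)
  prValid* : ∀ {n m} (gs : Vec (PR n) m) → All Valid (prAxioms* gs)
  prValid Z = z ∷ []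
    where
    z : Valid (zAxiom _)
    z δ r i with meaning zeroS i
    ... | refl , eq , _ = eval-intro δ Z #0 suc (↓-subst eq eZ)
  prValid S = s ∷ []
    where
    s : Valid sAxiom
    s δ r i with meaning sucS i
    ... | refl , eq = eval-intro δ S #1 (λ _ → #0) (↓-subst eq eS)
  prValid (P i) = p ∷ []
    where
    p : Valid (pAxiom i)
    p δ = eval-intro δ (P i) i (λ j → j) (↓-subst (sym (lookupV-tabulate (val ∘ δ) i)) (eP i))
  prValid (Comp {m} {n} g gs) = c ∷ AllP.++⁺ (prValid g) (prValid* gs)
    where
    ys : Fin m → Fin (suc (m + n))
    ys j = suc (j ↑ˡ n)
    xs : Fin n → Fin (suc (m + n))
    xs i = suc (m ↑ʳ i)
    c : Valid (compAxiom g gs)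
    c δ = Holds-args δ gs ys xs λ ds r i → fin ds (eval-elim δ g #0 ys i)
      where
      fin : ∀ {r} → gs [ args δ xs ]↓* args δ ys → r ≡ [] × g [ args δ ys ]↓ val (δ #0) →
        I (symCode (evalS n (Comp g gs))) (map δ (#0 ∷ tabulate xs)) (r ++ [])
      fin ds (refl , d) = eval-intro δ (Comp g gs) #0 xs (eComp ds d)
  prValid (Rec g h) = zr ∷ sc ∷ AllP.++⁺ (prValid g) (prValid h)
    where
    zr : Valid (recZeroAxiom g h)
    zr δ r i r′ i′ with meaning zeroS i | eval-elim δ g #1 (λ i → suc (suc i)) i′
    ... | refl , eq , _ | refl , d = eval-intro δ (Rec g h) #1 (#0 ◂ λ i → suc (suc i)) (arg-subst eq (eRec0 d))
    xs : ∀ {n} → Fin n → Fin (4 + n)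
    xs i = suc (suc (suc (suc i)))
    sc : Valid (recSucAxiom g h)
    sc δ r i r′ i′ r″ i″ with eval-elim δ (Rec g h) #2 (#0 ◂ xs) i | eval-elim δ h #3 (#0 ◂ #2 ◂ xs) i′ | meaning sucS i″
    ... | refl , d | refl , d′ | refl , eq = eval-intro δ (Rec g h) #3 (#1 ◂ xs) (arg-subst eq (eRecS d d′))
  prValid (Mu {n} g) = zr ∷ sc ∷ mu ∷ prValid g
    where
    zr : Valid (boundZeroAxiom g)
    zr δ r i with meaning zeroS i
    ... | refl , eq , _ = bound-intro δ g #0 suc λ z z< → contra z (subst (z <_) eq z<)
      where
      contra : ∀ z {V : Set} → z < 0 → V
      contra z ()
    xs : Fin n → Fin (4 + n)
    xs i = suc (suc (suc (suc i)))
    sc : Valid (boundSucAxiom g)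
    sc δ r i r′ i′ r″ i″ r‴ i‴ with bound-elim δ g #0 xs i | eval-elim δ g #3 (#0 ◂ xs) i′ | meaning sucS i″ | meaning sucS i‴
    ... | refl , ds | refl , d | refl , eq | refl , eq′ = bound-intro δ g #1 xs λ z z< →
      go z (m≤n⇒m<n∨m≡n (≤-pred (subst (z <_) eq′ z<)))
      where
      go : ∀ z → z < val (δ #0) ⊎ z ≡ val (δ #0) → ∃ λ w → g [ z ∷ args δ xs ]↓ suc w
      go z (inj₁ z<) = ds z z<
      go z (inj₂ eq″) = val (δ #2) , ↓-subst (sym eq) (arg-subst eq″ d)
    mu : Valid (muAxiom g)
    mu δ r i r′ i′ r″ i″ with bound-elim δ g #0 (λ i → suc (suc i)) i | meaning zeroS i′ | eval-elim δ g #1 (#0 ◂ λ i → suc (suc i)) i″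
    ... | refl , ds | refl , eq , _ | refl , d = eval-intro δ (Mu g) #0 (λ i → suc (suc i)) (eMu (↓-subst (sym eq) d) ds)
  prValid* [] = []
  prValid* (g ∷ gs) = AllP.++⁺ (prValid g) (prValid* gs)

  posZeroValid : Valid posZeroAxiom
  posZeroValid δ r i r′ i′ with meaning consS i | meaning zeroS i′
  ... | refl , eq | refl , eq′ , _ = means posS (refl , ≡.subst₂ (λ l a → At l a (val (δ #0))) (sym eq) (sym eq′) here)

  posSucValid : Valid posSucAxiom
  posSucValid δ r i r′ i′ r″ i″ with meaning consS i | meaning sucS i′ | meaning posS i″
  ... | refl , eq | refl , eq′ | refl , at = means posS (refl , ≡.subst₂ (λ l a → At l a (val (δ #5))) (sym eq) (sym eq′) (there at))

  queueZeroValid : Valid queueZeroAxiom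
  queueZeroValid δ r i r′ i′ with meaning zeroS i | meaning zeroS i′
  ... | refl , _ , eq | refl , eq′ , _ = means queueS (↭-reflexive (cong (map node) (sym eq)) , ≡.trans eq′ (cong length (sym eq)))

  queueSucValid : Valid queueSucAxiom
  queueSucValid δ r i r′ i′ r″ i″ r‴ i‴ with meaning consS i | meaning sucS i′ | meaning nodeS i″ | meaning queueS i‴
  ... | refl , eq | refl , eq′ | refl | p , eq″ = means queueS
    ( ↭-trans (++-comm r‴ _) (↭-trans (prep _ p) (↭-reflexive (cong (map node) (sym eq))))
    , ≡.trans eq′ (≡.trans (cong suc eq″) (cong length (sym eq))))

  readZeroValid : Valid readZeroAxiom
  readZeroValid δ r i r′ i′ with meaning zeroS i | meaning queueS i′
  ... | refl , eq , eq′ | p , eq″ = means readS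
    ([] , ↭-trans (↭-reflexive (++-identityʳ r′)) (↭-trans p (↭-reflexive (sym (++-identityʳ _)))) , eq″ , eq , eq , eq)

  readSucValid : ∀ c → Valid (readSucAxiom c)
  readSucValid c δ = Holds-pos δ #0 vs as λ ats r₁ i₁ r₂ i₂ r₃ i₃ r₄ i₄ r₅ i₅ →
      fin ats (meaning sucS i₁) (eval-elim δ (prog (labelFn (toℕ c))) #6 (λ _ → #3) i₂)
        (eval-elim δ (prog (attFn k)) #7 (#4 ◂ as) i₃) (meaning (edgeS (toℕ c)) i₄) (meaning readS i₅)
    where
    open ReadSuc c
    fin : ∀ {r₁ r₂ r₃ r₄ r₅} → (∀ i → At (nodes (δ #0)) (val (δ (as i))) (val (δ (vs i)))) →
      r₁ ≡ [] × val (δ #5) ≡ suc (val (δ #2)) →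
      r₂ ≡ [] × prog (labelFn (toℕ c)) [ val (δ #3) ∷ [] ]↓ val (δ #6) →
      r₃ ≡ [] × prog (attFn k) [ val (δ #4) ∷ args δ as ]↓ val (δ #7) →
      Mean (edgeS (toℕ c)) (map δ (tabulate vs)) r₄ →
      Mean readS (δ #0 ∷ δ #1 ∷ δ #2 ∷ δ #3 ∷ δ #4 ∷ []) r₅ →
      I (symCode readS) (δ #0 ∷ δ #1 ∷ δ #5 ∷ δ #6 ∷ δ #7 ∷ []) (r₅ ++ r₄ ++ r₃ ++ r₂ ++ r₁ ++ [])
    fin {r₅ = r₅} ats (refl , eq₁) (refl , d₂) (refl , d₃) (c′ , eq₄ , refl) (es , p , eqn , eqj , eql , eqa)
      with toℕ-injective {i = c′} {c} eq₄
    ... | refl = means readS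
      ( item c (val ∘ δ ∘ vs) (val ∘ δ ∘ as) ats ∷ es
      , ↭-trans (++-comm r₅ _) (↭-trans (prep _ p)
          (↭-trans (↭-sym (shift _ (map node (nodes (δ #0))) (map tok es)))
            (↭-reflexive (cong (λ ws → map node (nodes (δ #0)) ++ edge c ws ∷ map tok es) (vals δ vs)))))
      , eqn , ≡.trans eq₁ (cong suc eqj)
      -- The premise says only that the program evaluates to the element named `#6`; determinism
      -- identifies its number with the intended code.
      , ≡.trans (↓-det (prog (labelFn (toℕ c))) d₂ (computes (labelFn (toℕ c)) (val (δ #3) ∷ []))) (cong (consℕ (toℕ c)) eql)
      , ≡.trans (↓-det (prog (attFn k)) d₃ (computes (attFn k) (val (δ #4) ∷ args δ as)))
          (cong₂ consℕ (cong encList (toList-tabulate (val ∘ δ ∘ as))) eqa))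

  acceptValid : Valid acceptAxiom
  acceptValid δ = Holds-pos δ #0 xs bs λ ats r₁ i₁ r₂ i₂ →
      fin ats (eval-elim δ acceptPR #5 (#1 ◂ #2 ◂ #3 ◂ #4 ◂ bs) i₁) (meaning readS i₂)
    where
    open Accept
    fin : ∀ {r₁ r₂} → (∀ i → At (nodes (δ #0)) (val (δ (bs i))) (val (δ (xs i)))) →
      r₁ ≡ [] × acceptPR [ val (δ #1) ∷ val (δ #2) ∷ val (δ #3) ∷ val (δ #4) ∷ args δ bs ]↓ val (δ #5) →
      Mean readS (δ #0 ∷ δ #1 ∷ δ #2 ∷ δ #3 ∷ δ #4 ∷ []) r₂ →
      I (symCode acceptS) (map δ (tabulate xs)) (r₂ ++ r₁ ++ [])
    fin {r₂ = r₂} ats (refl , eComp (e∷ d e[]) d′) (es , p , eqn , eqj , eql , eqa) = means acceptS record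
      { order = nodes (δ #0) ; items = es ; tokens = ↭-trans (↭-reflexive (++-identityʳ r₂)) p
      ; extPos = val ∘ δ ∘ bs ; extNode = val ∘ δ ∘ xs ; extAt = ats ; extNode≡ = vals δ xs
      ; halts = val (δ #5) , subst (λ n → f [ n ∷ [] ]↓ val (δ #5))
          (≡.trans (↓-det (prog (graphFn m)) d (computes (graphFn m) _)) (code eqn eqj eql eqa (toList-tabulate (val ∘ δ ∘ bs)))) d′ }
      where
      code : ∀ {n n′ j j′ l l′ a a′ b b′} → n ≡ n′ → j ≡ j′ → l ≡ l′ → a ≡ a′ → b ≡ b′ →
        encList (n ∷ j ∷ l ∷ a ∷ encList b ∷ []) ≡ encList (n′ ∷ j′ ∷ l′ ∷ a′ ∷ encList b′ ∷ [])
      code refl refl refl refl refl = refl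

  axiomsValid : All Valid axioms
  axiomsValid = posZeroValid ∷ posSucValid ∷ queueZeroValid ∷ queueSucValid ∷ readZeroValid ∷ acceptValid
    ∷ AllP.++⁺ (prValid acceptPR) (AllP.concat⁺ (AllP.tabulate⁺ λ c →
        readSucValid c ∷ AllP.++⁺ (prValid (prog (labelFn (toℕ c)))) (prValid (prog (attFn (rank c))))))

  theoryTrue : ∀ {ρ} → All (λ A → Sem₀ A ρ []) theory
  theoryTrue
    -- The first witness is both the number 0 and the empty list. In the other two, the component
    -- about which the axiom is silent is chosen arbitrarily.
    = ((0 , []) , refl , means zeroS (refl , refl , refl))
    ∷ (λ d → (suc (val d) , []) , refl , means sucS (refl , refl))
    ∷ (λ d e → (0 , val d ∷ nodes e) , refl , means consS (refl , refl))
    ∷ AllP.map⁺ (All.map (λ {a} v → Valid-sound a v) axiomsValid)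

-- Parallel hyperedges produce equal entries, so the values do not determine a bijection of the
-- indices; it is taken from the derivation of the permutation.
tabulate-↭ : ∀ {A : Set} {n m} (g : Fin n → A) (h : Fin m → A) → tabulate g ↭ tabulate h →
  Σ[ π ∈ Fin n ↔ Fin m ] ∀ i → h (Inverse.to π i) ≡ g i
tabulate-↭ {A} g h p = π , λ i →
  ≡.trans (sym (lookup-tab h (Inverse.to ι (cast (sym (length-tabulate g)) i))))
    (≡.trans (sym (PermProp.onIndices-lookup (setoid A) (↭⇒↭ₛ p) (cast (sym (length-tabulate g)) i))) (lookup-tabulate g i))
  where
  ι = onIndices (↭⇒↭ₛ p)
  π = cast-id (sym (length-tabulate g)) ∘ₚ (ι ∘ₚ cast-id (length-tabulate h))
  lookup-tab : ∀ {k} (h : Fin k → A) j → lookup (tabulate h) j ≡ h (cast (length-tabulate h) j)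
  lookup-tab {suc k} h zero = refl
  lookup-tab {suc k} h (suc j) = lookup-tab (h ∘ suc) j

tabulate-≡ : ∀ {A : Set} {n m} (g : Fin n → A) (h : Fin m → A) → tabulate g ≡ tabulate h → .(eq : n ≡ m) →
  ∀ i → g i ≡ h (cast eq i)
tabulate-≡ {m = suc m} g h tabs eq zero = proj₁ (∷-injective tabs)
tabulate-≡ {m = suc m} g h tabs eq (suc i) = tabulate-≡ (g ∘ suc) (h ∘ suc) (proj₂ (∷-injective tabs)) _ i

tabulate-≗ : ∀ {A : Set} {n} (g h : Fin n → A) → tabulate g ≡ tabulate h → ∀ i → g i ≡ h i
tabulate-≗ g h eq i = ≡.trans (tabulate-≡ g h eq refl i) (cong h (cast-is-id refl i))

untabulate : ∀ {A : Set} (xs : List A) n → n ≡ length xs → Σ[ h ∈ (Fin n → A) ] xs ≡ tabulate h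
untabulate xs n refl = lookup xs , sym (tabulate-lookup xs)

∷⁵-injective : ∀ {a b c d e a′ b′ c′ d′ e′ : ℕ} →
  _≡_ {A = List ℕ} (a ∷ b ∷ c ∷ d ∷ e ∷ []) (a′ ∷ b′ ∷ c′ ∷ d′ ∷ e′ ∷ []) →
  a ≡ a′ × b ≡ b′ × c ≡ c′ × d ≡ d′ × e ≡ e′
∷⁵-injective refl = refl , refl , refl , refl , refl

selSub-head : ∀ σ l h → selSub (σ ∷ l) h σ ≡ h zero
selSub-head σ l h with σ ≟ σ
... | yes _ = refl
... | no σ≢σ = contradiction refl σ≢σ

selSub-tail : ∀ σ l h x → σ ≢ x → selSub (σ ∷ l) h x ≡ selSub l (h ∘ suc) x
selSub-tail σ l h x σ≢x with x ≟ σ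
... | yes x≡σ = contradiction (sym x≡σ) σ≢x
... | no _ = refl

-- Uniqueness of the selectors enters here: for a repeated one, `selSub` would return the value at
-- its first occurrence each time.
map-selSub : ∀ l h → Unique l → map (selSub l h) l ≡ tabulate h
map-selSub [] h [] = refl
map-selSub (σ ∷ l) h (σ∉l ∷ u) = cong₂ _∷_ (selSub-head σ l h)
  (≡.trans (map-≡ l (All.map (selSub-tail σ l h _) σ∉l)) (map-selSub l (h ∘ suc) u))
  where
  map-≡ : ∀ {f g : Var → Var} xs → All (λ x → f x ≡ g x) xs → map f xs ≡ map g xs
  map-≡ [] [] = refl
  map-≡ (x ∷ xs) (eq ∷ eqs) = cong₂ _∷_ eq (map-≡ xs eqs)

ren-selSub : ∀ p l h → Unique l →
  ren (selSub l h) (atom {0} p (map fv l)) ≡ atom p (tabulate (fv ∘ h))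
ren-selSub p l h u = cong (atom p) (≡.trans (sym (map-∘ l)) (≡.trans (map-∘ l)
  (≡.trans (cong (map fv) (map-selSub l h u)) (map-tabulate h fv))))

FV-fv : ∀ l → concatMap fvT (map (fv {0}) l) ≡ l
FV-fv [] = refl
FV-fv (x ∷ l) = cong (x ∷_) (FV-fv l)

all-self : ∀ (l : List Var) → All (_∈ l) l
all-self l = All.tabulate λ x∈ → x∈

-- The grammar of a partial recursive function, and its soundness

module Universal (x• : Var) (T : Alphabet) (X : List Var) (X-unique : Unique X) (f : PR 1) where
  open Reading T X f
  open Validity T X f

  nodeRule : Fm 0
  nodeRule = atom (symCode nodeS) (fv x• ∷ [])

  edgeRule : Fin (size T) → Fm 0
  edgeRule c = atom (symCode (edgeS (toℕ c))) (map fv (type T c))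

  acceptFm : ∀ {k} → (Fin k → Var) → Fm 0
  acceptFm xs = atom (symCode acceptS) (tabulate (fv ∘ xs))

  theoryClosed : All (λ A → FV A ≡ []) theory
  theoryClosed = refl ∷ refl ∷ refl ∷ AllP.map⁺ (All.universal FV-axiomFm axioms)

  theoryRigid : ∀ h → All (λ A → ren h A ≡ A) theory
  theoryRigid h = refl ∷ refl ∷ refl ∷ AllP.map⁺ (All.universal (ren-axiomFm h) axioms)

  grammar : Grammar x• T X
  grammar = record
    { rules = (nothing , nodeRule) ∷ tabulate (λ c → just c , edgeRule c)
    ; rules-ok = (refl ∷ []) ∷ AllP.tabulate⁺ λ c → subst (All (_∈ type T c)) (sym (FV-fv (type T c))) (all-self (type T c))
    ; start = impls theory (atom (symCode acceptS) (map fv X))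
    ; start-ok = subst (All (_∈ X)) (sym (≡.trans (FV-impls theory _ theoryClosed) (FV-fv X))) (all-self X)
    }

  ren-start : ∀ h → ren (selSub X h) (start grammar) ≡ impls theory (acceptFm h)
  ren-start h = ≡.trans (ren-impls (selSub X h) theory _ (theoryRigid (selSub X h)))
    (cong (impls theory) (ren-selSub (symCode acceptS) X h X-unique))

  edgeFm : (H : HG T X) → Fin (nE H) → Fm 0
  edgeFm H e = atom (symCode (edgeS (toℕ (lab H e)))) (tabulate (fv ∘ toℕ ∘ att H e))

  nodeFm : ℕ → Fm 0
  nodeFm v = atom (symCode nodeS) (fv v ∷ [])

  ren-nodeRule : ∀ v → ren (pointSub x• v) nodeRule ≡ nodeFm v
  ren-nodeRule v with x• ≟ x•
  ... | yes _ = refl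
  ... | no x≢x = contradiction refl x≢x

  ren-edgeRule : ∀ H e → ren (selSub (type T (lab H e)) (toℕ ∘ att H e)) (edgeRule (lab H e)) ≡ edgeFm H e
  ren-edgeRule H e = ren-selSub _ (type T (lab H e)) (toℕ ∘ att H e) (type-unique T (lab H e))

  -- Nodes and each label have exactly one rule, so membership in the language leaves no choice of
  -- formulas and amounts to a single sequent.
  nodeRule-only : ∀ {A} → (nothing , A) ∈ rules grammar → A ≡ nodeRule
  nodeRule-only (here refl) = refl
  nodeRule-only (there m) with ∈-tabulate⁻ m
  ... | _ , ()

  edgeRule-only : ∀ {c A} → (just c , A) ∈ rules grammar → A ≡ edgeRule c
  edgeRule-only (there m) with ∈-tabulate⁻ m
  ... | _ , refl = refl

  graphCtx : HG T X → Ctx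
  graphCtx H = tabulate (edgeFm H) ++ tabulate (nodeFm ∘ toℕ {nV H})

  InL⇒⊢ : ∀ H → InL grammar H → graphCtx H ⊢ impls theory (acceptFm (toℕ ∘ ext H))
  InL⇒⊢ H (hV , hE , okV , okE , d) = ≡.subst₂ _⊢_
    (cong₂ _++_
      (tabulate-cong λ e → ≡.trans (cong (ren _) (edgeRule-only (okE e))) (ren-edgeRule H e))
      (tabulate-cong λ v → ≡.trans (cong (ren _) (nodeRule-only (okV v))) (ren-nodeRule (toℕ v))))
    (ren-start (toℕ ∘ ext H)) d

  graphToks : HG T X → List Tok
  graphToks H = tabulate (λ e → edge (lab H e) (tabulate (toℕ ∘ att H e))) ++ tabulate (node ∘ toℕ {nV H})

  -- A node variable denotes itself as a number, so that distinct nodes stay distinct and the tokens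
  -- record the hypergraph faithfully.
  nameEnv : Var → D
  nameEnv x = x , []

  tm-vars : ∀ {k} (xs : Fin k → Var) → map val (map (tm {0} nameEnv (λ ())) (tabulate (fv ∘ xs))) ≡ tabulate xs
  tm-vars xs = ≡.trans (cong (map val) (map-tabulate (fv ∘ xs) (tm {0} nameEnv λ ()))) (map-tabulate (λ i → nameEnv (xs i)) val)

  SemC-tabulate : ∀ {n} (F : Fin n → Fm 0) (t : Fin n → Tok) → (∀ i → Sem₀ (F i) nameEnv (t i ∷ [])) →
    SemC (tabulate F) nameEnv (tabulate t)
  SemC-tabulate {zero} F t s = refl
  SemC-tabulate {suc n} F t s = t zero ∷ [] , tabulate (t ∘ suc) , ↭-refl , s zero , SemC-tabulate (F ∘ suc) (t ∘ suc) (s ∘ suc)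

  graph-sem : ∀ H → SemC (graphCtx H) nameEnv (graphToks H)
  graph-sem H = joinC (tabulate (edgeFm H))
    (SemC-tabulate _ _ λ e → means (edgeS _) (lab H e , refl ,
      cong (λ ws → edge (lab H e) ws ∷ []) (sym (tm-vars (toℕ ∘ att H e)))))
    (SemC-tabulate _ _ λ v → means nodeS refl)

  InL⇒Accepted : ∀ H → InL grammar H → Accepted (tabulate (toℕ ∘ ext H)) (graphToks H)
  InL⇒Accepted H H∈ = subst (λ xs → Accepted xs (graphToks H)) (tm-vars (toℕ ∘ ext H))
    (meaning acceptS (Sem-impls theory theoryTrue (sound (InL⇒⊢ H H∈) (graph-sem H))))

  -- These partial functions split a permutation of tokens into one of the nodes and one of the
  -- hyperedges, by way of `mapMaybe-↭`.
  nodeOf : Tok → Maybe ℕ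
  nodeOf (node v) = just v
  nodeOf (edge _ _) = nothing

  edgeOf : Tok → Maybe (Fin (size T) × List ℕ)
  edgeOf (node v) = nothing
  edgeOf (edge c vs) = just (c , vs)

  module _ {B : Set} (p : Tok → Maybe B) where

    pick-all : ∀ {n} (t : Fin n → Tok) (b : Fin n → B) → (∀ i → p (t i) ≡ just (b i)) → mapMaybe p (tabulate t) ≡ tabulate b
    pick-all {zero} t b eq = refl
    pick-all {suc n} t b eq rewrite eq zero = cong (b zero ∷_) (pick-all (t ∘ suc) (b ∘ suc) (eq ∘ suc))

    pick-none : ∀ {n} (t : Fin n → Tok) → (∀ i → p (t i) ≡ nothing) → mapMaybe p (tabulate t) ≡ []
    pick-none {zero} t eq = refl
    pick-none {suc n} t eq rewrite eq zero = pick-none (t ∘ suc) (eq ∘ suc)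

  nodes-graphToks : ∀ H → mapMaybe nodeOf (graphToks H) ≡ tabulate (toℕ {nV H})
  nodes-graphToks H = ≡.trans (mapMaybe-++ nodeOf (tabulate {n = nE H} _) _)
    (cong₂ _++_ (pick-none nodeOf {nE H} _ λ _ → refl) (pick-all nodeOf {nV H} _ toℕ λ _ → refl))

  edges-graphToks : ∀ H → mapMaybe edgeOf (graphToks H) ≡ tabulate (λ e → lab H e , tabulate (toℕ ∘ att H e))
  edges-graphToks H = ≡.trans (mapMaybe-++ edgeOf (tabulate {n = nE H} _) _)
    (≡.trans (cong₂ _++_ (pick-all edgeOf {nE H} _ _ λ _ → refl) (pick-none edgeOf {nV H} _ λ _ → refl)) (++-identityʳ _))

  nodes-toks : ∀ l es → mapMaybe nodeOf (toks l es) ≡ l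
  nodes-toks l es = ≡.trans (mapMaybe-++ nodeOf (map node l) (map tok es))
    (≡.trans (cong₂ _++_ (≡.trans (mapMaybe-map nodeOf node l) (mapMaybe-just l))
      (≡.trans (mapMaybe-map nodeOf tok es) (mapMaybe-nothing es))) (++-identityʳ l))

  edges-toks : ∀ l es → mapMaybe edgeOf (toks l es) ≡ map (λ e → label e , tabulate (attached e)) es
  edges-toks l es = ≡.trans (mapMaybe-++ edgeOf (map node l) (map tok es))
    (cong₂ _++_ (≡.trans (mapMaybe-map edgeOf node l) (mapMaybe-nothing l)) (go es))
    where
    go : ∀ es → mapMaybe edgeOf (map tok es) ≡ map (λ e → label e , tabulate (attached e)) es
    go [] = refl
    go (e ∷ es) = cong (_ ∷_) (go es)

  At-tabulate : ∀ {l a v n} (h : Fin n → ℕ) → At l a v → l ≡ tabulate h → ∀ i → toℕ i ≡ a → h i ≡ v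
  At-tabulate h here eq zero refl = sym (proj₁ (∷-injective eq))
  At-tabulate h (there at) eq (suc i) refl = At-tabulate (h ∘ suc) at (proj₂ (∷-injective eq)) i refl

  module _ (H G : HG T X) (acc : Accepted (tabulate (toℕ ∘ ext H)) (graphToks H)) where
    open Accepted acc

    code : List ℕ
    code = length order ∷ length items ∷ labCode items ∷ posCode items ∷ encList (tabulate extPos) ∷ []

    -- By equality of the codes, node `i` of `G` corresponds to the `i`-th node read and hyperedge
    -- `e` to the `e`-th item. Since the tokens of `H` were read exactly once each, these
    -- correspondences are the bijections `πV` and `πE`. The code stores positions in `order`, and
    -- an `At` proof says which node of `H` stands there, which gives compatibility with attachments
    -- and external nodes.
    accepted-iso : encode G ≡ encList code → Iso G H
    accepted-iso G≡ with ∷⁵-injective (encList-inj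
      {nV G ∷ nE G ∷ encList (tabulate (toℕ ∘ lab G)) ∷ encList (tabulate (λ e → encList (tabulate (toℕ ∘ att G e))))
        ∷ encList (tabulate (toℕ ∘ ext G)) ∷ []} {code} G≡)
    ... | V≡ , E≡ , lab≡′ , att≡′ , ext≡′ with untabulate order (nV G) V≡ | untabulate items (nE G) E≡
    ... | nd , order≡ | it , items≡ = record
      { isoV = πV ; isoE = πE ; lab≡ = labels ; att≡ = attachments
      ; ext≡ = λ i → toℕ-injective (≡.trans (tabulate-≗ (toℕ ∘ ext H) extNode extNode≡ i)
          (≡.trans (sym (At-tabulate nd (extAt i) order≡ (ext G i)
            (tabulate-≗ (toℕ ∘ ext G) extPos (encList-inj {tabulate (toℕ ∘ ext G)} {tabulate extPos} ext≡′) i)))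
            (sym (πV-≡ (ext G i)))))
      }
      where
      permV : tabulate nd ↭ tabulate toℕ
      permV = ↭-trans (↭-reflexive (≡.trans (sym order≡) (sym (nodes-toks order items))))
        (↭-trans (mapMaybe-↭ nodeOf (↭-sym tokens)) (↭-reflexive (nodes-graphToks H)))
      πV = proj₁ (tabulate-↭ nd toℕ permV)
      πV-≡ = proj₂ (tabulate-↭ nd toℕ permV)

      itemKey : ∀ {l} → Item l → Fin (size T) × List ℕ
      itemKey e = label e , tabulate (attached e)
      edgeKey : Fin (nE H) → Fin (size T) × List ℕ
      edgeKey e = lab H e , tabulate (toℕ ∘ att H e)
      permE : tabulate (itemKey ∘ it) ↭ tabulate edgeKey
      permE = ↭-trans (↭-reflexive (≡.trans (sym (map-tabulate it itemKey))
          (≡.trans (cong (map itemKey) (sym items≡)) (sym (edges-toks order items)))))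
        (↭-trans (mapMaybe-↭ edgeOf (↭-sym tokens)) (↭-reflexive (edges-graphToks H)))
      πE = proj₁ (tabulate-↭ (itemKey ∘ it) edgeKey permE)
      πE-≡ = proj₂ (tabulate-↭ (itemKey ∘ it) edgeKey permE)

      itemLabel : ∀ e → lab G e ≡ label (it e)
      itemLabel e = toℕ-injective (tabulate-≗ (toℕ ∘ lab G) (toℕ ∘ label ∘ it) (≡.trans
        (encList-inj {tabulate (toℕ ∘ lab G)} {map (toℕ ∘ label) items} lab≡′)
        (≡.trans (cong (map (toℕ ∘ label)) items≡) (map-tabulate it (toℕ ∘ label)))) e)

      itemPositions : ∀ e → tabulate (toℕ ∘ att G e) ≡ tabulate (positions (it e))
      itemPositions e = encList-inj {tabulate (toℕ ∘ att G e)} {tabulate (positions (it e))}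
        (tabulate-≗ (λ e → encList (tabulate (toℕ ∘ att G e))) (λ e → encList (tabulate (positions (it e)))) (≡.trans
          (encList-inj {tabulate (λ e → encList (tabulate (toℕ ∘ att G e)))} {map (λ e → encList (tabulate (positions e))) items} att≡′)
          (≡.trans (cong (map (λ e → encList (tabulate (positions e)))) items≡) (map-tabulate it _))) e)

      labels : ∀ e → lab H (Inverse.to πE e) ≡ lab G e
      labels e = ≡.trans (cong proj₁ (πE-≡ e)) (sym (itemLabel e))

      attachments : ∀ e i → att H (Inverse.to πE e) (cast (cong (λ c → length (type T c)) (sym (labels e))) i)
        ≡ Inverse.to πV (att G e i)
      -- The cast from the label in `G` to that in `H` is factored through the label of the item:
      -- positions agree along `eq₁`, attachment nodes along `eq₂`.
      attachments e i = toℕ-injective (≡.trans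
        (cong (toℕ ∘ att H (Inverse.to πE e)) (sym (cast-trans eq₁ eq₂ i)))
        (≡.trans (sym (tabulate-≡ (attached (it e)) (toℕ ∘ att H (Inverse.to πE e)) (sym (cong proj₂ (πE-≡ e))) eq₂ (cast eq₁ i)))
          (≡.trans (sym (At-tabulate nd (at (it e) (cast eq₁ i)) order≡ (att G e i)
            (tabulate-≡ (toℕ ∘ att G e) (positions (it e)) (itemPositions e) eq₁ i))) (sym (πV-≡ (att G e i))))))
        where
        eq₁ : length (type T (lab G e)) ≡ length (type T (label (it e)))
        eq₁ = cong (λ c → length (type T c)) (itemLabel e)
        eq₂ : length (type T (label (it e))) ≡ length (type T (lab H (Inverse.to πE e)))
        eq₂ = cong (λ c → length (type T c)) (sym (cong proj₁ (πE-≡ e)))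

  -- The hypergraph `G` whose code was computed is not constructed from the reading: `f` halts only
  -- on codes of members of `L`, and this supplies `G` together with its membership, which the
  -- isomorphism carries over to `H`.
  InL⇒L : (L : HG T X → Set) → IsoClosed L → (∀ n → (∃ λ y → f [ n ∷ [] ]↓ y) → Σ[ H ∈ HG T X ] (encode H ≡ n × L H)) →
    ∀ H → InL grammar H → L H
  InL⇒L L iso f-sound H H∈ =
    let acc = InL⇒Accepted H H∈
        G , G≡ , G∈ = f-sound (encList (code H H acc)) (Accepted.halts acc)
    in iso G H (accepted-iso H G acc G≡) G∈

zeroF : Var → Fm 0
zeroF x = atom (symCode zeroS) (fv x ∷ [])

sucF : Var → Var → Fm 0
sucF x y = atom (symCode sucS) (fv x ∷ fv y ∷ [])

consF : Var → Var → Var → Fm 0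
consF v l l′ = atom (symCode consS) (fv v ∷ fv l ∷ fv l′ ∷ [])

-- Derivability of the graph of a partial recursive function, where φ names the numbers
module Evaluate (Ψ : ℕ → Ctx) (step : ∀ N {Δ C} → Ψ N ∣ Δ ⊩ C → Ψ (suc N) ∣ Δ ⊩ C) (φ : ℕ → Var)
  (zero-known : ∀ N → zeroF (φ 0) ∈ Ψ N) (suc-known : ∀ N → sucF (φ N) (φ (suc N)) ∈ Ψ (suc N)) where
  open Stages Ψ step public

  zero∞ : [] ⊪ zeroF (φ 0)
  zero∞ = 0 , reuse (zero-known 0)

  suc∞ : ∀ k → [] ⊪ sucF (φ k) (φ (suc k))
  suc∞ k = suc k , reuse (suc-known k)

  Known : List Axiom → Set
  Known as = ∀ {a} → a ∈ as → ∀ N → axiomFm a ∈ Ψ N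

  predF : Sym → ∀ {n} → ℕ → Vec ℕ n → Fm 0
  predF s y xs = atom (symCode s) (fv (φ y) ∷ tabulate (fv ∘ φ ∘ lookupV xs))

  predF-≡ : ∀ s {n k} (ρ : Fin k → Var) y (xs : Fin n → Fin k) v us → ρ y ≡ φ v → (∀ i → ρ (xs i) ≡ φ (lookupV us i)) →
    hatom (fv ∘ ρ) (symCode s , y ∷ tabulate xs) ≡ predF s v us
  predF-≡ s ρ y xs v us eq eqs = cong (atom (symCode s)) (cong₂ _∷_ (cong fv eq)
    (≡.trans (map-tabulate xs (fv ∘ ρ)) (tabulate-cong (cong fv ∘ eqs))))

  into : ∀ s {n k Δ} (ρ : Fin k → Var) y (xs : Fin n → Fin k) v us → ρ y ≡ φ v → (∀ i → ρ (xs i) ≡ φ (lookupV us i)) →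
    Δ ⊪ predF s v us → Δ ⊪ hatom (fv ∘ ρ) (symCode s , y ∷ tabulate xs)
  into s {Δ = Δ} ρ y xs v us eq eqs = subst (Δ ⊪_) (sym (predF-≡ s ρ y xs v us eq eqs))

  outof : ∀ s {n k Δ} (ρ : Fin k → Var) y (xs : Fin n → Fin k) v us → ρ y ≡ φ v → (∀ i → ρ (xs i) ≡ φ (lookupV us i)) →
    Δ ⊪ hatom (fv ∘ ρ) (symCode s , y ∷ tabulate xs) → Δ ⊪ predF s v us
  outof s {Δ = Δ} ρ y xs v us eq eqs = subst (Δ ⊪_) (predF-≡ s ρ y xs v us eq eqs)

  -- Induction on the evaluation: each step is an instance of one axiom, whose variables are sent to
  -- the names `φ k` of the values involved. Intermediate values can be arbitrarily large, which is
  -- why derivability is claimed only at some stage.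
  evaluate : ∀ {n} (g : PR n) → Known (prAxioms g) → ∀ {xs y} → g [ xs ]↓ y → [] ⊪ predF (evalS n g) y xs
  evaluate* : ∀ {n m k} (gs : Vec (PR n) m) → Known (prAxioms* gs) → (ρ : Fin k → Var) →
    ∀ ys xs us vs {bs Δ} → (∀ i → ρ (ys i) ≡ φ (lookupV vs i)) → (∀ i → ρ (xs i) ≡ φ (lookupV us i)) → gs [ us ]↓* vs →
    Premises∞ (map (hatom (fv ∘ ρ)) bs) Δ → Premises∞ (map (hatom (fv ∘ ρ)) (argsA gs ys xs ++ bs)) Δ
  bounded : ∀ {n} (g : PR (suc n)) → Known (prAxioms (Mu g)) → ∀ {xs} y → (∀ z → z < y → ∃ λ w → g [ z ∷ xs ]↓ suc w) →
    [] ⊪ predF (boundS n g) y xs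
  evaluate {n} Z known {xs} eZ = outof (evalS n Z) ρ #0 suc 0 xs refl (λ _ → refl)
    (apply∞ (zAxiom _) (known (here refl)) ρ (zero∞ ∷ []))
    where ρ = φ ∘ (0 ◂ lookupV xs)
  evaluate S known (eS {x}) = outof (evalS 1 S) ρ #1 (λ _ → #0) (suc x) (x ∷ []) refl (λ { zero → refl })
    (apply∞ sAxiom (known (here refl)) ρ (suc∞ x ∷ []))
    where ρ = φ ∘ (x ◂ suc x ◂ λ ())
  evaluate {n} (P i) known {xs} (eP .i) = outof (evalS n (P i)) ρ i (λ j → j) (lookupV xs i) xs refl (λ _ → refl)
    (apply∞ (pAxiom i) (known (here refl)) ρ [])
    where ρ = φ ∘ lookupV xs
  evaluate {n} (Comp {m} g gs) known {xs} {y} (eComp {ys = ys} ds d) =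
    outof (evalS n (Comp g gs)) ρ #0 xi y xs refl xi-≡
      (apply∞ (compAxiom g gs) (known (here refl)) ρ
        (evaluate* gs (known ∘ there ∘ ∈-++⁺ʳ (prAxioms g)) ρ yi xi xs ys yi-≡ xi-≡ ds
          (into (evalS m g) ρ #0 yi y ys refl yi-≡ (evaluate g (known ∘ there ∘ ∈-++⁺ˡ) d) ∷ [])))
    where
    ρ : Fin (suc (m + n)) → Var
    ρ = φ ∘ (y ◂ [ lookupV ys , lookupV xs ]′ ∘ splitAt m)
    yi : Fin m → Fin (suc (m + n))
    yi j = suc (j ↑ˡ n)
    xi : Fin n → Fin (suc (m + n))
    xi i = suc (m ↑ʳ i)
    yi-≡ : ∀ j → ρ (yi j) ≡ φ (lookupV ys j)
    yi-≡ j = cong (φ ∘ [ lookupV ys , lookupV xs ]′) (splitAt-↑ˡ m j n)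
    xi-≡ : ∀ i → ρ (xi i) ≡ φ (lookupV xs i)
    xi-≡ i = cong (φ ∘ [ lookupV ys , lookupV xs ]′) (splitAt-↑ʳ m n i)
  evaluate {suc n} (Rec g h) known {_ ∷ xs} {y} (eRec0 d) =
    outof (evalS (suc n) (Rec g h)) ρ #1 (#0 ◂ xi) y (0 ∷ xs) refl (λ { zero → refl ; (suc i) → refl })
      (apply∞ (recZeroAxiom g h) (known (here refl)) ρ
        (zero∞ ∷ into (evalS n g) ρ #1 xi y xs refl (λ _ → refl) (evaluate g (known ∘ there ∘ there ∘ ∈-++⁺ˡ) d) ∷ []))
    where
    ρ = φ ∘ (0 ◂ y ◂ lookupV xs)
    xi : Fin n → Fin (2 + n)
    xi i = suc (suc i)
  evaluate {suc n} (Rec g h) known {_ ∷ xs} {z} (eRecS {k = k} {y = y} d d′) =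
    outof (evalS (suc n) (Rec g h)) ρ #3 (#1 ◂ xi) z (suc k ∷ xs) refl (λ { zero → refl ; (suc i) → refl })
      (apply∞ (recSucAxiom g h) (known (there (here refl))) ρ
        ( into (evalS (suc n) (Rec g h)) ρ #2 (#0 ◂ xi) y (k ∷ xs) refl (λ { zero → refl ; (suc i) → refl }) (evaluate (Rec g h) known d)
        ∷ into (evalS (2 + n) h) ρ #3 (#0 ◂ #2 ◂ xi) z (k ∷ y ∷ xs) refl (λ { zero → refl ; (suc zero) → refl ; (suc (suc i)) → refl })
            (evaluate h (known ∘ there ∘ there ∘ ∈-++⁺ʳ (prAxioms g)) d′)
        ∷ suc∞ k ∷ []))
    where
    ρ = φ ∘ (k ◂ suc k ◂ y ◂ z ◂ lookupV xs)
    xi : Fin n → Fin (4 + n)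
    xi i = suc (suc (suc (suc i)))
  evaluate {n} (Mu g) known {xs} {y} (eMu d ds) = outof (evalS n (Mu g)) ρ #0 xi y xs refl (λ _ → refl)
    (apply∞ (muAxiom g) (known (there (there (here refl)))) ρ
      ( into (boundS n g) ρ #0 xi y xs refl (λ _ → refl) (bounded g known y ds)
      ∷ zero∞
      ∷ into (evalS (suc n) g) ρ #1 (#0 ◂ xi) 0 (y ∷ xs) refl (λ { zero → refl ; (suc i) → refl })
          (evaluate g (known ∘ there ∘ there ∘ there) d)
      ∷ []))
    where
    ρ = φ ∘ (y ◂ 0 ◂ lookupV xs)
    xi : Fin n → Fin (2 + n)
    xi i = suc (suc i)
  evaluate* [] known ρ ys xs us vs eqy eqx e[] rest = rest
  evaluate* {n} (g ∷ gs) known ρ ys xs us (v ∷ vs) eqy eqx (e∷ d ds) rest =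
    into (evalS n g) ρ (ys zero) xs v us (eqy zero) eqx (evaluate g (known ∘ ∈-++⁺ˡ) d)
    ∷ evaluate* gs (known ∘ ∈-++⁺ʳ (prAxioms g)) ρ (ys ∘ suc) xs us vs (eqy ∘ suc) eqx ds rest
  bounded {n} g known {xs} zero ds = outof (boundS n g) ρ #0 suc 0 xs refl (λ _ → refl)
    (apply∞ (boundZeroAxiom g) (known (here refl)) ρ (zero∞ ∷ []))
    where ρ = φ ∘ (0 ◂ lookupV xs)
  bounded {n} g known {xs} (suc y) ds with ds y ≤-refl
  ... | w , d = outof (boundS n g) ρ #1 xi (suc y) xs refl (λ _ → refl)
    (apply∞ (boundSucAxiom g) (known (there (here refl))) ρ
      ( into (boundS n g) ρ #0 xi y xs refl (λ _ → refl) (bounded g known y λ z z<y → ds z (m<n⇒m<1+n z<y))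
      ∷ into (evalS (suc n) g) ρ #3 (#0 ◂ xi) (suc w) (y ∷ xs) refl (λ { zero → refl ; (suc i) → refl })
          (evaluate g (known ∘ there ∘ there ∘ there) d)
      ∷ suc∞ w ∷ suc∞ y ∷ []))
    where
    ρ = φ ∘ (y ◂ suc y ◂ w ◂ suc w ◂ lookupV xs)
    xi : Fin n → Fin (4 + n)
    xi i = suc (suc (suc (suc i)))

-- Derivations for the hypergraphs on whose code the function halts

module Completeness (x• : Var) (T : Alphabet) (X : List Var) (X-unique : Unique X) (f : PR 1) (H : HG T X) where
  open Reading T X f
  open Universal x• T X X-unique f

  vertices : List ℕ
  vertices = tabulate (toℕ {nV H})

  -- The variables below nV H name the nodes; listVar l names the list l, which is always a
  -- suffix of vertices, and φ k names the number k.
  listVar : List ℕ → Var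
  listVar l = nV H + length l

  -- Only `vertices` and its tails need names, because the nodes will be read in this order. The
  -- empty list gets a name of its own, from a use of `existsZero` other than the one that yields
  -- `φ 0`.
  listFacts : List ℕ → Ctx
  listFacts [] = zeroF (listVar []) ∷ theory
  listFacts (v ∷ l) = consF v (listVar l) (listVar (v ∷ l)) ∷ listFacts l

  φ : ℕ → Var
  φ k = suc (listVar vertices + k)

  Ψ : ℕ → Ctx
  Ψ zero = zeroF (φ 0) ∷ listFacts vertices
  Ψ (suc N) = sucF (φ N) (φ (suc N)) ∷ Ψ N

  listFacts⊆Ψ : ∀ N {A} → A ∈ listFacts vertices → A ∈ Ψ N
  listFacts⊆Ψ zero m = there m
  listFacts⊆Ψ (suc N) m = there (listFacts⊆Ψ N m)

  theory⊆listFacts : ∀ l {A} → A ∈ theory → A ∈ listFacts l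
  theory⊆listFacts [] m = there m
  theory⊆listFacts (v ∷ l) m = there (theory⊆listFacts l m)

  zero-known : ∀ N → zeroF (φ 0) ∈ Ψ N
  zero-known zero = here refl
  zero-known (suc N) = there (zero-known N)

  open Evaluate Ψ (λ _ → !W) φ zero-known (λ _ → here refl)

  axiom-known : ∀ {a} → a ∈ axioms → ∀ N → axiomFm a ∈ Ψ N
  axiom-known m N = listFacts⊆Ψ N (theory⊆listFacts vertices (there (there (there (∈-map⁺ axiomFm m)))))

  label-known : ∀ c {a} → a ∈ labelAxioms c → ∀ N → axiomFm a ∈ Ψ N
  label-known c m = axiom-known (there (there (there (there (there (there
    (∈-++⁺ʳ (prAxioms acceptPR) (∈-concat⁺′ m (∈-tabulate⁺ c)))))))))

  known∞ : ∀ {A} → A ∈ listFacts vertices → [] ⊪ A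
  known∞ m = 0 , reuse (listFacts⊆Ψ 0 m)

  linear∞ : ∀ {A} → A ∷ [] ⊪ A
  linear∞ {A} = 0 , linear {Ψ 0}

  queueF : Var → Var → Fm 0
  queueF l n = atom (symCode queueS) (fv l ∷ fv n ∷ [])

  posF : Var → Var → Var → Fm 0
  posF l v a = atom (symCode posS) (fv l ∷ fv v ∷ fv a ∷ [])

  readF : Var → Var → Var → Var → Var → Fm 0
  readF l n j ls as = atom (symCode readS) (fv l ∷ fv n ∷ fv j ∷ fv ls ∷ fv as ∷ [])

  Suffix : List ℕ → Set
  Suffix l = ∀ {A} → A ∈ listFacts l → A ∈ listFacts vertices

  nil-fact : ∀ l → zeroF (listVar []) ∈ listFacts l
  nil-fact [] = here refl
  nil-fact (v ∷ l) = there (nil-fact l)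

  -- Lists grow at the front, so the last node is consumed first. The final list is then `vertices`
  -- in its canonical order, in which the position of a node equals the node, as `vertex∞` uses.
  queue∞ : ∀ l → Suffix l → map nodeFm l ⊪ queueF (listVar l) (φ (length l))
  queue∞ [] sub = apply∞ queueZeroAxiom (axiom-known (there (there (here refl)))) (listVar [] ◂ φ 0 ◂ λ ())
    (known∞ (nil-fact vertices) ∷ zero∞ ∷ [])
  queue∞ (v ∷ l) sub = subst (λ Δ → nodeFm v ∷ Δ ⊪ queueF (listVar (v ∷ l)) (φ (suc (length l)))) (++-identityʳ (map nodeFm l))
    (apply∞ queueSucAxiom (axiom-known (there (there (there (here refl)))))
      (v ◂ listVar l ◂ listVar (v ∷ l) ◂ φ (length l) ◂ φ (suc (length l)) ◂ λ ())
      (known∞ (sub (here refl)) ∷ suc∞ (length l) ∷ linear∞ ∷ queue∞ l (sub ∘ there) ∷ []))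

  pos∞ : ∀ {l a v} → Suffix l → At l a v → [] ⊪ posF (listVar l) v (φ a)
  pos∞ {v ∷ l} sub here = apply∞ posZeroAxiom (axiom-known (here refl)) (v ◂ listVar l ◂ listVar (v ∷ l) ◂ φ 0 ◂ λ ())
    (known∞ (sub (here refl)) ∷ zero∞ ∷ [])
  pos∞ {w ∷ l} {suc a} {v} sub (there at) = apply∞ posSucAxiom (axiom-known (there (here refl)))
    (w ◂ listVar l ◂ listVar (w ∷ l) ◂ φ a ◂ φ (suc a) ◂ v ◂ λ ())
    (known∞ (sub (here refl)) ∷ suc∞ a ∷ pos∞ (sub ∘ there) at ∷ [])

  At-tab : ∀ {n} (h : Fin n → ℕ) i → At (tabulate h) (toℕ i) (h i)
  At-tab h zero = here
  At-tab h (suc i) = there (At-tab (h ∘ suc) i)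

  vertex∞ : (v : Fin (nV H)) → [] ⊪ posF (listVar vertices) (toℕ v) (φ (toℕ v))
  vertex∞ v = pos∞ (λ m → m) (At-tab toℕ v)

  positions∞ : ∀ {n Δ} (ρ : Fin n → Var) l {k} (vs as : Fin k → Fin n) (a : Fin k → Fin (nV H)) {bs : List (HAtom n)} →
    ρ l ≡ listVar vertices → (∀ i → ρ (vs i) ≡ toℕ (a i)) → (∀ i → ρ (as i) ≡ φ (toℕ (a i))) →
    Premises∞ (map (hatom (fv ∘ ρ)) bs) Δ → Premises∞ (map (hatom (fv ∘ ρ)) (tabulate (λ i → posA l (vs i) (as i)) ++ bs)) Δ
  positions∞ ρ l {zero} vs as a eql eqv eqa rest = rest
  positions∞ ρ l {suc k} vs as a eql eqv eqa rest =
    subst ([] ⊪_) (cong₂ _⊙_ (≡.cong₂ _,_ (sym eql) (sym (eqv zero))) (sym (eqa zero))) (vertex∞ (a zero))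
    ∷ positions∞ ρ l (vs ∘ suc) (as ∘ suc) (a ∘ suc) eql (eqv ∘ suc) (eqa ∘ suc) rest
    where
    _⊙_ : Var × Var → Var → Fm 0
    (l , v) ⊙ a = posF l v a

  labs atts : ∀ {n} → (Fin n → Fin (nE H)) → ℕ
  labs g = encList (tabulate (toℕ ∘ lab H ∘ g))
  atts g = encList (tabulate (λ e → encList (tabulate (toℕ ∘ att H (g e)))))

  -- Codes also grow at the front: the first hyperedge listed by `g` is read last. With the identity
  -- for `g` the two codes are literally those in `encode H`, whereas the induction passes to tails
  -- of the enumeration.
  read∞ : ∀ n (g : Fin n → Fin (nE H)) → tabulate (edgeFm H ∘ g) ++ map nodeFm vertices ⊪
    readF (listVar vertices) (φ (length vertices)) (φ n) (φ (labs g)) (φ (atts g))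
  read∞ zero g = subst (_⊪ readF (listVar vertices) (φ (length vertices)) (φ 0) (φ 0) (φ 0)) (++-identityʳ (map nodeFm vertices))
    (apply∞ readZeroAxiom (axiom-known (there (there (there (there (here refl))))))
      (listVar vertices ◂ φ (length vertices) ◂ φ 0 ◂ λ ()) (zero∞ ∷ queue∞ vertices (λ m → m) ∷ []))
  read∞ (suc n) g = subst (λ Δ → edgeFm H (g zero) ∷ Δ ⊪ goal) (++-identityʳ (tabulate (edgeFm H ∘ g ∘ suc) ++ map nodeFm vertices))
    (apply∞ (readSucAxiom c) (label-known c (here refl)) ρ
      (positions∞ ρ #0 vs as a refl vs-≡ as-≡
        ( suc∞ n
        ∷ into (evalS 1 (prog (labelFn (toℕ c)))) ρ #6 (λ _ → #3) ls′ (ls ∷ []) refl (λ { zero → refl })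
            (evaluate (prog (labelFn (toℕ c))) (λ m → label-known c (there (∈-++⁺ˡ m))) (computes (labelFn (toℕ c)) (ls ∷ [])))
        ∷ into (evalS (suc k) (prog (attFn k))) ρ #7 (#4 ◂ as) as′ (as₀ ∷ Vec.tabulate (toℕ ∘ a)) refl
            (λ { zero → refl ; (suc i) → ≡.trans (as-≡ i) (cong φ (sym (lookupV-tabulate (toℕ ∘ a) i))) })
            (evaluate (prog (attFn k)) (λ m → label-known c (there (∈-++⁺ʳ (prAxioms (prog (labelFn (toℕ c)))) m)))
              (subst (prog (attFn k) [ as₀ ∷ Vec.tabulate (toℕ ∘ a) ]↓_)
                (cong (λ l → consℕ (encList l) as₀) (toList-tabulate (toℕ ∘ a)))
                (computes (attFn k) (as₀ ∷ Vec.tabulate (toℕ ∘ a)))))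
        ∷ subst (edgeFm H (g zero) ∷ [] ⊪_)
            (cong (atom (symCode (edgeS (toℕ c)))) (sym (≡.trans (map-tabulate vs (fv ∘ ρ)) (tabulate-cong (cong fv ∘ vs-≡))))) linear∞
        ∷ read∞ n (g ∘ suc)
        ∷ [])))
    where
    c = lab H (g zero)
    a = att H (g zero)
    open ReadSuc c
    ls = labs (g ∘ suc)
    as₀ = atts (g ∘ suc)
    ls′ = labs g
    as′ = atts g
    goal = readF (listVar vertices) (φ (length vertices)) (φ (suc n)) (φ ls′) (φ as′)
    ρ : Fin (8 + (k + k)) → Var
    ρ = listVar vertices ◂ φ (length vertices) ◂ φ n ◂ φ ls ◂ φ as₀ ◂ φ (suc n) ◂ φ ls′ ◂ φ as′
      ◂ [ toℕ ∘ a , φ ∘ toℕ ∘ a ]′ ∘ splitAt k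
    vs-≡ : ∀ i → ρ (vs i) ≡ toℕ (a i)
    vs-≡ i = cong [ toℕ ∘ a , φ ∘ toℕ ∘ a ]′ (splitAt-↑ˡ k i k)
    as-≡ : ∀ i → ρ (as i) ≡ φ (toℕ (a i))
    as-≡ i = cong [ toℕ ∘ a , φ ∘ toℕ ∘ a ]′ (splitAt-↑ʳ k k i)

  acceptStep : ∀ {Δ} n j ls as y → acceptPR [ n ∷ j ∷ ls ∷ as ∷ Vec.tabulate (toℕ ∘ ext H) ]↓ y →
    Δ ⊪ readF (listVar vertices) (φ n) (φ j) (φ ls) (φ as) → Δ ++ [] ⊪ acceptFm (toℕ ∘ ext H)
  acceptStep {Δ} n j ls as y d r = subst (Δ ++ [] ⊪_)
    (cong (atom (symCode acceptS)) (≡.trans (map-tabulate xs (fv ∘ ρ)) (tabulate-cong (cong fv ∘ xs-≡))))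
    (apply∞ acceptAxiom (axiom-known (there (there (there (there (there (here refl))))))) ρ
      (positions∞ ρ #0 xs bs (ext H) refl xs-≡ bs-≡
        ( into (evalS (4 + m) acceptPR) ρ #5 (#1 ◂ #2 ◂ #3 ◂ #4 ◂ bs) y (n ∷ j ∷ ls ∷ as ∷ Vec.tabulate (toℕ ∘ ext H)) refl
            (λ { #0 → refl ; #1 → refl ; #2 → refl ; #3 → refl
               ; (suc (suc (suc (suc i)))) → ≡.trans (bs-≡ i) (cong φ (sym (lookupV-tabulate (toℕ ∘ ext H) i))) })
            (evaluate acceptPR (λ m → axiom-known (there (there (there (there (there (there (∈-++⁺ˡ m)))))))) d)
        ∷ r
        ∷ [])))
    where
    open Accept
    ρ : Fin (6 + (m + m)) → Var
    ρ = listVar vertices ◂ φ n ◂ φ j ◂ φ ls ◂ φ as ◂ φ y ◂ [ toℕ ∘ ext H , φ ∘ toℕ ∘ ext H ]′ ∘ splitAt m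
    xs-≡ : ∀ i → ρ (xs i) ≡ toℕ (ext H i)
    xs-≡ i = cong [ toℕ ∘ ext H , φ ∘ toℕ ∘ ext H ]′ (splitAt-↑ˡ m i m)
    bs-≡ : ∀ i → ρ (bs i) ≡ φ (toℕ (ext H i))
    bs-≡ i = cong [ toℕ ∘ ext H , φ ∘ toℕ ∘ ext H ]′ (splitAt-↑ʳ m m i)

  acceptPR-↓ : ∀ {n y} {bs : Vec ℕ (length X)} n′ bs′ j ls as → n ≡ n′ → Vec.toList bs ≡ bs′ →
    f [ encList (n′ ∷ j ∷ ls ∷ as ∷ encList bs′ ∷ []) ∷ [] ]↓ y → acceptPR [ n ∷ j ∷ ls ∷ as ∷ bs ]↓ y
  acceptPR-↓ {n} {bs = bs} _ _ j ls as refl refl d = eComp (e∷ (computes (graphFn (length X)) (n ∷ j ∷ ls ∷ as ∷ bs)) e[]) d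

  accept∞ : (∃ λ y → f [ encode H ∷ [] ]↓ y) → graphCtx H ⊪ acceptFm (toℕ ∘ ext H)
  accept∞ (y , d) = subst (_⊪ acceptFm (toℕ ∘ ext H))
    (≡.trans (++-identityʳ _) (cong (tabulate (edgeFm H) ++_) (map-tabulate toℕ nodeFm)))
    (acceptStep (length vertices) (nE H) (labs λ e → e) (atts λ e → e) y
      (acceptPR-↓ (nV H) (tabulate (toℕ ∘ ext H)) (nE H) (labs λ e → e) (atts λ e → e) (length-tabulate (toℕ {nV H})) (toList-tabulate (toℕ ∘ ext H)) d)
      (read∞ (nE H) (λ e → e)))

  -- Every fact introduces one new variable, so the facts can be removed one by one from Ψ N.

  Below : Var → List Var → Set
  Below y = All (_< y)

  below-mono : ∀ {y z xs} → y ≤ z → Below y xs → Below z xs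
  below-mono y≤z = All.map λ x<y → <-≤-trans x<y y≤z

  below-∉ : ∀ {y xs} → Below y xs → y ∉ xs
  below-∉ b y∈ = <-irrefl refl (All.lookup b y∈)

  FVs-++ : ∀ Γ Δ {y} → Below y (FVs Γ) → Below y (FVs Δ) → Below y (FVs (Γ ++ Δ))
  FVs-++ Γ Δ b b′ = subst (Below _) (sym (concatMap-++ FV Γ Δ)) (AllP.++⁺ b b′)

  theory-below : ∀ {y} → Below y (FVs theory)
  theory-below = go theory theoryClosed
    where
    go : ∀ {y} Γ → All (λ A → FV A ≡ []) Γ → Below y (FVs Γ)
    go [] [] = []
    go (A ∷ Γ) (eq ∷ eqs) rewrite eq = go Γ eqs

  listFacts-below : ∀ l → Below (nV H) l → Below (suc (listVar l)) (FVs (listFacts l))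
  listFacts-below [] [] = ≤-refl ∷ theory-below
  listFacts-below (v ∷ l) (v< ∷ l<) = ≤-trans v< (≤-trans (m≤m+n (nV H) (suc (length l))) (n≤1+n _))
    ∷ s≤s (+-monoʳ-≤ (nV H) (n≤1+n (length l))) ∷ ≤-refl
    ∷ below-mono (s≤s (+-monoʳ-≤ (nV H) (n≤1+n (length l)))) (listFacts-below l l<)

  vertices-below : Below (nV H) vertices
  vertices-below = AllP.tabulate⁺ toℕ<n

  φ-suc : ∀ k → φ (suc k) ≡ suc (φ k)
  φ-suc k = cong suc (+-suc (listVar vertices) k)

  φ-≥ : ∀ k → suc (listVar vertices) ≤ φ k
  φ-≥ k = s≤s (m≤m+n (listVar vertices) k)

  -- The freshness of the next name: the variables of stage `N` are at most `φ N`, and `φ (suc N)`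
  -- is the successor of that.
  Ψ-below : ∀ N → Below (suc (φ N)) (FVs (Ψ N))
  Ψ-below zero = ≤-refl ∷ below-mono (≤-trans (φ-≥ 0) (n≤1+n _)) (listFacts-below vertices vertices-below)
  Ψ-below (suc N) rewrite φ-suc N = n≤1+n _ ∷ ≤-refl ∷ below-mono (n≤1+n _) (Ψ-below N)

  module _ {Δ : Ctx} {C : Fm 0} (Δ-below : Below (nV H) (FVs Δ)) (C-below : Below (nV H) (FV C)) where

    -- All names lie at or above `nV H`, whereas the linear context and the conclusion mention nodes
    -- only. The eigenvariable condition is thus reduced to `Γ` and `B`.
    open-fact : ∀ {Γ y} (B : Fm 1) → nV H ≤ y → Below y (FVs Γ) → Below y (FV B) →
      Γ ∣ [] ⊩ ∃' (! B) → inst B y ∷ Γ ∣ Δ ⊩ C → Γ ∣ Δ ⊩ C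
    open-fact {Γ} {y} B le b b′ = open∃ {Γ} {Δ} B y (below-∉ (FVs-++ Γ Δ b (below-mono le Δ-below)))
      (below-∉ b′) (below-∉ (below-mono le C-below))

    close-list : ∀ l → Below (nV H) l → listFacts l ∣ Δ ⊩ C → theory ∣ Δ ⊩ C
    close-list [] [] d = open-fact (atom (symCode zeroS) (bv zero ∷ [])) (m≤m+n (nV H) 0) theory-below [] (reuse (here refl)) d
    close-list (v ∷ l) (v< ∷ l<) d = close-list l l< (open-fact (atom (symCode consS) (fv v ∷ fv (listVar l) ∷ bv zero ∷ []))
      (m≤m+n (nV H) (suc (length l)))
      (below-mono (≤-reflexive (sym (+-suc (nV H) (length l)))) (listFacts-below l l<))
      (≤-trans v< (m≤m+n (nV H) (suc (length l))) ∷ ≤-reflexive (sym (+-suc (nV H) (length l))) ∷ [])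
      (instantiate {listFacts l} {[]} (∃' (! atom (symCode consS) (fv v ∷ bv #1 ∷ bv #0 ∷ []))) (listVar l)
        (instantiate {listFacts l} {[]} (∀' (∃' (! atom (symCode consS) (bv #2 ∷ bv #1 ∷ bv #0 ∷ [])))) v
          (reuse (theory⊆listFacts l (there (there (here refl)))))))
      d)

    close : ∀ N → Ψ N ∣ Δ ⊩ C → theory ∣ Δ ⊩ C
    close zero d = close-list vertices vertices-below (open-fact (atom (symCode zeroS) (bv zero ∷ []))
      (≤-trans (m≤m+n (nV H) (length vertices)) (≤-trans (n≤1+n _) (φ-≥ 0)))
      (below-mono (φ-≥ 0) (listFacts-below vertices vertices-below)) []
      (reuse (theory⊆listFacts vertices (here refl))) d)
    close (suc N) d = close N (open-fact (atom (symCode sucS) (fv (φ N) ∷ bv zero ∷ []))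
      (≤-trans (m≤m+n (nV H) (length vertices)) (≤-trans (n≤1+n _) (φ-≥ (suc N))))
      (below-mono (≤-reflexive (sym (φ-suc N))) (Ψ-below N)) (≤-reflexive (sym (φ-suc N)) ∷ [])
      (instantiate {Ψ N} {[]} (∃' (! atom (symCode sucS) (bv #1 ∷ bv #0 ∷ []))) (φ N)
        (reuse (listFacts⊆Ψ N (theory⊆listFacts vertices (there (here refl))))))
      d)

  fvs-below : ∀ {k} (xs : Fin k → Fin (nV H)) → Below (nV H) (concatMap fvT (tabulate (fv {0} ∘ toℕ ∘ xs)))
  fvs-below {zero} xs = []
  fvs-below {suc k} xs = toℕ<n (xs zero) ∷ fvs-below (xs ∘ suc)

  graphCtx-below : Below (nV H) (FVs (graphCtx H))
  graphCtx-below = FVs-++ (tabulate (edgeFm H)) (tabulate (nodeFm ∘ toℕ))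
    (go _ λ e → fvs-below (att H e)) (go _ λ v → toℕ<n v ∷ [])
    where
    go : ∀ {n} (F : Fin n → Fm 0) → (∀ i → Below (nV H) (FV (F i))) → Below (nV H) (FVs (tabulate F))
    go {zero} F b = []
    go {suc n} F b = AllP.++⁺ (b zero) (go (F ∘ suc) (b ∘ suc))

  ⊢⇒InL : graphCtx H ⊢ impls theory (acceptFm (toℕ ∘ ext H)) → InL grammar H
  ⊢⇒InL d = (λ _ → nodeRule) , (λ e → edgeRule (lab H e)) , (λ _ → here refl) , (λ e → there (∈-tabulate⁺ (lab H e))) ,
    ≡.subst₂ _⊢_ (sym (cong₂ _++_ (tabulate-cong (ren-edgeRule H)) (tabulate-cong (ren-nodeRule ∘ toℕ))))
      (sym (ren-start (toℕ ∘ ext H))) d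

  halts⇒InL : (∃ λ y → f [ encode H ∷ [] ]↓ y) → InL grammar H
  halts⇒InL halts = let N , d = accept∞ halts in
    ⊢⇒InL (impls-intro theory (close graphCtx-below (fvs-below (ext H)) N d))

theorem23 : (x• : ℕ) (T : Alphabet) (X : List ℕ) → Unique X →
    (L : HG T X → Set) → IsoClosed L →
    (Σ[ G ∈ Grammar x• T X ] Generates G L) ⇔ RE L
theorem23 x• T X X-unique L iso = mk⇔
  (λ (G , gen) → GrammarRE.generated⇒RE G L gen)
  (λ (f , f-correct) → Universal.grammar x• T X X-unique f , λ H → mk⇔
    (λ H∈ → Completeness.halts⇒InL x• T X X-unique f H (Equivalence.to (f-correct (encode H)) (H , refl , H∈)))
    (Universal.InL⇒L x• T X X-unique f L iso (λ n → Equivalence.from (f-correct n)) H))
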